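{- Let $p<q$ be primes. For every positive integer $b$, $p \mid \mathrm{B}(pq^{b})$.
   Context: The height $\mathrm{H}(f)$ of a polynomial $f\in\mathbb{Z}[x]$ is the largest absolute value of its coefficients. For a positive integer $n$, $\mathrm{B}(n):=\max\{\mathrm{H}(f) : f\in\mathbb{Z}[x],\ f \mid x^{n}-1\}$. -}

module Defs where

open import Data.Empty using (⊥-elim)
open import Data.Integer as ℤ using (ℤ; +_; -[1+_]; 0ℤ; 1ℤ; -1ℤ; ∣_∣)
import Data.Integer.Properties as ℤₚ
open import Data.Integer.Tactic.RingSolver using (solve-∀)
open import Data.List using (List; []; _∷_; _++_; [_]; map; replicate; length; filter; upTo;
  cartesianProduct; cartesianProductWith; applyUpTo)
open import Data.List.Extrema.Nat using (max; xs≤max; max≤v⁺; argmax; argmax-all; f[xs]≤f[argmax])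
open import Data.List.Membership.Propositional using (_∈_)
open import Data.List.Membership.Propositional.Properties
  using (∈-cartesianProduct⁺; ∈-cartesianProductWith⁺; ∈-map⁺; ∈-upTo⁺; ∈-++⁺ˡ; ∈-++⁺ʳ; ∈-filter⁺)
open import Data.List.Properties using (length-applyUpTo)
open import Data.List.Relation.Unary.All as All using (All; []; _∷_)
import Data.List.Relation.Unary.All.Properties as Allₚ
open import Data.List.Relation.Unary.Any using (here)
open import Data.Nat as ℕ using (ℕ; zero; suc; NonZero; _≤_; _<_; z≤n; s≤s; s≤s⁻¹)
import Data.Nat.Properties as ℕₚ
open import Data.Nat.Primality using (Prime; prime⇒nonZero)
open import Data.Product using (∃; _×_; _,_; proj₁; proj₂)
open import Data.Sum using (_⊎_; inj₁; inj₂)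
open import Function using (_∘_)
open import Relation.Binary.PropositionalEquality
  using (_≡_; _≢_; refl; sym; trans; cong; cong₂; subst; module ≡-Reasoning)
open import Relation.Nullary using (Dec; yes; no; ¬_)

------------------------------------------------------------------------
-- Polynomials over ℤ

-- A polynomial is its list of coefficients, constant term first.  Trailing
-- zeros are allowed, so equality of polynomials is _≋_, not _≡_.
Poly : Set
Poly = List ℤ

coeff : Poly → ℕ → ℤ
coeff []      _       = 0ℤ
coeff (a ∷ f) zero    = a
coeff (a ∷ f) (suc k) = coeff f k

infix 4 _≋_ _∣ₚ_
_≋_ : Poly → Poly → Set
f ≋ g = ∀ k → coeff f k ≡ coeff g k

infixl 6 _+ₚ_
_+ₚ_ : Poly → Poly → Poly
[]      +ₚ g       = g
(a ∷ f) +ₚ []      = a ∷ f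
(a ∷ f) +ₚ (b ∷ g) = (a ℤ.+ b) ∷ (f +ₚ g)

infixl 7 _*ₚ_
_*ₚ_ : Poly → Poly → Poly
[]      *ₚ g = []
(a ∷ f) *ₚ g = map (a ℤ.*_) g +ₚ (0ℤ ∷ f *ₚ g)

_∣ₚ_ : Poly → Poly → Set
f ∣ₚ g = ∃ λ h → f *ₚ h ≋ g

monomial : ℕ → Poly
monomial n = replicate n 0ℤ ++ [ 1ℤ ]

Xⁿ-1 : ℕ → Poly
Xⁿ-1 n = monomial n +ₚ [ -1ℤ ]

-- The base value 0 only matters for the empty list, the zero polynomial.
height : Poly → ℕ
height f = max 0 (map ∣_∣ f)

IsMaxHeight : ℕ → ℕ → Set
IsMaxHeight n m =
  (∃ λ f → f ∣ₚ Xⁿ-1 n × height f ≡ m) × (∀ f → f ∣ₚ Xⁿ-1 n → height f ≤ m)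

------------------------------------------------------------------------
-- The maximum exists: the divisors f of xⁿ - 1 have bounded height.  Indeed
-- f has degree at most n and f(a) divides aⁿ - 1 ≠ 0 for a = 2, …, n + 2,
-- and the values at n + 1 points bound the coefficients.

module Existence where

  coeff-+ : ∀ f g k → coeff (f +ₚ g) k ≡ coeff f k ℤ.+ coeff g k
  coeff-+ []      g       k       = sym (ℤₚ.+-identityˡ _)
  coeff-+ (a ∷ f) []      k       = sym (ℤₚ.+-identityʳ _)
  coeff-+ (a ∷ f) (b ∷ g) zero    = refl
  coeff-+ (a ∷ f) (b ∷ g) (suc k) = coeff-+ f g k

  coeff-map : ∀ a g k → coeff (map (a ℤ.*_) g) k ≡ a ℤ.* coeff g k
  coeff-map a []      k       = sym (ℤₚ.*-zeroʳ a)
  coeff-map a (b ∷ g) zero    = refl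
  coeff-map a (b ∷ g) (suc k) = coeff-map a g k

  coeff-* : ∀ a f g k → coeff ((a ∷ f) *ₚ g) k ≡ a ℤ.* coeff g k ℤ.+ coeff (0ℤ ∷ f *ₚ g) k
  coeff-* a f g k =
    trans (coeff-+ (map (a ℤ.*_) g) _ k) (cong (ℤ._+ coeff (0ℤ ∷ f *ₚ g) k) (coeff-map a g k))

  0∷-cong : ∀ {f g} → f ≋ g → (0ℤ ∷ f) ≋ (0ℤ ∷ g)
  0∷-cong e zero    = refl
  0∷-cong e (suc k) = e k

  *ₚ-zeroˡ : ∀ f g → f ≋ [] → f *ₚ g ≋ []
  *ₚ-zeroˡ []      g e k = refl
  *ₚ-zeroˡ (a ∷ f) g e k = begin
    coeff ((a ∷ f) *ₚ g) k                       ≡⟨ coeff-* a f g k ⟩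
    a ℤ.* coeff g k ℤ.+ coeff (0ℤ ∷ f *ₚ g) k
      ≡⟨ cong₂ (λ x y → x ℤ.* coeff g k ℤ.+ y) (e 0) (shift k) ⟩
    0ℤ ℤ.* coeff g k ℤ.+ 0ℤ                      ≡⟨ solve-0 (coeff g k) ⟩
    0ℤ ∎
    where
    open ≡-Reasoning
    shift : ∀ k → coeff (0ℤ ∷ f *ₚ g) k ≡ 0ℤ
    shift zero    = refl
    shift (suc k) = *ₚ-zeroˡ f g (λ i → e (suc i)) k
    solve-0 : ∀ x → 0ℤ ℤ.* x ℤ.+ 0ℤ ≡ 0ℤ
    solve-0 = solve-∀

  *ₚ-congˡ : ∀ f f′ g → f ≋ f′ → f *ₚ g ≋ f′ *ₚ g
  *ₚ-congˡ []      f′       g e k = sym (*ₚ-zeroˡ f′ g (sym ∘ e) k)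
  *ₚ-congˡ (a ∷ f) []       g e k = *ₚ-zeroˡ (a ∷ f) g e k
  *ₚ-congˡ (a ∷ f) (b ∷ f′) g e k = begin
    coeff ((a ∷ f) *ₚ g) k                       ≡⟨ coeff-* a f g k ⟩
    a ℤ.* coeff g k ℤ.+ coeff (0ℤ ∷ f *ₚ g) k
      ≡⟨ cong₂ (λ x y → x ℤ.* coeff g k ℤ.+ y) (e 0)
           (0∷-cong {f *ₚ g} {f′ *ₚ g} (*ₚ-congˡ f f′ g (e ∘ suc)) k) ⟩
    b ℤ.* coeff g k ℤ.+ coeff (0ℤ ∷ f′ *ₚ g) k   ≡⟨ sym (coeff-* b f′ g k) ⟩
    coeff ((b ∷ f′) *ₚ g) k ∎
    where open ≡-Reasoning

  *ₚ-congʳ : ∀ f g g′ → g ≋ g′ → f *ₚ g ≋ f *ₚ g′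
  *ₚ-congʳ []      g g′ e k = refl
  *ₚ-congʳ (a ∷ f) g g′ e k = begin
    coeff ((a ∷ f) *ₚ g) k                       ≡⟨ coeff-* a f g k ⟩
    a ℤ.* coeff g k ℤ.+ coeff (0ℤ ∷ f *ₚ g) k
      ≡⟨ cong₂ (λ x y → a ℤ.* x ℤ.+ y) (e k)
           (0∷-cong {f *ₚ g} {f *ₚ g′} (*ₚ-congʳ f g g′ e) k) ⟩
    a ℤ.* coeff g′ k ℤ.+ coeff (0ℤ ∷ f *ₚ g′) k  ≡⟨ sym (coeff-* a f g′ k) ⟩
    coeff ((a ∷ f) *ₚ g′) k ∎
    where open ≡-Reasoning

  infix 4 _≋?_
  _≋?_ : ∀ f g → Dec (f ≋ g)
  [] ≋? [] = yes λ _ → refl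
  [] ≋? (b ∷ g) with 0ℤ ℤ.≟ b | [] ≋? g
  ... | yes p | yes e = yes λ { zero → p ; (suc k) → e k }
  ... | no p  | _     = no λ e → p (e 0)
  ... | yes _ | no p  = no λ e → p (e ∘ suc)
  (a ∷ f) ≋? [] with a ℤ.≟ 0ℤ | f ≋? []
  ... | yes p | yes e = yes λ { zero → p ; (suc k) → e k }
  ... | no p  | _     = no λ e → p (e 0)
  ... | yes _ | no p  = no λ e → p (e ∘ suc)
  (a ∷ f) ≋? (b ∷ g) with a ℤ.≟ b | f ≋? g
  ... | yes p | yes e = yes λ { zero → p ; (suc k) → e k }
  ... | no p  | _     = no λ e → p (e 0)
  ... | yes _ | no p  = no λ e → p (e ∘ suc)

  -- Coefficients and height

  coeff≤ : ∀ {N} f → All (λ c → ∣ c ∣ ≤ N) f → ∀ k → ∣ coeff f k ∣ ≤ N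
  coeff≤ []      []       k       = z≤n
  coeff≤ (a ∷ f) (p ∷ ps) zero    = p
  coeff≤ (a ∷ f) (p ∷ ps) (suc k) = coeff≤ f ps k

  coeff≤⁻ : ∀ {N} f → (∀ k → ∣ coeff f k ∣ ≤ N) → All (λ c → ∣ c ∣ ≤ N) f
  coeff≤⁻ []      p = []
  coeff≤⁻ (a ∷ f) p = p 0 ∷ coeff≤⁻ f (p ∘ suc)

  height-mono : ∀ f g → f ≋ g → height f ≤ height g
  height-mono f g e = max≤v⁺ z≤n (Allₚ.map⁺ (coeff≤⁻ f λ k →
    subst (λ c → ∣ c ∣ ≤ height g) (sym (e k))
      (coeff≤ g (Allₚ.map⁻ (xs≤max 0 (map ∣_∣ g))) k)))

  -- Evaluation

  eval : Poly → ℤ → ℤ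
  eval []      x = 0ℤ
  eval (a ∷ f) x = a ℤ.+ x ℤ.* eval f x

  eval-+ : ∀ f g x → eval (f +ₚ g) x ≡ eval f x ℤ.+ eval g x
  eval-+ []      g       x = sym (ℤₚ.+-identityˡ _)
  eval-+ (a ∷ f) []      x = sym (ℤₚ.+-identityʳ _)
  eval-+ (a ∷ f) (b ∷ g) x =
    trans (cong (λ e → a ℤ.+ b ℤ.+ x ℤ.* e) (eval-+ f g x)) (lem a b x (eval f x) (eval g x))
    where
    lem : ∀ a b x u v →
      a ℤ.+ b ℤ.+ x ℤ.* (u ℤ.+ v) ≡ (a ℤ.+ x ℤ.* u) ℤ.+ (b ℤ.+ x ℤ.* v)
    lem = solve-∀

  eval-map : ∀ a g x → eval (map (a ℤ.*_) g) x ≡ a ℤ.* eval g x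
  eval-map a []      x = sym (ℤₚ.*-zeroʳ a)
  eval-map a (b ∷ g) x =
    trans (cong (λ e → a ℤ.* b ℤ.+ x ℤ.* e) (eval-map a g x)) (lem a b x (eval g x))
    where
    lem : ∀ a b x u → a ℤ.* b ℤ.+ x ℤ.* (a ℤ.* u) ≡ a ℤ.* (b ℤ.+ x ℤ.* u)
    lem = solve-∀

  eval-* : ∀ f g x → eval (f *ₚ g) x ≡ eval f x ℤ.* eval g x
  eval-* []      g x = refl
  eval-* (a ∷ f) g x = begin
    eval (map (a ℤ.*_) g +ₚ (0ℤ ∷ f *ₚ g)) x
      ≡⟨ eval-+ (map (a ℤ.*_) g) _ x ⟩
    eval (map (a ℤ.*_) g) x ℤ.+ (0ℤ ℤ.+ x ℤ.* eval (f *ₚ g) x)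
      ≡⟨ cong₂ (λ u v → u ℤ.+ (0ℤ ℤ.+ x ℤ.* v)) (eval-map a g x) (eval-* f g x) ⟩
    a ℤ.* eval g x ℤ.+ (0ℤ ℤ.+ x ℤ.* (eval f x ℤ.* eval g x))
      ≡⟨ lem a x (eval f x) (eval g x) ⟩
    (a ℤ.+ x ℤ.* eval f x) ℤ.* eval g x ∎
    where
    open ≡-Reasoning
    lem : ∀ a x u v → a ℤ.* v ℤ.+ (0ℤ ℤ.+ x ℤ.* (u ℤ.* v)) ≡ (a ℤ.+ x ℤ.* u) ℤ.* v
    lem = solve-∀

  eval-0 : ∀ f x → f ≋ [] → eval f x ≡ 0ℤ
  eval-0 []      x e = refl
  eval-0 (a ∷ f) x e =
    trans (cong₂ (λ u v → u ℤ.+ x ℤ.* v) (e 0) (eval-0 f x (e ∘ suc))) (lem x)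
    where
    lem : ∀ x → 0ℤ ℤ.+ x ℤ.* 0ℤ ≡ 0ℤ
    lem = solve-∀

  eval-cong : ∀ f g x → f ≋ g → eval f x ≡ eval g x
  eval-cong []      g       x e = sym (eval-0 g x (sym ∘ e))
  eval-cong (a ∷ f) []      x e = eval-0 (a ∷ f) x e
  eval-cong (a ∷ f) (b ∷ g) x e =
    cong₂ (λ u v → u ℤ.+ x ℤ.* v) (e 0) (eval-cong f g x (e ∘ suc))

  eval-monomial : ∀ n a → eval (monomial n) (+ a) ≡ + (a ℕ.^ n)
  eval-monomial zero    a = lem (+ a)
    where
    lem : ∀ x → 1ℤ ℤ.+ x ℤ.* 0ℤ ≡ 1ℤ
    lem = solve-∀
  eval-monomial (suc n) a = begin
    0ℤ ℤ.+ + a ℤ.* eval (monomial n) (+ a) ≡⟨ ℤₚ.+-identityˡ _ ⟩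
    + a ℤ.* eval (monomial n) (+ a)        ≡⟨ cong (+ a ℤ.*_) (eval-monomial n a) ⟩
    + a ℤ.* + (a ℕ.^ n)                    ≡⟨ sym (ℤₚ.pos-* a (a ℕ.^ n)) ⟩
    + (a ℕ.* a ℕ.^ n) ∎
    where open ≡-Reasoning

  eval-Xⁿ-1 : ∀ n a → eval (Xⁿ-1 n) (+ a) ≡ + (a ℕ.^ n) ℤ.+ -1ℤ
  eval-Xⁿ-1 n a = trans (eval-+ (monomial n) [ -1ℤ ] (+ a))
    (cong₂ ℤ._+_ (eval-monomial n a) (lem (+ a)))
    where
    lem : ∀ x → -1ℤ ℤ.+ x ℤ.* 0ℤ ≡ -1ℤ
    lem = solve-∀

  pred-bounds : ∀ s → 2 ≤ s → NonZero ∣ + s ℤ.+ -1ℤ ∣ × ∣ + s ℤ.+ -1ℤ ∣ ≤ s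
  pred-bounds (suc (suc s)) (s≤s (s≤s z≤n)) = _ , ℕₚ.n≤1+n _

  1<a^n : ∀ a m → 2 ≤ (2 ℕ.+ a) ℕ.^ suc m
  1<a^n a m = ℕₚ.≤-trans (s≤s (s≤s z≤n))
    (ℕₚ.m≤m*n (2 ℕ.+ a) ((2 ℕ.+ a) ℕ.^ m) {{ℕₚ.m^n≢0 (2 ℕ.+ a) m}})

  nonZero-factors : ∀ u v → NonZero (u ℕ.* v) → (NonZero u × u ≤ u ℕ.* v) × (NonZero v × v ≤ u ℕ.* v)
  nonZero-factors zero    v       ()
  nonZero-factors (suc u) zero    nz rewrite ℕₚ.*-zeroʳ u = ⊥-elim (ℕ.≢-nonZero⁻¹ 0 {{nz}} refl)
  nonZero-factors (suc u) (suc v) _ = (_ , ℕₚ.m≤m*n (suc u) (suc v)) , (_ , ℕₚ.m≤n*m (suc v) (suc u))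

  eval-divisor : ∀ f h m → f *ₚ h ≋ Xⁿ-1 (suc m) → ∀ a →
    let x = + (2 ℕ.+ a) ; s = (2 ℕ.+ a) ℕ.^ suc m in
    (NonZero ∣ eval f x ∣ × ∣ eval f x ∣ ≤ s) × (NonZero ∣ eval h x ∣ × ∣ eval h x ∣ ≤ s)
  eval-divisor f h m e a =
    let (nu , u≤) , (nv , v≤) = nonZero-factors _ _ (subst NonZero eq (proj₁ pb))
    in (nu , ℕₚ.≤-trans u≤ uv≤s) , (nv , ℕₚ.≤-trans v≤ uv≤s)
    where
    x = + (2 ℕ.+ a)
    s = (2 ℕ.+ a) ℕ.^ suc m
    pb = pred-bounds s (1<a^n a m)
    eq : ∣ + s ℤ.+ -1ℤ ∣ ≡ ∣ eval f x ∣ ℕ.* ∣ eval h x ∣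
    eq = begin
      ∣ + s ℤ.+ -1ℤ ∣               ≡⟨ cong ∣_∣ (sym (eval-Xⁿ-1 (suc m) (2 ℕ.+ a))) ⟩
      ∣ eval (Xⁿ-1 (suc m)) x ∣      ≡⟨ cong ∣_∣ (sym (eval-cong (f *ₚ h) (Xⁿ-1 (suc m)) x e)) ⟩
      ∣ eval (f *ₚ h) x ∣           ≡⟨ cong ∣_∣ (eval-* f h x) ⟩
      ∣ eval f x ℤ.* eval h x ∣     ≡⟨ ℤₚ.abs-* (eval f x) (eval h x) ⟩
      ∣ eval f x ∣ ℕ.* ∣ eval h x ∣ ∎
      where open ≡-Reasoning
    uv≤s : ∣ eval f x ∣ ℕ.* ∣ eval h x ∣ ≤ s
    uv≤s = subst (_≤ s) eq (proj₂ pb)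

  -- Degrees

  HasDegree : Poly → ℕ → Set
  HasDegree f d = coeff f d ≢ 0ℤ × (∀ i → d < i → coeff f i ≡ 0ℤ)

  degree : ∀ f → f ≋ [] ⊎ ∃ (HasDegree f)
  degree [] = inj₁ λ _ → refl
  degree (a ∷ f) with degree f
  ... | inj₂ (d , nz , z) = inj₂ (suc d , nz , λ { (suc i) (s≤s p) → z i p })
  ... | inj₁ e with a ℤ.≟ 0ℤ
  ...   | yes p = inj₁ λ { zero → p ; (suc k) → e k }
  ...   | no p  = inj₂ (0 , p , λ { (suc i) _ → e i })

  leading : ∀ f h d e → (∀ i → d < i → coeff f i ≡ 0ℤ) → (∀ i → e < i → coeff h i ≡ 0ℤ) →
    coeff (f *ₚ h) (d ℕ.+ e) ≡ coeff f d ℤ.* coeff h e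
  leading []      h d       e zf zh = refl
  leading (a ∷ f) h zero    e zf zh = begin
    coeff ((a ∷ f) *ₚ h) e                    ≡⟨ coeff-* a f h e ⟩
    a ℤ.* coeff h e ℤ.+ coeff (0ℤ ∷ f *ₚ h) e
      ≡⟨ cong (λ t → a ℤ.* coeff h e ℤ.+ t) (shift e) ⟩
    a ℤ.* coeff h e ℤ.+ 0ℤ                    ≡⟨ ℤₚ.+-identityʳ _ ⟩
    a ℤ.* coeff h e ∎
    where
    open ≡-Reasoning
    shift : ∀ k → coeff (0ℤ ∷ f *ₚ h) k ≡ 0ℤ
    shift zero    = refl
    shift (suc k) = *ₚ-zeroˡ f h (λ i → zf (suc i) (s≤s z≤n)) k
  leading (a ∷ f) h (suc d) e zf zh = begin
    coeff ((a ∷ f) *ₚ h) (suc d ℕ.+ e)        ≡⟨ coeff-* a f h (suc d ℕ.+ e) ⟩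
    a ℤ.* coeff h (suc d ℕ.+ e) ℤ.+ coeff (f *ₚ h) (d ℕ.+ e)
      ≡⟨ cong₂ (λ u v → a ℤ.* u ℤ.+ v) (zh (suc d ℕ.+ e) (s≤s (ℕₚ.m≤n+m e d)))
           (leading f h d e (λ i p → zf (suc i) (s≤s p)) zh) ⟩
    a ℤ.* 0ℤ ℤ.+ coeff f d ℤ.* coeff h e      ≡⟨ lem a _ ⟩
    coeff f d ℤ.* coeff h e ∎
    where
    open ≡-Reasoning
    lem : ∀ a t → a ℤ.* 0ℤ ℤ.+ t ≡ t
    lem = solve-∀

  coeff-monomial : ∀ n i → n < i → coeff (monomial n) i ≡ 0ℤ
  coeff-monomial zero    (suc i) p       = refl
  coeff-monomial (suc n) (suc i) (s≤s p) = coeff-monomial n i p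

  coeff-Xⁿ-1 : ∀ n i → n < i → coeff (Xⁿ-1 n) i ≡ 0ℤ
  coeff-Xⁿ-1 n (suc i) p = trans (coeff-+ (monomial n) [ -1ℤ ] (suc i))
    (trans (ℤₚ.+-identityʳ _) (coeff-monomial n (suc i) p))

  eval≢0⇒≉[] : ∀ f x → NonZero ∣ eval f x ∣ → ¬ (f ≋ [])
  eval≢0⇒≉[] f x nz e = ℕ.≢-nonZero⁻¹ _ {{nz}} (cong ∣_∣ (eval-0 f x e))

  degree-divisor : ∀ f h m → f *ₚ h ≋ Xⁿ-1 (suc m) →
    (∀ i → suc m < i → coeff f i ≡ 0ℤ) × (∀ i → suc m < i → coeff h i ≡ 0ℤ)
  degree-divisor f h m eq with eval-divisor f h m eq 0 | degree f | degree h
  ... | (nf , _) , _ | inj₁ e | _ = ⊥-elim (eval≢0⇒≉[] f _ nf e)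
  ... | _ , (nh , _) | inj₂ _ | inj₁ e = ⊥-elim (eval≢0⇒≉[] h _ nh e)
  ... | _ | inj₂ (d , nf , zf) | inj₂ (e , nh , zh) =
    (λ i p → zf i (ℕₚ.≤-<-trans (ℕₚ.≤-trans (ℕₚ.m≤m+n d e) d+e≤n) p)) ,
    (λ i p → zh i (ℕₚ.≤-<-trans (ℕₚ.≤-trans (ℕₚ.m≤n+m e d) d+e≤n) p))
    where
    d+e≤n : d ℕ.+ e ≤ suc m
    d+e≤n with d ℕ.+ e ℕ.≤? suc m
    ... | yes p = p
    ... | no p with ℤₚ.i*j≡0⇒i≡0∨j≡0 (coeff f d) (trans (sym (leading f h d e zf zh))
                   (trans (eq (d ℕ.+ e)) (coeff-Xⁿ-1 (suc m) (d ℕ.+ e) (ℕₚ.≰⇒> p))))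
    ...   | inj₁ z = ⊥-elim (nf z)
    ...   | inj₂ z = ⊥-elim (nh z)

  -- Bounding coefficients by values: (c + x·t)(x) = (c + x·t)(a) + (x - a)·(quot a t)(x).

  quot : ℤ → Poly → Poly
  quot a []      = []
  quot a (c ∷ t) = eval (c ∷ t) a ∷ quot a t

  length-quot : ∀ a t → length (quot a t) ≡ length t
  length-quot a []      = refl
  length-quot a (c ∷ t) = cong suc (length-quot a t)

  eval-quot : ∀ c t a y →
    eval (c ∷ t) (a ℤ.+ y) ≡ eval (c ∷ t) a ℤ.+ y ℤ.* eval (quot a t) (a ℤ.+ y)
  eval-quot c []       a y = lem c a y
    where
    lem : ∀ c a y → c ℤ.+ (a ℤ.+ y) ℤ.* 0ℤ ≡ (c ℤ.+ a ℤ.* 0ℤ) ℤ.+ y ℤ.* 0ℤ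
    lem = solve-∀
  eval-quot c (c′ ∷ t) a y =
    trans (cong (λ u → c ℤ.+ (a ℤ.+ y) ℤ.* u) (eval-quot c′ t a y))
      (lem c a y (eval (c′ ∷ t) a) (eval (quot a t) (a ℤ.+ y)))
    where
    lem : ∀ c a y u v → c ℤ.+ (a ℤ.+ y) ℤ.* (u ℤ.+ y ℤ.* v) ≡
      (c ℤ.+ a ℤ.* u) ℤ.+ y ℤ.* (u ℤ.+ (a ℤ.+ y) ℤ.* v)
    lem = solve-∀

  head-bound : ∀ {M N} c t a → ∣ eval (c ∷ t) (+ a) ∣ ≤ M → All (λ u → ∣ u ∣ ≤ N) (quot (+ a) t) →
    ∣ c ∣ ≤ M ℕ.+ a ℕ.* N
  head-bound {M} {N} c t a p ps = begin
    ∣ c ∣                                            ≡⟨ cong ∣_∣ (lem c (+ a ℤ.* eval t (+ a))) ⟩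
    ∣ eval (c ∷ t) (+ a) ℤ.- + a ℤ.* eval t (+ a) ∣  ≤⟨ ℤₚ.∣i-j∣≤∣i∣+∣j∣ (eval (c ∷ t) (+ a)) _ ⟩
    ∣ eval (c ∷ t) (+ a) ∣ ℕ.+ ∣ + a ℤ.* eval t (+ a) ∣
      ≡⟨ cong (∣ eval (c ∷ t) (+ a) ∣ ℕ.+_) (ℤₚ.abs-* (+ a) (eval t (+ a))) ⟩
    ∣ eval (c ∷ t) (+ a) ∣ ℕ.+ a ℕ.* ∣ eval t (+ a) ∣
      ≤⟨ ℕₚ.+-mono-≤ p (ℕₚ.*-monoʳ-≤ a (tail t ps)) ⟩
    M ℕ.+ a ℕ.* N ∎
    where
    open ℕₚ.≤-Reasoning
    lem : ∀ c u → c ≡ (c ℤ.+ u) ℤ.- u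
    lem = solve-∀
    tail : ∀ t → All (λ u → ∣ u ∣ ≤ N) (quot (+ a) t) → ∣ eval t (+ a) ∣ ≤ N
    tail []      _       = z≤n
    tail (_ ∷ _) (p ∷ _) = p

  tail-bound : ∀ {N} t a → All (λ u → ∣ u ∣ ≤ N) (quot (+ a) t) → All (λ c → ∣ c ∣ ≤ N ℕ.+ a ℕ.* N) t
  tail-bound []      a []       = []
  tail-bound (c ∷ t) a (p ∷ ps) = head-bound c t a p ps ∷ tail-bound t a ps

  bound : ℕ → ℕ → ℕ → ℕ
  bound zero    a M = 0
  bound (suc d) a M = M ℕ.+ (N ℕ.+ a ℕ.* N)
    where N = bound d (suc a) (M ℕ.+ M)

  coeffs-bounded : ∀ d a M f → length f ≡ d → (∀ j → j < d → ∣ eval f (+ (a ℕ.+ j)) ∣ ≤ M) →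
    All (λ c → ∣ c ∣ ≤ bound d a M) f
  coeffs-bounded zero    a M []      _  p = []
  coeffs-bounded (suc d) a M (c ∷ t) eq p =
    ℕₚ.≤-trans (head-bound c t a f[a]≤M gs) (ℕₚ.+-monoʳ-≤ M (ℕₚ.m≤n+m _ N)) ∷
    All.map (λ q → ℕₚ.≤-trans q (ℕₚ.m≤n+m _ M)) (tail-bound t a gs)
    where
    N = bound d (suc a) (M ℕ.+ M)
    f[a]≤M : ∣ eval (c ∷ t) (+ a) ∣ ≤ M
    f[a]≤M = subst (λ x → ∣ eval (c ∷ t) (+ x) ∣ ≤ M) (ℕₚ.+-identityʳ a) (p 0 (s≤s z≤n))
    vals : ∀ j → j < d → ∣ eval (quot (+ a) t) (+ (suc a ℕ.+ j)) ∣ ≤ M ℕ.+ M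
    vals j j<d = subst (λ x → ∣ eval g (+ x) ∣ ≤ M ℕ.+ M) (ℕₚ.+-suc a j) (begin
      ∣ v ∣                             ≤⟨ ℕₚ.m≤n*m ∣ v ∣ (suc j) ⟩
      suc j ℕ.* ∣ v ∣                   ≡⟨ sym (ℤₚ.abs-* (+ suc j) v) ⟩
      ∣ + suc j ℤ.* v ∣                 ≡⟨ cong ∣_∣ (lem u (+ suc j ℤ.* v)) ⟩
      ∣ (u ℤ.+ + suc j ℤ.* v) ℤ.- u ∣   ≡⟨ cong (λ w → ∣ w ℤ.- u ∣) (sym (eval-quot c t (+ a) (+ suc j))) ⟩
      ∣ eval (c ∷ t) x ℤ.- u ∣          ≤⟨ ℤₚ.∣i-j∣≤∣i∣+∣j∣ (eval (c ∷ t) x) u ⟩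
      ∣ eval (c ∷ t) x ∣ ℕ.+ ∣ u ∣      ≤⟨ ℕₚ.+-mono-≤ (p (suc j) (s≤s j<d)) f[a]≤M ⟩
      M ℕ.+ M ∎)
      where
      open ℕₚ.≤-Reasoning
      g = quot (+ a) t
      x = + (a ℕ.+ suc j)
      v = eval g x
      u = eval (c ∷ t) (+ a)
      lem : ∀ u w → w ≡ (u ℤ.+ w) ℤ.- u
      lem = solve-∀
    gs : All (λ u → ∣ u ∣ ≤ N) (quot (+ a) t)
    gs = coeffs-bounded d (suc a) (M ℕ.+ M) (quot (+ a) t)
      (trans (length-quot (+ a) t) (ℕₚ.suc-injective eq)) vals

  -- Truncation to a fixed length, and the finite search space

  fit : ℕ → Poly → Poly
  fit k f = applyUpTo (coeff f) k

  fit-≋ : ∀ k f → (∀ i → k ≤ i → coeff f i ≡ 0ℤ) → fit k f ≋ f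
  fit-≋ k f z = go (coeff f) k z
    where
    go : ∀ (c : ℕ → ℤ) k → (∀ i → k ≤ i → c i ≡ 0ℤ) → ∀ i → coeff (applyUpTo c k) i ≡ c i
    go c zero    z i       = sym (z i z≤n)
    go c (suc k) z zero    = refl
    go c (suc k) z (suc i) = go (c ∘ suc) k (λ i p → z (suc i) (s≤s p)) i

  interval : ℕ → List ℤ
  interval C = map +_ (upTo (suc C)) ++ map (λ k → ℤ.- (+ k)) (upTo (suc C))

  ∈-interval : ∀ {C} c → ∣ c ∣ ≤ C → c ∈ interval C
  ∈-interval (+ k)        p = ∈-++⁺ˡ (∈-map⁺ +_ (∈-upTo⁺ (s≤s p)))
  ∈-interval {C} -[1+ k ] p =
    ∈-++⁺ʳ (map +_ (upTo (suc C))) (∈-map⁺ (λ k → ℤ.- (+ k)) (∈-upTo⁺ (s≤s p)))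

  box : ℕ → ℕ → List Poly
  box C zero    = [ [] ]
  box C (suc k) = cartesianProductWith _∷_ (interval C) (box C k)

  ∈-box : ∀ {C} k f → length f ≡ k → All (λ c → ∣ c ∣ ≤ C) f → f ∈ box C k
  ∈-box zero    []      _  []       = here refl
  ∈-box (suc k) (c ∷ f) eq (p ∷ ps) =
    ∈-cartesianProductWith⁺ _∷_ (∈-interval c p) (∈-box k f (ℕₚ.suc-injective eq) ps)

  size : ℕ → ℕ
  size n = bound (suc n) 2 ((2 ℕ.+ n) ℕ.^ n)

  fit-∈-box : ∀ m f → (∀ i → suc m < i → coeff f i ≡ 0ℤ) →
    (∀ a → ∣ eval f (+ (2 ℕ.+ a)) ∣ ≤ (2 ℕ.+ a) ℕ.^ suc m) →
    fit (suc (suc m)) f ∈ box (size (suc m)) (suc (suc m))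
  fit-∈-box m f z p = ∈-box (suc n) F lenF
    (coeffs-bounded (suc n) 2 ((2 ℕ.+ n) ℕ.^ n) F lenF λ j j<sn →
      subst (λ v → ∣ v ∣ ≤ (2 ℕ.+ n) ℕ.^ n) (sym (eval-cong F f _ (fit-≋ (suc n) f z)))
        (ℕₚ.≤-trans (p j) (ℕₚ.^-monoˡ-≤ n (ℕₚ.+-monoʳ-≤ 2 (s≤s⁻¹ j<sn)))))
    where
    n = suc m
    F = fit (suc n) f
    lenF = length-applyUpTo (coeff f) (suc n)

  search : ∀ n .{{_ : NonZero n}} → ∃ (IsMaxHeight n)
  search n@(suc m) = height (proj₁ best) , (proj₁ best , best-divides , refl) , best-max
    where
    Good : Poly × Poly → Set
    Good (f , h) = f *ₚ h ≋ Xⁿ-1 n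

    good? : ∀ fh → Dec (Good fh)
    good? (f , h) = f *ₚ h ≋? Xⁿ-1 n

    ℬ = box (size n) (suc n)

    candidates : List (Poly × Poly)
    candidates = filter good? (cartesianProduct ℬ ℬ)

    trivial : Poly × Poly
    trivial = [ 1ℤ ] , Xⁿ-1 n

    trivial-good : Good trivial
    trivial-good k = trans (coeff-* 1ℤ [] (Xⁿ-1 n) k)
      (trans (cong (λ u → 1ℤ ℤ.* coeff (Xⁿ-1 n) k ℤ.+ u) (shift k)) (lem (coeff (Xⁿ-1 n) k)))
      where
      shift : ∀ k → coeff (0ℤ ∷ []) k ≡ 0ℤ
      shift zero    = refl
      shift (suc k) = refl
      lem : ∀ u → 1ℤ ℤ.* u ℤ.+ 0ℤ ≡ u
      lem = solve-∀

    best : Poly × Poly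
    best = argmax (height ∘ proj₁) trivial candidates

    best-divides : proj₁ best ∣ₚ Xⁿ-1 n
    best-divides = proj₂ best ,
      argmax-all (height ∘ proj₁) {P = Good} trivial-good (Allₚ.all-filter good? (cartesianProduct ℬ ℬ))

    best-max : ∀ f → f ∣ₚ Xⁿ-1 n → height f ≤ height (proj₁ best)
    best-max f (h , eq) = ℕₚ.≤-trans (height-mono f F (sym ∘ F≋f))
      (All.lookup (f[xs]≤f[argmax] {f = height ∘ proj₁} trivial candidates)
        (∈-filter⁺ good? (∈-cartesianProduct⁺ F∈ H∈) FH))
      where
      F = fit (suc n) f
      H = fit (suc n) h
      zeros = degree-divisor f h m eq
      F≋f = fit-≋ (suc n) f (proj₁ zeros)
      H≋h = fit-≋ (suc n) h (proj₂ zeros)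
      F∈ = fit-∈-box m f (proj₁ zeros) (λ a → proj₂ (proj₁ (eval-divisor f h m eq a)))
      H∈ = fit-∈-box m h (proj₂ zeros) (λ a → proj₂ (proj₂ (eval-divisor f h m eq a)))
      FH : F *ₚ H ≋ Xⁿ-1 n
      FH k = trans (*ₚ-congˡ F f H F≋f k) (trans (*ₚ-congʳ f H h H≋h k) (eq k))

abstract

  maxHeight-exists : ∀ n .{{_ : NonZero n}} → ∃ (IsMaxHeight n)
  maxHeight-exists n = Existence.search n

-- B n never reduces; it is determined by B-isMaxHeight.
B : ∀ n .{{_ : NonZero n}} → ℕ
B n = proj₁ (maxHeight-exists n)

B-isMaxHeight : ∀ n .{{_ : NonZero n}} → IsMaxHeight n (B n)
B-isMaxHeight n = proj₂ (maxHeight-exists n)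

pq^b-nonZero : ∀ {p q} → Prime p → Prime q → ∀ b → NonZero (p ℕ.* q ℕ.^ b)
pq^b-nonZero {p} {q} pp pq b =
  ℕₚ.m*n≢0 p (q ℕ.^ b) {{prime⇒nonZero pp}} {{ℕₚ.m^n≢0 q b {{prime⇒nonZero pq}}}}

{-# OPTIONS --safe #-}
module Submission where

-- Let n = p q^b and let V range over the polynomials for which V(x^q) divides
-- (x^n - 1) / (x^{pq} - 1).  Every divisor of x^n - 1 has the form P(x) V(x^q),
-- where P is one of the sixteen products of some of x - 1, Φ_p, Φ_q, Φ_pq, and
-- its height is at most p H(V).  For P = Φ_p Φ_q the bound is attained, the
-- coefficient of x^{qj + q - 1} being p times the j-th coefficient of V.  So an
-- optimal divisor gives B(n) = p H(V).
--
-- The factorisation does not use irreducibility of cyclotomic polynomials: if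
-- f g = x^n - 1, then E = x f′ g satisfies E² = n E modulo x^n - 1, and the
-- Frobenius congruences E^l ≡ E(x^l) for the primes l not dividing n force
-- E(x) = E(x^k) modulo x^n - 1 for all k prime to n.  Averaging over k shows that
-- E is an integer modulo each Y among x - 1, Φ_p, Φ_q, Φ_pq, so Y divides f or g;
-- and once these are removed from f, its logarithmic derivative, hence f itself,
-- involves only powers of x^q.

open import Defs
open Existence using (_≋?_; coeff-+; coeff-map; coeff-*; *ₚ-congˡ; *ₚ-congʳ; coeff≤; coeff≤⁻;
  HasDegree; degree; leading; coeff-Xⁿ-1)
open import Algebra.Bundles using (CommutativeRing)
open import Algebra.Structures using (IsCommutativeRing)
open import Data.Bool using (Bool; true; false)
open import Data.Empty using (⊥-elim)
open import Data.Fin as Fin using (Fin; toℕ)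
import Data.Fin.Properties as Finₚ
open import Data.Integer as ℤ using (ℤ; +_; -[1+_]; 0ℤ; 1ℤ; -1ℤ; ∣_∣)
open import Data.Integer.DivMod using (_%ℕ_; _/ℕ_; n%ℕd<d; a≡a%ℕn+[a/ℕn]*n)
import Data.Integer.Divisibility.Signed as ℤ∣
import Data.Integer.Properties as ℤₚ
open import Data.Integer.Tactic.RingSolver using (solve-∀)
open import Data.List using ([]; _∷_; [_]; map; length; applyUpTo)
open import Data.List.Extrema.Nat using (xs≤max; max≤v⁺)
open import Data.List.Relation.Unary.All as All using (All; []; _∷_)
import Data.List.Relation.Unary.All.Properties as Allₚ
open import Data.Maybe using (Maybe; just; nothing)
open import Data.Nat using (ℕ; NonZero; _*_; _^_; _<_)
open import Data.Nat as ℕ using (zero; suc; _≤_; z≤n; s≤s; _!)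
open import Data.Nat.Combinatorics using (nCk≡n!/k![n-k]!; k![n∸k]!∣n!; nCk≡nC[n∸k]; nCn≡1)
  renaming (_C_ to _choose_)
open import Data.Nat.Coprimality as Coprimality using (Coprime; coprime-Bézout; coprime-divisor)
open import Data.Nat.Divisibility using (_∣_)
import Data.Nat.Divisibility as ℕ∣
open import Data.Nat.DivMod using (_/_; m/n*n≡m; m*n/n≡m; m/n*n≤m; /-mono-≤)
open import Data.Nat.GCD using (module Bézout)
open import Data.Nat.Induction using (<-rec)
open import Data.Nat.ListAction using (product)
open import Data.Nat.ListAction.Properties using (∈⇒∣product)
open import Data.Nat.Primality using (Prime; euclidsLemma; prime⇒nonZero; prime⇒nonTrivial;
  prime⇒irreducible; ¬prime[0]; ¬prime[1])
open import Data.Nat.Primality.Factorisation using (factorise; module PrimeFactorisation)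
import Data.Nat.Properties as ℕₚ
open import Data.Product using (∃; _×_; _,_; proj₁; proj₂)
open import Data.Sum using (_⊎_; inj₁; inj₂; [_,_]′)
open import Function using (_∘_)
open import Level using (0ℓ)
open import Relation.Binary using (Setoid; tri<; tri≈; tri>)
open import Relation.Binary.PropositionalEquality
  using (_≡_; _≢_; refl; sym; trans; cong; cong₂; subst; subst₂; module ≡-Reasoning)
import Relation.Binary.Reasoning.Setoid as SetoidReasoning
open import Relation.Nullary using (Dec; yes; no; ¬_)
open import Tactic.RingSolver using () renaming (solve-∀ to solve-∀-in)
open import Tactic.RingSolver.Core.AlmostCommutativeRing using (AlmostCommutativeRing; fromCommutativeRing)

-- The factorisation works as if the roots of f were visible. In the quotient by x^n - 1, E is n
-- times the idempotent that singles out the roots of f, so E = E(x^k) replaces the statement that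
-- Galois conjugation preserves these roots. A congruence modulo one prime l becomes an equality
-- because δ = E - E(x^l) satisfies δ³ = n² δ: one factor l breeds all its powers. For the height,
-- V(x^q) lives on multiples of q, so a factor whose exponents meet each class modulo q at most once
-- moves coefficients without adding them up. Since p < q, this holds for Φ_p as well as for Φ_q and
-- Φ_q(x^p). The obstacle is the pair Φ_pq and (x - 1) Φ_pq, which do not regroup into differences
-- x^t - 1 and geometric sums. They are reached through Φ_pq (x^q - 1) = (x - 1) Φ_q(x^p), by
-- expanding V(x^q) / (x^q - 1) as a power series, whose coefficients change by at most H(V) from
-- one multiple of q to the next.

-- _≋_ unfolds to a Π-type, from which Agda cannot recover the two polynomials.
infix 4 _≈_
record _≈_ (f g : Poly) : Set where
  constructor ⟪_⟫
  field at : f ≋ g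
open _≈_ public

-- The commutative ring ℤ[x]

-ₚ_ : Poly → Poly
-ₚ f = map (-1ℤ ℤ.*_) f

con : ℤ → Poly
con c = [ c ]

coeff-*-zero : ∀ a f g → coeff ((a ∷ f) *ₚ g) 0 ≡ a ℤ.* coeff g 0
coeff-*-zero a f g = trans (coeff-* a f g 0) (ℤₚ.+-identityʳ _)

coeff-*-suc : ∀ a f g k → coeff ((a ∷ f) *ₚ g) (suc k) ≡ a ℤ.* coeff g (suc k) ℤ.+ coeff (f *ₚ g) k
coeff-*-suc a f g k = coeff-* a f g (suc k)

*ₚ-zeroʳ : ∀ f → f *ₚ [] ≋ []
*ₚ-zeroʳ []      k       = refl
*ₚ-zeroʳ (a ∷ f) zero    = refl
*ₚ-zeroʳ (a ∷ f) (suc k) = *ₚ-zeroʳ f k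

coeff-*∷ : ∀ f b g k → coeff (f *ₚ (b ∷ g)) k ≡ b ℤ.* coeff f k ℤ.+ coeff (0ℤ ∷ f *ₚ g) k
coeff-*∷ []      b g zero    = lem b
  where
  lem : ∀ b → 0ℤ ≡ b ℤ.* 0ℤ ℤ.+ 0ℤ
  lem = solve-∀
coeff-*∷ []      b g (suc k) = lem b
  where
  lem : ∀ b → 0ℤ ≡ b ℤ.* 0ℤ ℤ.+ 0ℤ
  lem = solve-∀
coeff-*∷ (a ∷ f) b g zero    = trans (coeff-*-zero a f (b ∷ g)) (lem a b)
  where
  lem : ∀ a b → a ℤ.* b ≡ b ℤ.* a ℤ.+ 0ℤ
  lem = solve-∀
coeff-*∷ (a ∷ f) b g (suc k) = begin
  coeff ((a ∷ f) *ₚ (b ∷ g)) (suc k)                                  ≡⟨ coeff-*-suc a f (b ∷ g) k ⟩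
  a ℤ.* coeff g k ℤ.+ coeff (f *ₚ (b ∷ g)) k                          ≡⟨ cong (ℤ._+_ (a ℤ.* coeff g k)) (coeff-*∷ f b g k) ⟩
  a ℤ.* coeff g k ℤ.+ (b ℤ.* coeff f k ℤ.+ coeff (0ℤ ∷ f *ₚ g) k)     ≡⟨ lem (a ℤ.* coeff g k) (b ℤ.* coeff f k) _ ⟩
  b ℤ.* coeff f k ℤ.+ (a ℤ.* coeff g k ℤ.+ coeff (0ℤ ∷ f *ₚ g) k)     ≡⟨ cong (ℤ._+_ (b ℤ.* coeff f k)) (sym (coeff-* a f g k)) ⟩
  b ℤ.* coeff f k ℤ.+ coeff ((a ∷ f) *ₚ g) k ∎
  where
  open ≡-Reasoning
  lem : ∀ x y z → x ℤ.+ (y ℤ.+ z) ≡ y ℤ.+ (x ℤ.+ z)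
  lem = solve-∀

coeff-0∷-cong : ∀ f g k → (∀ j → coeff f j ≡ coeff g j) → coeff (0ℤ ∷ f) k ≡ coeff (0ℤ ∷ g) k
coeff-0∷-cong f g zero    e = refl
coeff-0∷-cong f g (suc k) e = e k

*ₚ-comm : ∀ f g → f *ₚ g ≋ g *ₚ f
*ₚ-comm []      g k = sym (*ₚ-zeroʳ g k)
*ₚ-comm (a ∷ f) g k = begin
  coeff ((a ∷ f) *ₚ g) k                        ≡⟨ coeff-* a f g k ⟩
  a ℤ.* coeff g k ℤ.+ coeff (0ℤ ∷ f *ₚ g) k     ≡⟨ cong (ℤ._+_ (a ℤ.* coeff g k)) (coeff-0∷-cong (f *ₚ g) (g *ₚ f) k (*ₚ-comm f g)) ⟩
  a ℤ.* coeff g k ℤ.+ coeff (0ℤ ∷ g *ₚ f) k     ≡⟨ sym (coeff-*∷ g a f k) ⟩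
  coeff (g *ₚ (a ∷ f)) k ∎
  where open ≡-Reasoning

*ₚ-distribʳ : ∀ h f g → (f +ₚ g) *ₚ h ≋ f *ₚ h +ₚ g *ₚ h
*ₚ-distribʳ h []      g       k = refl
*ₚ-distribʳ h (a ∷ f) []      k = sym (trans (coeff-+ ((a ∷ f) *ₚ h) [] k) (ℤₚ.+-identityʳ _))
*ₚ-distribʳ h (a ∷ f) (b ∷ g) k = begin
  coeff ((a ℤ.+ b ∷ (f +ₚ g)) *ₚ h) k                           ≡⟨ coeff-* (a ℤ.+ b) (f +ₚ g) h k ⟩
  (a ℤ.+ b) ℤ.* c ℤ.+ coeff (0ℤ ∷ (f +ₚ g) *ₚ h) k              ≡⟨ cong (ℤ._+_ ((a ℤ.+ b) ℤ.* c)) (coeff-0∷-cong ((f +ₚ g) *ₚ h) (f *ₚ h +ₚ g *ₚ h) k (*ₚ-distribʳ h f g)) ⟩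
  (a ℤ.+ b) ℤ.* c ℤ.+ coeff (0ℤ ∷ (f *ₚ h +ₚ g *ₚ h)) k         ≡⟨ cong (ℤ._+_ ((a ℤ.+ b) ℤ.* c)) (coeff-+ (0ℤ ∷ f *ₚ h) (0ℤ ∷ g *ₚ h) k) ⟩
  (a ℤ.+ b) ℤ.* c ℤ.+ (coeff (0ℤ ∷ f *ₚ h) k ℤ.+ coeff (0ℤ ∷ g *ₚ h) k) ≡⟨ lem a b c _ _ ⟩
  (a ℤ.* c ℤ.+ coeff (0ℤ ∷ f *ₚ h) k) ℤ.+ (b ℤ.* c ℤ.+ coeff (0ℤ ∷ g *ₚ h) k)
    ≡⟨ sym (cong₂ ℤ._+_ (coeff-* a f h k) (coeff-* b g h k)) ⟩
  coeff ((a ∷ f) *ₚ h) k ℤ.+ coeff ((b ∷ g) *ₚ h) k             ≡⟨ sym (coeff-+ ((a ∷ f) *ₚ h) ((b ∷ g) *ₚ h) k) ⟩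
  coeff ((a ∷ f) *ₚ h +ₚ (b ∷ g) *ₚ h) k ∎
  where
  open ≡-Reasoning
  c = coeff h k
  lem : ∀ a b c u v → (a ℤ.+ b) ℤ.* c ℤ.+ (u ℤ.+ v) ≡ (a ℤ.* c ℤ.+ u) ℤ.+ (b ℤ.* c ℤ.+ v)
  lem = solve-∀

map-*ₚ : ∀ a f g k → coeff (map (a ℤ.*_) f *ₚ g) k ≡ a ℤ.* coeff (f *ₚ g) k
map-*ₚ a []      g k = sym (ℤₚ.*-zeroʳ a)
map-*ₚ a (b ∷ f) g zero = trans (coeff-*-zero (a ℤ.* b) (map (a ℤ.*_) f) g)
  (trans (ℤₚ.*-assoc a b _) (cong (a ℤ.*_) (sym (coeff-*-zero b f g))))
map-*ₚ a (b ∷ f) g (suc k) = trans (coeff-*-suc (a ℤ.* b) (map (a ℤ.*_) f) g k)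
  (trans (cong (ℤ._+_ (a ℤ.* b ℤ.* coeff g (suc k))) (map-*ₚ a f g k))
  (trans (lem a b (coeff g (suc k)) (coeff (f *ₚ g) k)) (cong (a ℤ.*_) (sym (coeff-*-suc b f g k)))))
  where
  lem : ∀ a b c d → a ℤ.* b ℤ.* c ℤ.+ a ℤ.* d ≡ a ℤ.* (b ℤ.* c ℤ.+ d)
  lem = solve-∀

*ₚ-assoc : ∀ f g h → (f *ₚ g) *ₚ h ≋ f *ₚ (g *ₚ h)
*ₚ-assoc []      g h k = refl
*ₚ-assoc (a ∷ f) g h k = begin
  coeff ((map (a ℤ.*_) g +ₚ (0ℤ ∷ f *ₚ g)) *ₚ h) k                    ≡⟨ *ₚ-distribʳ h (map (a ℤ.*_) g) (0ℤ ∷ f *ₚ g) k ⟩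
  coeff (map (a ℤ.*_) g *ₚ h +ₚ (0ℤ ∷ f *ₚ g) *ₚ h) k                 ≡⟨ coeff-+ (map (a ℤ.*_) g *ₚ h) _ k ⟩
  coeff (map (a ℤ.*_) g *ₚ h) k ℤ.+ coeff ((0ℤ ∷ f *ₚ g) *ₚ h) k      ≡⟨ cong₂ ℤ._+_ (map-*ₚ a g h k) (shift k) ⟩
  a ℤ.* coeff (g *ₚ h) k ℤ.+ coeff (0ℤ ∷ f *ₚ (g *ₚ h)) k             ≡⟨ sym (coeff-* a f (g *ₚ h) k) ⟩
  coeff ((a ∷ f) *ₚ (g *ₚ h)) k ∎
  where
  open ≡-Reasoning
  shift : ∀ k → coeff ((0ℤ ∷ f *ₚ g) *ₚ h) k ≡ coeff (0ℤ ∷ f *ₚ (g *ₚ h)) k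
  shift zero    = trans (coeff-*-zero 0ℤ (f *ₚ g) h) refl
  shift (suc k) = trans (coeff-*-suc 0ℤ (f *ₚ g) h k) (trans (ℤₚ.+-identityˡ _) (*ₚ-assoc f g h k))

con-*ₚ : ∀ a f k → coeff (con a *ₚ f) k ≡ a ℤ.* coeff f k
con-*ₚ a f k = trans (coeff-* a [] f k) (trans (cong (ℤ._+_ (a ℤ.* coeff f k)) (z k)) (ℤₚ.+-identityʳ _))
  where
  z : ∀ k → coeff (0ℤ ∷ []) k ≡ 0ℤ
  z zero    = refl
  z (suc k) = refl

listRing : CommutativeRing 0ℓ 0ℓ
listRing = record
  { Carrier = Poly ; _≈_ = _≈_ ; _+_ = _+ₚ_ ; _*_ = _*ₚ_ ; -_ = -ₚ_ ; 0# = [] ; 1# = con 1ℤ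
  ; isCommutativeRing = record
    { isRing = record
      { +-isAbelianGroup = record
        { isGroup = record
          { isMonoid = record
            { isSemigroup = record
              { isMagma = record
                { isEquivalence = record
                  { refl = ⟪ (λ k → refl) ⟫
                  ; sym = λ e → ⟪ (λ k → sym (at e k)) ⟫
                  ; trans = λ e e′ → ⟪ (λ k → trans (at e k) (at e′ k)) ⟫ }
                ; ∙-cong = λ {f} {f′} {g} {g′} e e′ → ⟪ (λ k → trans (coeff-+ f g k)
                    (trans (cong₂ ℤ._+_ (at e k) (at e′ k)) (sym (coeff-+ f′ g′ k)))) ⟫ }
              ; assoc = λ f g h → ⟪ (λ k → trans (coeff-+ (f +ₚ g) h k)
                  (trans (cong (ℤ._+ coeff h k) (coeff-+ f g k))
                  (trans (ℤₚ.+-assoc (coeff f k) _ _)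
                  (sym (trans (coeff-+ f (g +ₚ h) k) (cong (ℤ._+_ (coeff f k)) (coeff-+ g h k))))))) ⟫ }
            ; identity = (λ f → ⟪ (λ k → refl) ⟫) ,
                λ f → ⟪ (λ k → trans (coeff-+ f [] k) (ℤₚ.+-identityʳ _)) ⟫ }
          ; inverse = (λ f → ⟪ (λ k → trans (coeff-+ (-ₚ f) f k)
                (trans (cong (ℤ._+ coeff f k) (coeff-map -1ℤ f k)) (negl (coeff f k)))) ⟫) ,
              λ f → ⟪ (λ k → trans (coeff-+ f (-ₚ f) k)
                (trans (cong (ℤ._+_ (coeff f k)) (coeff-map -1ℤ f k)) (negr (coeff f k)))) ⟫
          ; ⁻¹-cong = λ {f} {g} e → ⟪ (λ k → trans (coeff-map -1ℤ f k)
              (trans (cong (-1ℤ ℤ.*_) (at e k)) (sym (coeff-map -1ℤ g k)))) ⟫ }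
        ; comm = λ f g → ⟪ (λ k → trans (coeff-+ f g k)
            (trans (ℤₚ.+-comm (coeff f k) _) (sym (coeff-+ g f k)))) ⟫ }
      ; *-cong = λ {f} {f′} {g} {g′} e e′ → ⟪ (λ k →
          trans (*ₚ-congˡ f f′ g (at e) k) (*ₚ-congʳ f′ g g′ (at e′) k)) ⟫
      ; *-assoc = λ f g h → ⟪ *ₚ-assoc f g h ⟫
      ; *-identity = (λ f → ⟪ one f ⟫) ,
          λ f → ⟪ (λ k → trans (*ₚ-comm f (con 1ℤ) k) (one f k)) ⟫
      ; distrib = (λ f g h → ⟪ (λ k → trans (*ₚ-comm f (g +ₚ h) k)
            (trans (*ₚ-distribʳ f g h k) (trans (coeff-+ (g *ₚ f) _ k)
            (trans (cong₂ ℤ._+_ (*ₚ-comm g f k) (*ₚ-comm h f k)) (sym (coeff-+ (f *ₚ g) _ k)))))) ⟫) ,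
          λ h f g → ⟪ *ₚ-distribʳ h f g ⟫ }
    ; *-comm = λ f g → ⟪ *ₚ-comm f g ⟫ } }
  where
  negl : ∀ x → -1ℤ ℤ.* x ℤ.+ x ≡ 0ℤ
  negl = solve-∀
  negr : ∀ x → x ℤ.+ -1ℤ ℤ.* x ≡ 0ℤ
  negr = solve-∀
  one : ∀ f → con 1ℤ *ₚ f ≋ f
  one f k = trans (con-*ₚ 1ℤ f k) (ℤₚ.*-identityˡ _)

polyACR : AlmostCommutativeRing 0ℓ 0ℓ
polyACR = fromCommutativeRing listRing zero?
  where
  zero? : ∀ f → Maybe ([] ≈ f)
  zero? f with [] ≋? f
  ... | yes e = just ⟪ e ⟫
  ... | no _  = nothing

-- Opaque copies of the ring operations: with the recursive definitions unification
-- cannot recover the operands.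
infixl 6 _⊕_ _⊖_
infixl 7 _⊗_
infix  8 ⊝_
opaque
  _⊕_ _⊗_ : Poly → Poly → Poly
  _⊕_ = _+ₚ_
  _⊗_ = _*ₚ_

  ⊝_ : Poly → Poly
  ⊝_ = -ₚ_

  isCommutativeRing : IsCommutativeRing _≈_ _⊕_ _⊗_ ⊝_ [] (con 1ℤ)
  isCommutativeRing = CommutativeRing.isCommutativeRing listRing

  coeff-⊕ : ∀ f g k → coeff (f ⊕ g) k ≡ coeff f k ℤ.+ coeff g k
  coeff-⊕ = coeff-+

  coeff-⊝ : ∀ f k → coeff (⊝ f) k ≡ -1ℤ ℤ.* coeff f k
  coeff-⊝ = coeff-map -1ℤ

  coeff-con-⊗ : ∀ a f k → coeff (con a ⊗ f) k ≡ a ℤ.* coeff f k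
  coeff-con-⊗ = con-*ₚ

  coeff-⊗-zero : ∀ f g → coeff (f ⊗ g) 0 ≡ coeff f 0 ℤ.* coeff g 0
  coeff-⊗-zero []      g = refl
  coeff-⊗-zero (a ∷ f) g = coeff-*-zero a f g

  coeff-⊗-suc : ∀ a f g k → coeff ((a ∷ f) ⊗ g) (suc k) ≡ a ℤ.* coeff g (suc k) ℤ.+ coeff (f ⊗ g) k
  coeff-⊗-suc = coeff-*-suc

  ≋⇒≈ : ∀ {f g h} → f *ₚ g ≋ h → f ⊗ g ≈ h
  ≋⇒≈ = ⟪_⟫

  ≈⇒≋ : ∀ {f g h} → f ⊗ g ≈ h → f *ₚ g ≋ h
  ≈⇒≋ = at

  +ₚ≈⊕ : ∀ f g → f +ₚ g ≈ f ⊕ g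
  +ₚ≈⊕ f g = ⟪ (λ k → refl) ⟫

_⊖_ : Poly → Poly → Poly
f ⊖ g = f ⊕ ⊝ g

polyRing : CommutativeRing 0ℓ 0ℓ
polyRing = record { isCommutativeRing = isCommutativeRing }

module R = CommutativeRing polyRing
open R using () renaming (reflexive to ≈-reflexive; refl to ≈-refl; sym to ≈-sym; trans to ≈-trans)

module ≈-Reasoning = SetoidReasoning R.setoid
open import Algebra.Properties.Semiring.Exp R.semiring
  using (^-homo-*; ^-assocʳ; ^-congˡ) renaming (_^_ to _^ₚ_)
open import Algebra.Properties.CommutativeSemiring.Exp R.commutativeSemiring using (^-distrib-*)
open import Algebra.Properties.Semiring.Mult R.semiring using () renaming (_×_ to _·_)
open import Algebra.Properties.Semiring.Sum R.semiring using (sum)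
import Algebra.Properties.CommutativeSemiring.Binomial R.commutativeSemiring as Binomial

-- Divisibility and congruence of polynomials

infix 4 _∣⊗_
_∣⊗_ : Poly → Poly → Set
f ∣⊗ g = ∃ λ h → f ⊗ h ≈ g

infix 4 _≈_[mod_]
record _≈_[mod_] (f g m : Poly) : Set where
  constructor ⟦_,_⟧
  field
    quotient : Poly
    equation : f ≈ g ⊕ m ⊗ quotient

module _ {m : Poly} where

  ≈⇒mod : ∀ {f g} → f ≈ g → f ≈ g [mod m ]
  ≈⇒mod {f} {g} e = ⟦ [] , ≈-trans e (lem m g) ⟧
    where
    opaque
      unfolding _⊕_
      lem : ∀ m g → g ≈ g ⊕ m ⊗ []
      lem = solve-∀-in polyACR

  mod-refl : ∀ {f} → f ≈ f [mod m ]
  mod-refl = ≈⇒mod ≈-refl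

  mod-sym : ∀ {f g} → f ≈ g [mod m ] → g ≈ f [mod m ]
  mod-sym {f} {g} ⟦ h , e ⟧ = ⟦ ⊝ h , ≈-trans (lem m g h) (R.+-congʳ (≈-sym e)) ⟧
    where
    opaque
      unfolding _⊕_
      lem : ∀ m g h → g ≈ (g ⊕ m ⊗ h) ⊕ m ⊗ (⊝ h)
      lem = solve-∀-in polyACR

  mod-trans : ∀ {f g h} → f ≈ g [mod m ] → g ≈ h [mod m ] → f ≈ h [mod m ]
  mod-trans {f} {g} {h} ⟦ k , e ⟧ ⟦ l , e′ ⟧ =
    ⟦ l ⊕ k , ≈-trans e (≈-trans (R.+-congʳ e′) (lem m h k l)) ⟧
    where
    opaque
      unfolding _⊕_
      lem : ∀ m h k l → (h ⊕ m ⊗ l) ⊕ m ⊗ k ≈ h ⊕ m ⊗ (l ⊕ k)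
      lem = solve-∀-in polyACR

  mod-+ : ∀ {f f′ g g′} → f ≈ f′ [mod m ] → g ≈ g′ [mod m ] → f ⊕ g ≈ f′ ⊕ g′ [mod m ]
  mod-+ {f′ = f′} {g′ = g′} ⟦ k , e ⟧ ⟦ l , e′ ⟧ =
    ⟦ k ⊕ l , ≈-trans (R.+-cong e e′) (lem m f′ g′ k l) ⟧
    where
    opaque
      unfolding _⊕_
      lem : ∀ m f g k l → (f ⊕ m ⊗ k) ⊕ (g ⊕ m ⊗ l) ≈ (f ⊕ g) ⊕ m ⊗ (k ⊕ l)
      lem = solve-∀-in polyACR

  mod-* : ∀ {f f′ g g′} → f ≈ f′ [mod m ] → g ≈ g′ [mod m ] → f ⊗ g ≈ f′ ⊗ g′ [mod m ]
  mod-* {f′ = f′} {g′ = g′} ⟦ k , e ⟧ ⟦ l , e′ ⟧ =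
    ⟦ f′ ⊗ l ⊕ k ⊗ g′ ⊕ m ⊗ (k ⊗ l) , ≈-trans (R.*-cong e e′) (lem m f′ g′ k l) ⟧
    where
    opaque
      unfolding _⊕_
      lem : ∀ m f g k l → (f ⊕ m ⊗ k) ⊗ (g ⊕ m ⊗ l) ≈ f ⊗ g ⊕ m ⊗ (f ⊗ l ⊕ k ⊗ g ⊕ m ⊗ (k ⊗ l))
      lem = solve-∀-in polyACR

  mod-neg : ∀ {f g} → f ≈ g [mod m ] → ⊝ f ≈ ⊝ g [mod m ]
  mod-neg {f} {g} ⟦ h , e ⟧ = ⟦ ⊝ h , ≈-trans (R.-‿cong e) (lem m g h) ⟧
    where
    opaque
      unfolding _⊕_
      lem : ∀ m g h → ⊝ (g ⊕ m ⊗ h) ≈ ⊝ g ⊕ m ⊗ (⊝ h)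
      lem = solve-∀-in polyACR

  mod-^ : ∀ {f g} k → f ≈ g [mod m ] → f ^ₚ k ≈ g ^ₚ k [mod m ]
  mod-^ zero    e = mod-refl
  mod-^ (suc k) e = mod-* e (mod-^ k e)

  ∣⇒mod : ∀ {f} → m ∣⊗ f → f ≈ [] [mod m ]
  ∣⇒mod (h , e) = ⟦ h , ≈-trans (≈-sym e) (≈-sym (R.+-identityˡ _)) ⟧

  mod⇒∣ : ∀ {f} → f ≈ [] [mod m ] → m ∣⊗ f
  mod⇒∣ ⟦ h , e ⟧ = h , ≈-sym (≈-trans e (R.+-identityˡ _))

  mod-weaken : ∀ {d f g} → d ∣⊗ m → f ≈ g [mod m ] → f ≈ g [mod d ]
  mod-weaken {d} {f} {g} (h , e) ⟦ k , e′ ⟧ = ⟦ h ⊗ k , ≈-trans e′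
    (R.+-congˡ (≈-trans (R.*-congʳ (≈-sym e)) (R.*-assoc d h k))) ⟧

modSetoid : Poly → Setoid 0ℓ 0ℓ
modSetoid m = record
  { Carrier = Poly ; _≈_ = λ f g → f ≈ g [mod m ]
  ; isEquivalence = record { refl = mod-refl ; sym = mod-sym ; trans = mod-trans } }

module Mod-Reasoning (m : Poly) = SetoidReasoning (modSetoid m)

∣-refl : ∀ {f} → f ∣⊗ f
∣-refl {f} = con 1ℤ , R.*-identityʳ f

∣-trans : ∀ {f g h} → f ∣⊗ g → g ∣⊗ h → f ∣⊗ h
∣-trans {f} (k , e) (l , e′) =
  k ⊗ l , ≈-trans (≈-sym (R.*-assoc f k l)) (≈-trans (R.*-congʳ e) e′)

∣-respʳ : ∀ {f g h} → g ≈ h → f ∣⊗ g → f ∣⊗ h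
∣-respʳ e (k , e′) = k , ≈-trans e′ e

f∣f*g : ∀ f g → f ∣⊗ f ⊗ g
f∣f*g f g = g , ≈-refl

f∣g*f : ∀ f g → f ∣⊗ g ⊗ f
f∣g*f f g = g , R.*-comm f g

∣-*ˡ : ∀ {f g} h → f ∣⊗ g → f ∣⊗ h ⊗ g
∣-*ˡ h d = ∣-trans d (f∣g*f _ h)

-- Constants and multiplication by x

con-+ : ∀ a b → con (a ℤ.+ b) ≈ con a ⊕ con b
con-+ a b = +ₚ≈⊕ (con a) (con b)

con-* : ∀ a b → con (a ℤ.* b) ≈ con a ⊗ con b
con-* a b = ⟪ (λ { zero → sym (coeff-con-⊗ a (con b) 0)
                 ; (suc k) → sym (trans (coeff-con-⊗ a (con b) (suc k)) (ℤₚ.*-zeroʳ a)) }) ⟫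

con-0 : con 0ℤ ≈ []
con-0 = ⟪ (λ { zero → refl ; (suc k) → refl }) ⟫

con-neg : ∀ a → con (ℤ.- a) ≈ ⊝ con a
con-neg a = ⟪ (λ { zero → trans (sym (ℤₚ.-1*i≡-i a)) (sym (coeff-⊝ (con a) 0))
                 ; (suc k) → sym (coeff-⊝ (con a) (suc k)) }) ⟫

con-cancel : ∀ m .{{_ : ℤ.NonZero m}} f g → con m ⊗ f ≈ con m ⊗ g → f ≈ g
con-cancel m f g e = ⟪ (λ k → ℤₚ.*-cancelˡ-≡ m (coeff f k) (coeff g k)
  (trans (sym (coeff-con-⊗ m f k)) (trans (at e k) (coeff-con-⊗ m g k)))) ⟫

X : Poly
X = 0ℤ ∷ 1ℤ ∷ []

coeff-X⊗-zero : ∀ f → coeff (X ⊗ f) 0 ≡ 0ℤ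
coeff-X⊗-zero f = coeff-⊗-zero X f

coeff-X⊗-suc : ∀ f k → coeff (X ⊗ f) (suc k) ≡ coeff f k
coeff-X⊗-suc f k = trans (coeff-⊗-suc 0ℤ (con 1ℤ) f k) (trans (ℤₚ.+-identityˡ _) (at (R.*-identityˡ f) k))

∷≈ : ∀ a f → a ∷ f ≈ con a ⊕ X ⊗ f
∷≈ a f = ⟪ (λ k → sym (trans (coeff-⊕ (con a) (X ⊗ f) k) (lem k))) ⟫
  where
  lem : ∀ k → coeff (con a) k ℤ.+ coeff (X ⊗ f) k ≡ coeff (a ∷ f) k
  lem zero    = trans (cong (ℤ._+_ a) (coeff-X⊗-zero f)) (ℤₚ.+-identityʳ a)
  lem (suc k) = trans (ℤₚ.+-identityˡ _) (coeff-X⊗-suc f k)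

∷-cong : ∀ {a b f g} → a ≡ b → f ≈ g → a ∷ f ≈ b ∷ g
∷-cong refl e = ⟪ (λ { zero → refl ; (suc k) → at e k }) ⟫

∷-⊕ : ∀ a b f g → (a ℤ.+ b) ∷ (f ⊕ g) ≈ (a ∷ f) ⊕ (b ∷ g)
∷-⊕ a b f g = ≈-trans (∷-cong refl (≈-sym (+ₚ≈⊕ f g))) (+ₚ≈⊕ (a ∷ f) (b ∷ g))

∷-⊗ : ∀ a f g → (a ∷ f) ⊗ g ≈ con a ⊗ g ⊕ X ⊗ (f ⊗ g)
∷-⊗ a f g = ≈-trans (R.*-congʳ (∷≈ a f))
  (≈-trans (R.distribʳ g (con a) (X ⊗ f)) (R.+-congˡ (R.*-assoc X f g)))

con-⊗-∷ : ∀ a b f → con a ⊗ (b ∷ f) ≈ a ℤ.* b ∷ con a ⊗ f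
con-⊗-∷ a b f = ⟪ (λ { zero → coeff-con-⊗ a (b ∷ f) 0
  ; (suc k) → trans (coeff-con-⊗ a (b ∷ f) (suc k)) (sym (coeff-con-⊗ a f k)) }) ⟫

-- Polynomials with constant term ±1 behave like units for divisibility by integers.

UnitConstant : Poly → Set
UnitConstant f = coeff f 0 ℤ.* coeff f 0 ≡ 1ℤ

square-unit : ∀ a b → (a ℤ.* b) ℤ.* (a ℤ.* b) ≡ 1ℤ → a ℤ.* a ≡ 1ℤ
square-unit a b e = trans (sym (∣∣-square a)) (cong (λ u → + (u ℕ.* u)) u≡1)
  where
  ∣∣-square : ∀ a → + (ℤ.∣ a ∣ ℕ.* ℤ.∣ a ∣) ≡ a ℤ.* a
  ∣∣-square (+ a)      = ℤₚ.pos-* a a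
  ∣∣-square -[1+ a ]   = refl
  u≡1 : ℤ.∣ a ∣ ≡ 1
  u≡1 = ℕₚ.m*n≡1⇒m≡1 ℤ.∣ a ∣ _ (trans (sym (ℕₚ.*-assoc ℤ.∣ a ∣ ℤ.∣ b ∣ (ℤ.∣ a ∣ ℕ.* ℤ.∣ b ∣)))
    (trans (cong₂ ℕ._*_ (sym (ℤₚ.abs-* a b)) (sym (ℤₚ.abs-* a b)))
    (trans (sym (ℤₚ.abs-* (a ℤ.* b) (a ℤ.* b))) (cong ℤ.∣_∣ e))))

unitConstant-∣ : ∀ {f g} → f ∣⊗ g → UnitConstant g → UnitConstant f
unitConstant-∣ {f} {g} (h , e) u = square-unit (coeff f 0) (coeff h 0) (trans (cong₂ ℤ._*_ c≡ c≡) u)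
  where
  c≡ : coeff f 0 ℤ.* coeff h 0 ≡ coeff g 0
  c≡ = trans (sym (coeff-⊗-zero f h)) (at e 0)

tailₚ : Poly → Poly
tailₚ []      = []
tailₚ (a ∷ f) = f

tail-spec : ∀ f → f ≈ con (coeff f 0) ⊕ X ⊗ tailₚ f
tail-spec []      = ≈-sym (≈-trans (R.+-cong con-0 (R.zeroʳ X)) (R.+-identityʳ []))
tail-spec (a ∷ f) = ∷≈ a f

X-cancel : ∀ {f g} → X ⊗ f ≈ X ⊗ g → f ≈ g
X-cancel {f} {g} e = ⟪ (λ k → trans (sym (coeff-X⊗-suc f k)) (trans (at e (suc k)) (coeff-X⊗-suc g k))) ⟫

-- Division from the lowest coefficient upwards: the constant term of f is its own inverse, so the
-- equation of constant terms makes the first coefficient of the cofactor a multiple of `m`.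
-- Removing it and dividing by `X` leaves an equation of the same shape. This does the work of
-- Gauss's lemma.
con-∣-cofactor : ∀ f m → UnitConstant f → ∀ k h → f ⊗ k ≈ con m ⊗ h → con m ∣⊗ k
con-∣-cofactor f m u []      h e = [] , R.zeroʳ _
con-∣-cofactor f m u (b ∷ k) h e =
  let k′ , e′ = con-∣-cofactor f m u k (tailₚ h ⊖ con c ⊗ tailₚ f) (X-cancel rest)
  in (c ∷ k′) , ≈-trans (con-⊗-∷ m c k′) (∷-cong (sym b≡) e′)
  where
  f₀ = coeff f 0
  h₀ = coeff h 0
  c = f₀ ℤ.* h₀
  f₀b≡mh₀ : f₀ ℤ.* b ≡ m ℤ.* h₀
  f₀b≡mh₀ = trans (sym (coeff-⊗-zero f (b ∷ k))) (trans (at e 0) (coeff-con-⊗ m h 0))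
  b≡ : b ≡ m ℤ.* c
  b≡ = begin
    b                        ≡⟨ sym (ℤₚ.*-identityˡ b) ⟩
    1ℤ ℤ.* b                 ≡⟨ cong (ℤ._* b) (sym u) ⟩
    f₀ ℤ.* f₀ ℤ.* b          ≡⟨ ℤₚ.*-assoc f₀ f₀ b ⟩
    f₀ ℤ.* (f₀ ℤ.* b)        ≡⟨ cong (f₀ ℤ.*_) f₀b≡mh₀ ⟩
    f₀ ℤ.* (m ℤ.* h₀)        ≡⟨ swap f₀ m h₀ ⟩
    m ℤ.* c ∎
    where
    open ≡-Reasoning
    swap : ∀ x y z → x ℤ.* (y ℤ.* z) ≡ y ℤ.* (x ℤ.* z)
    swap = solve-∀
  f₀b≈mh₀ : con f₀ ⊗ con b ≈ con m ⊗ con h₀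
  f₀b≈mh₀ = ≈-trans (≈-sym (con-* f₀ b)) (≈-trans (≈-reflexive (cong con f₀b≡mh₀)) (con-* m h₀))
  b≈ : con b ≈ con m ⊗ con c
  b≈ = ≈-trans (≈-reflexive (cong con b≡)) (con-* m c)
  open ≈-Reasoning
  rest : X ⊗ (f ⊗ k) ≈ X ⊗ (con m ⊗ (tailₚ h ⊖ con c ⊗ tailₚ f))
  rest = begin
    X ⊗ (f ⊗ k)                                        ≈⟨ lem₁ X f k (con b) ⟩
    f ⊗ (con b ⊕ X ⊗ k) ⊖ f ⊗ con b                    ≈⟨ R.+-cong (R.*-congˡ (≈-sym (∷≈ b k))) (R.-‿cong (R.*-congʳ (tail-spec f))) ⟩
    f ⊗ (b ∷ k) ⊖ (con f₀ ⊕ X ⊗ tailₚ f) ⊗ con b       ≈⟨ R.+-congʳ (≈-trans e (R.*-congˡ (tail-spec h))) ⟩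
    con m ⊗ (con h₀ ⊕ X ⊗ tailₚ h) ⊖ (con f₀ ⊕ X ⊗ tailₚ f) ⊗ con b   ≈⟨ lem₂ (con m) (con h₀) X (tailₚ h) (con f₀) (tailₚ f) (con b) ⟩
    (con m ⊗ con h₀ ⊖ con f₀ ⊗ con b) ⊕ X ⊗ (con m ⊗ tailₚ h ⊖ con b ⊗ tailₚ f)
      ≈⟨ R.+-cong (≈-trans (R.+-congˡ (R.-‿cong f₀b≈mh₀)) (R.-‿inverseʳ _)) (R.*-congˡ (R.+-congˡ (R.-‿cong (R.*-congʳ b≈)))) ⟩
    [] ⊕ X ⊗ (con m ⊗ tailₚ h ⊖ (con m ⊗ con c) ⊗ tailₚ f)   ≈⟨ lem₃ X (con m) (tailₚ h) (con c) (tailₚ f) ⟩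
    X ⊗ (con m ⊗ (tailₚ h ⊖ con c ⊗ tailₚ f)) ∎
    where
    opaque
      unfolding _⊕_
      lem₁ : ∀ x f k b → x ⊗ (f ⊗ k) ≈ f ⊗ (b ⊕ x ⊗ k) ⊕ ⊝ (f ⊗ b)
      lem₁ = solve-∀-in polyACR
      lem₂ : ∀ m h x h′ f f′ b → m ⊗ (h ⊕ x ⊗ h′) ⊕ ⊝ ((f ⊕ x ⊗ f′) ⊗ b) ≈ (m ⊗ h ⊕ ⊝ (f ⊗ b)) ⊕ x ⊗ (m ⊗ h′ ⊕ ⊝ (b ⊗ f′))
      lem₂ = solve-∀-in polyACR
      lem₃ : ∀ x m h c f → [] ⊕ x ⊗ (m ⊗ h ⊕ ⊝ ((m ⊗ c) ⊗ f)) ≈ x ⊗ (m ⊗ (h ⊕ ⊝ (c ⊗ f)))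
      lem₃ = solve-∀-in polyACR

∣-con-cancel : ∀ {f g} m .{{_ : ℤ.NonZero m}} → UnitConstant f → f ∣⊗ con m ⊗ g → f ∣⊗ g
∣-con-cancel {f} {g} m u (k , e) with con-∣-cofactor f m u k g e
... | k′ , e′ = k′ , con-cancel m (f ⊗ k′) g (≈-trans (lem (con m) f k′) (≈-trans (R.*-congˡ e′) e))
  where
  opaque
    unfolding _⊕_
    lem : ∀ c f k → c ⊗ (f ⊗ k) ≈ f ⊗ (c ⊗ k)
    lem = solve-∀-in polyACR

-- The case of the integer 0 in `con-∣-cofactor`: a multiple of 0 is 0. Cancellation of f is thus
-- obtained without degrees.
*-zero-cancel : ∀ f k → UnitConstant f → f ⊗ k ≈ [] → k ≈ []
*-zero-cancel f k u e with con-∣-cofactor f 0ℤ u k [] (≈-trans e (≈-sym (R.zeroʳ _)))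
... | k′ , e′ = ≈-trans (≈-sym e′) (≈-trans (R.*-congʳ con-0) (R.zeroˡ k′))

*-cancelˡ : ∀ f {g h} → UnitConstant f → f ⊗ g ≈ f ⊗ h → g ≈ h
*-cancelˡ f {g} {h} u e = begin
  g               ≈⟨ lem₁ g h ⟩
  (g ⊖ h) ⊕ h   ≈⟨ R.+-congʳ (*-zero-cancel f (g ⊖ h) u (≈-trans (lem₂ f g h) (≈-trans (R.+-congʳ e) (R.-‿inverseʳ (f ⊗ h))))) ⟩
  [] ⊕ h        ≈⟨ R.+-identityˡ h ⟩
  h ∎
  where
  open ≈-Reasoning
  opaque
    unfolding _⊕_
    lem₁ : ∀ g h → g ≈ (g ⊕ ⊝ h) ⊕ h
    lem₁ = solve-∀-in polyACR
    lem₂ : ∀ f g h → f ⊗ (g ⊕ ⊝ h) ≈ f ⊗ g ⊕ ⊝ (f ⊗ h)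
    lem₂ = solve-∀-in polyACR

-- Substitution

infix 8 _∘ₚ_
_∘ₚ_ : Poly → Poly → Poly
[]      ∘ₚ u = []
(a ∷ f) ∘ₚ u = con a ⊕ u ⊗ (f ∘ₚ u)

∘-zero : ∀ f u → f ≋ [] → f ∘ₚ u ≈ []
∘-zero []      u e = ≈-refl
∘-zero (a ∷ f) u e = begin
  con a ⊕ u ⊗ f ∘ₚ u   ≈⟨ R.+-cong (≈-trans (≈-reflexive (cong con (e 0))) con-0) (R.*-congˡ (∘-zero f u (λ k → e (suc k)))) ⟩
  [] ⊕ u ⊗ []          ≈⟨ R.+-identityˡ _ ⟩
  u ⊗ []               ≈⟨ R.zeroʳ u ⟩
  [] ∎
  where open ≈-Reasoning

∘-congˡ : ∀ f g u → f ≈ g → f ∘ₚ u ≈ g ∘ₚ u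
∘-congˡ []      g       u e = ≈-sym (∘-zero g u (at (≈-sym e)))
∘-congˡ (a ∷ f) []      u e = ∘-zero (a ∷ f) u (at e)
∘-congˡ (a ∷ f) (b ∷ g) u e = R.+-cong (≈-reflexive (cong con (at e 0)))
  (R.*-congˡ (∘-congˡ f g u ⟪ (λ k → at e (suc k)) ⟫))

∘-congʳ : ∀ f {u v} → u ≈ v → f ∘ₚ u ≈ f ∘ₚ v
∘-congʳ []      e = ≈-refl
∘-congʳ (a ∷ f) e = R.+-congˡ (R.*-cong e (∘-congʳ f e))

∘-+ : ∀ f g u → (f ⊕ g) ∘ₚ u ≈ f ∘ₚ u ⊕ g ∘ₚ u
∘-+ []      g       u = ≈-trans (∘-congˡ _ _ u (R.+-identityˡ g)) (≈-sym (R.+-identityˡ _))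
∘-+ (a ∷ f) []      u = ≈-trans (∘-congˡ _ _ u (R.+-identityʳ (a ∷ f))) (≈-sym (R.+-identityʳ _))
∘-+ (a ∷ f) (b ∷ g) u = begin
  ((a ∷ f) ⊕ (b ∷ g)) ∘ₚ u                        ≈⟨ ∘-congˡ _ _ u (≈-sym (∷-⊕ a b f g)) ⟩
  con (a ℤ.+ b) ⊕ u ⊗ (f ⊕ g) ∘ₚ u                ≈⟨ R.+-cong (con-+ a b) (R.*-congˡ (∘-+ f g u)) ⟩
  (con a ⊕ con b) ⊕ u ⊗ (f ∘ₚ u ⊕ g ∘ₚ u)         ≈⟨ lem (con a) (con b) u (f ∘ₚ u) (g ∘ₚ u) ⟩
  (con a ⊕ u ⊗ f ∘ₚ u) ⊕ (con b ⊕ u ⊗ g ∘ₚ u)  ∎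
  where
  open ≈-Reasoning
  opaque
    unfolding _⊕_
    lem : ∀ a b u f g → (a ⊕ b) ⊕ u ⊗ (f ⊕ g) ≈ (a ⊕ u ⊗ f) ⊕ (b ⊕ u ⊗ g)
    lem = solve-∀-in polyACR

∘-con-⊗ : ∀ a f u → (con a ⊗ f) ∘ₚ u ≈ con a ⊗ f ∘ₚ u
∘-con-⊗ a []      u = ≈-trans (∘-congˡ _ [] u (R.zeroʳ _)) (≈-sym (R.zeroʳ _))
∘-con-⊗ a (b ∷ f) u = begin
  (con a ⊗ (b ∷ f)) ∘ₚ u                       ≈⟨ ∘-congˡ _ _ u (con-⊗-∷ a b f) ⟩
  con (a ℤ.* b) ⊕ u ⊗ (con a ⊗ f) ∘ₚ u         ≈⟨ R.+-cong (con-* a b) (R.*-congˡ (∘-con-⊗ a f u)) ⟩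
  con a ⊗ con b ⊕ u ⊗ (con a ⊗ f ∘ₚ u)         ≈⟨ lem (con a) (con b) u (f ∘ₚ u) ⟩
  con a ⊗ (con b ⊕ u ⊗ f ∘ₚ u) ∎
  where
  open ≈-Reasoning
  opaque
    unfolding _⊕_
    lem : ∀ a b u f → a ⊗ b ⊕ u ⊗ (a ⊗ f) ≈ a ⊗ (b ⊕ u ⊗ f)
    lem = solve-∀-in polyACR

∘-X⊗ : ∀ f u → (X ⊗ f) ∘ₚ u ≈ u ⊗ f ∘ₚ u
∘-X⊗ f u = begin
  (X ⊗ f) ∘ₚ u           ≈⟨ ∘-congˡ _ _ u (≈-sym (≈-trans (∷≈ 0ℤ f) (≈-trans (R.+-congʳ con-0) (R.+-identityˡ _)))) ⟩
  con 0ℤ ⊕ u ⊗ f ∘ₚ u    ≈⟨ ≈-trans (R.+-congʳ con-0) (R.+-identityˡ _) ⟩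
  u ⊗ f ∘ₚ u ∎
  where open ≈-Reasoning

∘-* : ∀ f g u → (f ⊗ g) ∘ₚ u ≈ f ∘ₚ u ⊗ g ∘ₚ u
∘-* []      g u = ≈-trans (∘-congˡ _ [] u (R.zeroˡ g)) (≈-sym (R.zeroˡ _))
∘-* (a ∷ f) g u = begin
  ((a ∷ f) ⊗ g) ∘ₚ u                              ≈⟨ ∘-congˡ _ _ u (∷-⊗ a f g) ⟩
  (con a ⊗ g ⊕ X ⊗ (f ⊗ g)) ∘ₚ u                  ≈⟨ ∘-+ (con a ⊗ g) _ u ⟩
  (con a ⊗ g) ∘ₚ u ⊕ (X ⊗ (f ⊗ g)) ∘ₚ u           ≈⟨ R.+-cong (∘-con-⊗ a g u) (≈-trans (∘-X⊗ (f ⊗ g) u) (R.*-congˡ (∘-* f g u))) ⟩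
  con a ⊗ g ∘ₚ u ⊕ u ⊗ (f ∘ₚ u ⊗ g ∘ₚ u)          ≈⟨ lem (con a) u (f ∘ₚ u) (g ∘ₚ u) ⟩
  (con a ⊕ u ⊗ f ∘ₚ u) ⊗ g ∘ₚ u ∎
  where
  open ≈-Reasoning
  opaque
    unfolding _⊕_
    lem : ∀ a u f g → a ⊗ g ⊕ u ⊗ (f ⊗ g) ≈ (a ⊕ u ⊗ f) ⊗ g
    lem = solve-∀-in polyACR

con-∘ : ∀ a u → con a ∘ₚ u ≈ con a
con-∘ a u = ≈-trans (R.+-congˡ (R.zeroʳ u)) (R.+-identityʳ _)

X-∘ : ∀ u → X ∘ₚ u ≈ u
X-∘ u = ≈-trans (R.+-cong con-0 (≈-trans (R.*-congˡ (con-∘ 1ℤ u)) (R.*-identityʳ u))) (R.+-identityˡ u)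

∘-X : ∀ f → f ∘ₚ X ≈ f
∘-X []      = ≈-refl
∘-X (a ∷ f) = ≈-trans (R.+-congˡ (R.*-congˡ (∘-X f))) (≈-sym (∷≈ a f))

∘-assoc : ∀ f u v → (f ∘ₚ u) ∘ₚ v ≈ f ∘ₚ (u ∘ₚ v)
∘-assoc []      u v = ≈-refl
∘-assoc (a ∷ f) u v = begin
  (con a ⊕ u ⊗ f ∘ₚ u) ∘ₚ v             ≈⟨ ∘-+ (con a) (u ⊗ f ∘ₚ u) v ⟩
  con a ∘ₚ v ⊕ (u ⊗ f ∘ₚ u) ∘ₚ v        ≈⟨ R.+-cong (con-∘ a v) (∘-* u (f ∘ₚ u) v) ⟩
  con a ⊕ u ∘ₚ v ⊗ (f ∘ₚ u) ∘ₚ v        ≈⟨ R.+-congˡ (R.*-congˡ (∘-assoc f u v)) ⟩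
  con a ⊕ u ∘ₚ v ⊗ f ∘ₚ (u ∘ₚ v) ∎
  where open ≈-Reasoning

∘-^ : ∀ f k u → (f ^ₚ k) ∘ₚ u ≈ (f ∘ₚ u) ^ₚ k
∘-^ f zero    u = con-∘ 1ℤ u
∘-^ f (suc k) u = ≈-trans (∘-* f (f ^ₚ k) u) (R.*-congˡ (∘-^ f k u))

-- Geometric sums

geom : ℕ → Poly → Poly
geom zero    u = []
geom (suc k) u = con 1ℤ ⊕ u ⊗ geom k u

geom-cong : ∀ k {u v} → u ≈ v → geom k u ≈ geom k v
geom-cong zero    e = ≈-refl
geom-cong (suc k) e = R.+-congˡ (R.*-cong e (geom-cong k e))

geom-+ : ∀ a b u → geom (a ℕ.+ b) u ≈ geom a u ⊕ u ^ₚ a ⊗ geom b u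
geom-+ zero    b u = ≈-sym (≈-trans (R.+-identityˡ _) (R.*-identityˡ _))
geom-+ (suc a) b u = ≈-trans (R.+-congˡ (R.*-congˡ (geom-+ a b u))) (lem u (geom a u) (u ^ₚ a) (geom b u))
  where
  opaque
    unfolding _⊕_
    lem : ∀ u g v h → con 1ℤ ⊕ u ⊗ (g ⊕ v ⊗ h) ≈ (con 1ℤ ⊕ u ⊗ g) ⊕ (u ⊗ v) ⊗ h
    lem = solve-∀-in polyACR

geom-* : ∀ a b u → geom (a ℕ.* b) u ≈ geom a u ⊗ geom b (u ^ₚ a)
geom-* a zero    u rewrite ℕₚ.*-zeroʳ a = ≈-sym (R.zeroʳ _)
geom-* a (suc b) u rewrite ℕₚ.*-suc a b = begin
  geom (a ℕ.+ a ℕ.* b) u                               ≈⟨ geom-+ a (a ℕ.* b) u ⟩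
  geom a u ⊕ u ^ₚ a ⊗ geom (a ℕ.* b) u                ≈⟨ R.+-congˡ (R.*-congˡ (geom-* a b u)) ⟩
  geom a u ⊕ u ^ₚ a ⊗ (geom a u ⊗ geom b (u ^ₚ a))    ≈⟨ lem (geom a u) (u ^ₚ a) (geom b (u ^ₚ a)) ⟩
  geom a u ⊗ (con 1ℤ ⊕ u ^ₚ a ⊗ geom b (u ^ₚ a)) ∎
  where
  open ≈-Reasoning
  opaque
    unfolding _⊕_
    lem : ∀ g v h → g ⊕ v ⊗ (g ⊗ h) ≈ g ⊗ (con 1ℤ ⊕ v ⊗ h)
    lem = solve-∀-in polyACR

telescope : ∀ k u → (u ⊖ con 1ℤ) ⊗ geom k u ≈ u ^ₚ k ⊖ con 1ℤ
telescope zero    u = ≈-trans (R.zeroʳ _) (≈-sym (R.-‿inverseʳ (con 1ℤ)))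
telescope (suc k) u = begin
  (u ⊖ con 1ℤ) ⊗ (con 1ℤ ⊕ u ⊗ geom k u)                ≈⟨ lem₁ u (geom k u) ⟩
  (u ⊕ ⊝ con 1ℤ) ⊕ u ⊗ ((u ⊕ ⊝ con 1ℤ) ⊗ geom k u)   ≈⟨ R.+-congˡ (R.*-congˡ (telescope k u)) ⟩
  (u ⊕ ⊝ con 1ℤ) ⊕ u ⊗ (u ^ₚ k ⊖ con 1ℤ)                ≈⟨ lem₂ u (u ^ₚ k) ⟩
  u ⊗ u ^ₚ k ⊖ con 1ℤ ∎
  where
  open ≈-Reasoning
  opaque
    unfolding _⊕_
    lem₁ : ∀ u g → (u ⊕ ⊝ con 1ℤ) ⊗ (con 1ℤ ⊕ u ⊗ g) ≈ (u ⊕ ⊝ con 1ℤ) ⊕ u ⊗ ((u ⊕ ⊝ con 1ℤ) ⊗ g)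
    lem₁ = solve-∀-in polyACR
    lem₂ : ∀ u v → (u ⊕ ⊝ con 1ℤ) ⊕ u ⊗ (v ⊕ ⊝ con 1ℤ) ≈ u ⊗ v ⊕ ⊝ con 1ℤ
    lem₂ = solve-∀-in polyACR

-- A Bézout relation between the exponents lifts to geometric sums: m x = 1 + k y gives
-- `geom (m x) u` = 1 + u `geom (k y) u`, and `geom-*` splits off `geom m u` on one side and
-- `geom k u` on the other.
geom-bézout : ∀ m k u → Coprime m k → ∃ λ s → ∃ λ t → geom m u ⊗ s ⊕ geom k u ⊗ t ≈ con 1ℤ
geom-bézout m k u c with coprime-Bézout c
... | Bézout.Identity.+- x y eq = geom x (u ^ₚ m) , ⊝ (u ⊗ geom y (u ^ₚ k)) , (begin
    geom m u ⊗ geom x (u ^ₚ m) ⊕ geom k u ⊗ ⊝ (u ⊗ geom y (u ^ₚ k))   ≈⟨ lem₁ (geom m u ⊗ geom x (u ^ₚ m)) (geom k u) u (geom y (u ^ₚ k)) ⟩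
    geom m u ⊗ geom x (u ^ₚ m) ⊖ u ⊗ (geom k u ⊗ geom y (u ^ₚ k))      ≈⟨ R.+-cong (≈-sym (geom-* m x u)) (R.-‿cong (R.*-congˡ (≈-sym (geom-* k y u)))) ⟩
    geom (m ℕ.* x) u ⊖ u ⊗ geom (k ℕ.* y) u                           ≡⟨ cong (λ z → geom z u ⊖ u ⊗ geom (k ℕ.* y) u) (trans (ℕₚ.*-comm m x) (trans (sym eq) (cong suc (ℕₚ.*-comm y k)))) ⟩
    (con 1ℤ ⊕ u ⊗ geom (k ℕ.* y) u) ⊖ u ⊗ geom (k ℕ.* y) u          ≈⟨ lem₂ (u ⊗ geom (k ℕ.* y) u) ⟩
    con 1ℤ ∎)
  where
  open ≈-Reasoning
  opaque
    unfolding _⊕_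
    lem₁ : ∀ a b u c → a ⊕ b ⊗ ⊝ (u ⊗ c) ≈ a ⊕ ⊝ (u ⊗ (b ⊗ c))
    lem₁ = solve-∀-in polyACR
    lem₂ : ∀ a → (con 1ℤ ⊕ a) ⊕ ⊝ a ≈ con 1ℤ
    lem₂ = solve-∀-in polyACR
... | Bézout.Identity.-+ x y eq = ⊝ (u ⊗ geom x (u ^ₚ m)) , geom y (u ^ₚ k) , (begin
    geom m u ⊗ ⊝ (u ⊗ geom x (u ^ₚ m)) ⊕ geom k u ⊗ geom y (u ^ₚ k)   ≈⟨ lem₁ (geom k u ⊗ geom y (u ^ₚ k)) (geom m u) u (geom x (u ^ₚ m)) ⟩
    geom k u ⊗ geom y (u ^ₚ k) ⊖ u ⊗ (geom m u ⊗ geom x (u ^ₚ m))      ≈⟨ R.+-cong (≈-sym (geom-* k y u)) (R.-‿cong (R.*-congˡ (≈-sym (geom-* m x u)))) ⟩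
    geom (k ℕ.* y) u ⊖ u ⊗ geom (m ℕ.* x) u                           ≡⟨ cong (λ z → geom z u ⊖ u ⊗ geom (m ℕ.* x) u) (trans (ℕₚ.*-comm k y) (trans (sym eq) (cong suc (ℕₚ.*-comm x m)))) ⟩
    (con 1ℤ ⊕ u ⊗ geom (m ℕ.* x) u) ⊖ u ⊗ geom (m ℕ.* x) u          ≈⟨ lem₂ (u ⊗ geom (m ℕ.* x) u) ⟩
    con 1ℤ ∎)
  where
  open ≈-Reasoning
  opaque
    unfolding _⊕_
    lem₁ : ∀ a b u c → b ⊗ ⊝ (u ⊗ c) ⊕ a ≈ a ⊕ ⊝ (u ⊗ (b ⊗ c))
    lem₁ = solve-∀-in polyACR
    lem₂ : ∀ a → (con 1ℤ ⊕ a) ⊕ ⊝ a ≈ con 1ℤ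
    lem₂ = solve-∀-in polyACR

-- Both `geom m u ⊗ geom k (u ^ₚ m)` and `geom k u ⊗ geom m (u ^ₚ k)` are the geometric sum of
-- length m k, and `geom m u` is prime to `geom k u` by `geom-bézout`. For u = x this yields Φ_p(x)
-- ∣ Φ_p(x^q), with the cofactor that will serve as Φ_pq.
geom-∣ : ∀ m k u → Coprime m k → geom m u ∣⊗ geom m (u ^ₚ k)
geom-∣ m k u c with geom-bézout m k u c
... | s , t , e = s ⊗ geom m (u ^ₚ k) ⊕ geom k (u ^ₚ m) ⊗ t , (begin
  geom m u ⊗ (s ⊗ geom m (u ^ₚ k) ⊕ geom k (u ^ₚ m) ⊗ t)   ≈⟨ lem₁ (geom m u) s (geom m (u ^ₚ k)) (geom k (u ^ₚ m)) t ⟩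
  geom m (u ^ₚ k) ⊗ (geom m u ⊗ s) ⊕ (geom m u ⊗ geom k (u ^ₚ m)) ⊗ t   ≈⟨ R.+-congˡ (R.*-congʳ swap) ⟩
  geom m (u ^ₚ k) ⊗ (geom m u ⊗ s) ⊕ (geom k u ⊗ geom m (u ^ₚ k)) ⊗ t   ≈⟨ lem₂ (geom m (u ^ₚ k)) (geom m u ⊗ s) (geom k u) t ⟩
  geom m (u ^ₚ k) ⊗ (geom m u ⊗ s ⊕ geom k u ⊗ t)         ≈⟨ R.*-congˡ e ⟩
  geom m (u ^ₚ k) ⊗ con 1ℤ                                   ≈⟨ R.*-identityʳ _ ⟩
  geom m (u ^ₚ k) ∎)
  where
  open ≈-Reasoning
  swap : geom m u ⊗ geom k (u ^ₚ m) ≈ geom k u ⊗ geom m (u ^ₚ k)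
  swap = begin
    geom m u ⊗ geom k (u ^ₚ m)   ≈⟨ ≈-sym (geom-* m k u) ⟩
    geom (m ℕ.* k) u             ≡⟨ cong (λ z → geom z u) (ℕₚ.*-comm m k) ⟩
    geom (k ℕ.* m) u             ≈⟨ geom-* k m u ⟩
    geom k u ⊗ geom m (u ^ₚ k) ∎
  opaque
    unfolding _⊕_
    lem₁ : ∀ g s h j t → g ⊗ (s ⊗ h ⊕ j ⊗ t) ≈ h ⊗ (g ⊗ s) ⊕ (g ⊗ j) ⊗ t
    lem₁ = solve-∀-in polyACR
    lem₂ : ∀ h a k t → h ⊗ a ⊕ (k ⊗ h) ⊗ t ≈ h ⊗ (a ⊕ k ⊗ t)
    lem₂ = solve-∀-in polyACR

mod-geom : ∀ k {u v m} → u ≈ v [mod m ] → geom k u ≈ geom k v [mod m ]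
mod-geom zero    e = mod-refl
mod-geom (suc k) e = mod-+ mod-refl (mod-* e (mod-geom k e))

geom-one : ∀ k → geom k (con 1ℤ) ≈ con (+ k)
geom-one zero    = ≈-sym con-0
geom-one (suc k) = ≈-trans (R.+-congˡ (≈-trans (R.*-identityˡ _) (geom-one k))) (≈-sym (con-+ 1ℤ (+ k)))

-- θ f = X f′

θ : Poly → Poly
θ []      = []
θ (a ∷ f) = X ⊗ (f ⊕ θ f)

coeff-θ : ∀ f k → coeff (θ f) k ≡ + k ℤ.* coeff f k
coeff-θ []      k       = sym (ℤₚ.*-zeroʳ (+ k))
coeff-θ (a ∷ f) zero    = coeff-X⊗-zero (f ⊕ θ f)
coeff-θ (a ∷ f) (suc k) = trans (coeff-X⊗-suc (f ⊕ θ f) k) (trans (coeff-⊕ f (θ f) k)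
  (trans (cong (ℤ._+_ (coeff f k)) (coeff-θ f k)) (lem (+ k) (coeff f k))))
  where
  lem : ∀ k c → c ℤ.+ k ℤ.* c ≡ (1ℤ ℤ.+ k) ℤ.* c
  lem = solve-∀

θ-cong : ∀ {f g} → f ≈ g → θ f ≈ θ g
θ-cong {f} {g} e = ⟪ (λ k → trans (coeff-θ f k) (trans (cong (+ k ℤ.*_) (at e k)) (sym (coeff-θ g k)))) ⟫

θ-+ : ∀ f g → θ (f ⊕ g) ≈ θ f ⊕ θ g
θ-+ f g = ⟪ (λ k → trans (coeff-θ (f ⊕ g) k) (trans (cong (+ k ℤ.*_) (coeff-⊕ f g k))
  (trans (ℤₚ.*-distribˡ-+ (+ k) (coeff f k) (coeff g k)) (trans (sym (cong₂ ℤ._+_ (coeff-θ f k) (coeff-θ g k)))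
  (sym (coeff-⊕ (θ f) (θ g) k)))))) ⟫

θ-X* : ∀ f → θ (X ⊗ f) ≈ X ⊗ (f ⊕ θ f)
θ-X* f = θ-cong {X ⊗ f} {0ℤ ∷ f} (≈-sym (≈-trans (∷≈ 0ℤ f) (≈-trans (R.+-congʳ con-0) (R.+-identityˡ _))))

θ-con-⊗ : ∀ a f → θ (con a ⊗ f) ≈ con a ⊗ θ f
θ-con-⊗ a f = ⟪ (λ k → trans (coeff-θ (con a ⊗ f) k) (trans (cong (+ k ℤ.*_) (coeff-con-⊗ a f k))
  (trans (swap (+ k) a (coeff f k)) (trans (cong (a ℤ.*_) (sym (coeff-θ f k))) (sym (coeff-con-⊗ a (θ f) k)))))) ⟫
  where
  swap : ∀ x y z → x ℤ.* (y ℤ.* z) ≡ y ℤ.* (x ℤ.* z)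
  swap = solve-∀

θ-* : ∀ f g → θ (f ⊗ g) ≈ θ f ⊗ g ⊕ f ⊗ θ g
θ-* []      g = ≈-trans (θ-cong (R.zeroˡ g)) (≈-sym (≈-trans (R.+-cong (R.zeroˡ g) (R.zeroˡ (θ g))) (R.+-identityˡ [])))
θ-* (a ∷ f) g = begin
  θ ((a ∷ f) ⊗ g)                                   ≈⟨ θ-cong (∷-⊗ a f g) ⟩
  θ (con a ⊗ g ⊕ X ⊗ (f ⊗ g))                       ≈⟨ θ-+ (con a ⊗ g) _ ⟩
  θ (con a ⊗ g) ⊕ θ (X ⊗ (f ⊗ g))                   ≈⟨ R.+-cong (θ-con-⊗ a g) (≈-trans (θ-X* (f ⊗ g)) (R.*-congˡ (R.+-congˡ (θ-* f g)))) ⟩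
  con a ⊗ θ g ⊕ X ⊗ (f ⊗ g ⊕ (θ f ⊗ g ⊕ f ⊗ θ g))   ≈⟨ lem (con a) X f g (θ f) (θ g) ⟩
  X ⊗ (f ⊕ θ f) ⊗ g ⊕ (con a ⊕ X ⊗ f) ⊗ θ g         ≈⟨ R.+-congˡ (R.*-congʳ (≈-sym (∷≈ a f))) ⟩
  X ⊗ (f ⊕ θ f) ⊗ g ⊕ (a ∷ f) ⊗ θ g ∎
  where
  open ≈-Reasoning
  opaque
    unfolding _⊕_
    lem : ∀ a x f g f′ g′ → a ⊗ g′ ⊕ x ⊗ (f ⊗ g ⊕ (f′ ⊗ g ⊕ f ⊗ g′)) ≈ x ⊗ (f ⊕ f′) ⊗ g ⊕ (a ⊕ x ⊗ f) ⊗ g′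
    lem = solve-∀-in polyACR

θ-con : ∀ a → θ (con a) ≈ []
θ-con a = ≈-trans (R.*-congˡ (R.+-identityˡ [])) (R.zeroʳ X)

θ-X^ : ∀ n → θ (X ^ₚ n) ≈ con (+ n) ⊗ X ^ₚ n
θ-X^ zero    = ≈-trans (θ-con 1ℤ) (≈-sym (≈-trans (R.*-congʳ con-0) (R.zeroˡ _)))
θ-X^ (suc n) = begin
  θ (X ⊗ X ^ₚ n)                      ≈⟨ θ-X* (X ^ₚ n) ⟩
  X ⊗ (X ^ₚ n ⊕ θ (X ^ₚ n))           ≈⟨ R.*-congˡ (R.+-congˡ (θ-X^ n)) ⟩
  X ⊗ (X ^ₚ n ⊕ con (+ n) ⊗ X ^ₚ n)  ≈⟨ lem X (X ^ₚ n) (con (+ n)) ⟩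
  (con 1ℤ ⊕ con (+ n)) ⊗ (X ⊗ X ^ₚ n)  ≈⟨ R.*-congʳ (≈-sym (con-+ 1ℤ (+ n))) ⟩
  con (+ suc n) ⊗ (X ⊗ X ^ₚ n) ∎
  where
  open ≈-Reasoning
  opaque
    unfolding _⊕_
    lem : ∀ x y n → x ⊗ (y ⊕ n ⊗ y) ≈ (con 1ℤ ⊕ n) ⊗ (x ⊗ y)
    lem = solve-∀-in polyACR

-- The polynomial x^n - 1 and its squarefreeness

X^n-1 : ℕ → Poly
X^n-1 n = X ^ₚ n ⊖ con 1ℤ

θ-X^n-1 : ∀ n → θ (X^n-1 n) ≈ con (+ n) ⊗ X ^ₚ n
θ-X^n-1 n = ≈-trans (θ-+ (X ^ₚ n) (⊝ con 1ℤ)) (≈-trans (R.+-cong (θ-X^ n) (≈-trans (θ-cong (≈-sym (con-neg 1ℤ))) (θ-con -1ℤ))) (R.+-identityʳ _))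

monomial≈ : ∀ n → monomial n ≈ X ^ₚ n
monomial≈ zero    = ≈-refl
monomial≈ (suc n) = ≈-trans (∷≈ 0ℤ (monomial n)) (≈-trans (R.+-cong con-0 (R.*-congˡ (monomial≈ n))) (R.+-identityˡ _))

Xⁿ-1≈ : ∀ n → Xⁿ-1 n ≈ X^n-1 n
Xⁿ-1≈ n = ≈-trans (+ₚ≈⊕ (monomial n) (con -1ℤ)) (R.+-cong (monomial≈ n) (con-neg 1ℤ))

X^n-1-unitConstant : ∀ n .{{_ : NonZero n}} → UnitConstant (X^n-1 n)
X^n-1-unitConstant (suc n) = cong₂ ℤ._*_ c c
  where
  c : coeff (X^n-1 (suc n)) 0 ≡ -1ℤ
  c = trans (coeff-⊕ (X ⊗ X ^ₚ n) (⊝ con 1ℤ) 0) (cong₂ ℤ._+_ (coeff-X⊗-zero (X ^ₚ n)) (coeff-⊝ (con 1ℤ) 0))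

-- Differentiating u v c = Xⁿ - 1 exhibits n as a combination of u and v.
squarefree-cancel : ∀ n .{{_ : NonZero n}} {u v c w} → u ⊗ v ⊗ c ≈ X^n-1 n → u ∣⊗ v ⊗ w → u ∣⊗ w
squarefree-cancel n@(suc _) {u} {v} {c} {w} e (t , e′) =
  ∣-con-cancel (+ n) (unitConstant-∣ (v ⊗ c , ≈-trans (≈-sym (R.*-assoc u v c)) e) (X^n-1-unitConstant n))
    ((θ v ⊗ c ⊕ v ⊗ θ c ⊖ con (+ n) ⊗ (v ⊗ c)) ⊗ w ⊕ θ u ⊗ c ⊗ t , (begin
      u ⊗ ((θ v ⊗ c ⊕ v ⊗ θ c ⊖ con (+ n) ⊗ (v ⊗ c)) ⊗ w ⊕ θ u ⊗ c ⊗ t)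
        ≈⟨ lem₁ u v c w t (θ u) (θ v) (θ c) (con (+ n)) ⟩
      ((u ⊗ θ v) ⊗ c ⊕ u ⊗ v ⊗ θ c ⊖ con (+ n) ⊗ (u ⊗ v ⊗ c)) ⊗ w ⊕ θ u ⊗ c ⊗ (u ⊗ t)
        ≈⟨ R.+-congˡ (R.*-congˡ e′) ⟩
      ((u ⊗ θ v) ⊗ c ⊕ u ⊗ v ⊗ θ c ⊖ con (+ n) ⊗ (u ⊗ v ⊗ c)) ⊗ w ⊕ θ u ⊗ c ⊗ (v ⊗ w)
        ≈⟨ lem₂ u v c w (θ u) (θ v) (θ c) (con (+ n)) ⟩
      (((θ u ⊗ v ⊕ u ⊗ θ v) ⊗ c ⊕ u ⊗ v ⊗ θ c) ⊖ con (+ n) ⊗ (u ⊗ v ⊗ c)) ⊗ w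
        ≈⟨ R.*-congʳ (R.+-cong (≈-trans (≈-sym (≈-trans (θ-* (u ⊗ v) c) (R.+-congʳ (R.*-congʳ (θ-* u v)))))
             (≈-trans (θ-cong e) (θ-X^n-1 n))) (R.-‿cong (R.*-congˡ e))) ⟩
      (con (+ n) ⊗ X ^ₚ n ⊖ con (+ n) ⊗ (X ^ₚ n ⊖ con 1ℤ)) ⊗ w
        ≈⟨ lem₃ (con (+ n)) (X ^ₚ n) w ⟩
      con (+ n) ⊗ w ∎))
  where
  open ≈-Reasoning
  opaque
    unfolding _⊕_
    lem₁ : ∀ u v c w t u′ v′ c′ n →
      u ⊗ ((v′ ⊗ c ⊕ v ⊗ c′ ⊕ ⊝ (n ⊗ (v ⊗ c))) ⊗ w ⊕ u′ ⊗ c ⊗ t) ≈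
      ((u ⊗ v′) ⊗ c ⊕ u ⊗ v ⊗ c′ ⊕ ⊝ (n ⊗ (u ⊗ v ⊗ c))) ⊗ w ⊕ u′ ⊗ c ⊗ (u ⊗ t)
    lem₁ = solve-∀-in polyACR
    lem₂ : ∀ u v c w u′ v′ c′ n →
      ((u ⊗ v′) ⊗ c ⊕ u ⊗ v ⊗ c′ ⊕ ⊝ (n ⊗ (u ⊗ v ⊗ c))) ⊗ w ⊕ u′ ⊗ c ⊗ (v ⊗ w) ≈
      (((u′ ⊗ v ⊕ u ⊗ v′) ⊗ c ⊕ u ⊗ v ⊗ c′) ⊕ ⊝ (n ⊗ (u ⊗ v ⊗ c))) ⊗ w
    lem₂ = solve-∀-in polyACR
    lem₃ : ∀ n x w → (n ⊗ x ⊕ ⊝ (n ⊗ (x ⊕ ⊝ con 1ℤ))) ⊗ w ≈ n ⊗ w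
    lem₃ = solve-∀-in polyACR

-- The Frobenius congruence modulo a prime

prime∤! : ∀ {l} → Prime l → ∀ m → m < l → ¬ (l ℕ∣.∣ m !)
prime∤! lp zero    m<l d = ¬prime[1] (subst Prime (ℕ∣.∣1⇒≡1 d) lp)
prime∤! lp (suc m) m<l d with euclidsLemma (suc m) (m !) lp d
... | inj₁ d′ = ℕₚ.<⇒≱ m<l (ℕ∣.∣⇒≤ d′)
... | inj₂ d′ = prime∤! lp m (ℕₚ.<-trans (ℕₚ.n<1+n m) m<l) d′

prime∣choose : ∀ {l} → Prime l → ∀ k → 0 < k → k < l → l ℕ∣.∣ l choose k
prime∣choose {l@(suc l-1)} lp k 0<k k<l with euclidsLemma (l choose k) (k ! ℕ.* (l ℕ.∸ k) !) lp
    (subst (l ℕ∣.∣_) (sym eq) (ℕ∣.m∣m*n (l-1 !)))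
  where
  instance
    nz : NonZero (k ! ℕ.* (l ℕ.∸ k) !)
    nz = ℕₚ._!*_!≢0 k (l ℕ.∸ k)
  eq : (l choose k) ℕ.* (k ! ℕ.* (l ℕ.∸ k) !) ≡ l !
  eq = trans (cong (λ z → z ℕ.* (k ! ℕ.* (l ℕ.∸ k) !)) (nCk≡n!/k![n-k]! (ℕₚ.<⇒≤ k<l)))
    (m/n*n≡m (k![n∸k]!∣n! (ℕₚ.<⇒≤ k<l)))
... | inj₁ d = d
... | inj₂ d with euclidsLemma (k !) ((l ℕ.∸ k) !) lp d
...   | inj₁ d′ = ⊥-elim (prime∤! lp k k<l d′)
...   | inj₂ d′ = ⊥-elim (prime∤! lp (l ℕ.∸ k) (ℕₚ.∸-monoʳ-< 0<k (ℕₚ.<⇒≤ k<l)) d′)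
prime∣choose {zero} lp = ⊥-elim (¬prime[0] lp)

·≈con⊗ : ∀ n f → n · f ≈ con (+ n) ⊗ f
·≈con⊗ zero    f = ≈-sym (≈-trans (R.*-congʳ con-0) (R.zeroˡ f))
·≈con⊗ (suc n) f = ≈-trans (R.+-congˡ (·≈con⊗ n f)) (≈-sym (≈-trans (R.*-congʳ (con-+ 1ℤ (+ n)))
  (≈-trans (R.distribʳ f (con 1ℤ) (con (+ n))) (R.+-congʳ (R.*-identityˡ f)))))

con-mod-0 : ∀ {l n} → l ℕ∣.∣ n → ∀ f → n · f ≈ [] [mod con (+ l) ]
con-mod-0 {l} {n} (ℕ∣.divides k eq) f = ∣⇒mod (con (+ k) ⊗ f , (begin
  con (+ l) ⊗ (con (+ k) ⊗ f)   ≈⟨ ≈-sym (R.*-assoc _ _ _) ⟩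
  con (+ l) ⊗ con (+ k) ⊗ f     ≈⟨ R.*-congʳ (≈-trans (≈-sym (con-* (+ l) (+ k))) (≈-reflexive (cong con (trans (sym (ℤₚ.pos-* l k)) (cong +_ (trans (ℕₚ.*-comm l k) (sym eq))))))) ⟩
  con (+ n) ⊗ f                 ≈⟨ ≈-sym (·≈con⊗ n f) ⟩
  n · f ∎))
  where open ≈-Reasoning

sum-mod-last : ∀ {m} n (t : Fin (suc n) → Poly) → (∀ i → toℕ i < n → t i ≈ [] [mod m ]) →
  sum t ≈ t (Fin.fromℕ n) [mod m ]
sum-mod-last zero    t z = ≈⇒mod (R.+-identityʳ _)
sum-mod-last {m} (suc n) t z = mod-trans (mod-+ (z Fin.zero (s≤s z≤n)) (sum-mod-last n (t ∘ Fin.suc) (λ i p → z (Fin.suc i) (s≤s p))))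
  (≈⇒mod (R.+-identityˡ _))

module _ {l-1 : ℕ} (lp : Prime (suc l-1)) where

  private
    l = suc l-1
    m = l-1

  freshman : ∀ f g → (f ⊕ g) ^ₚ l ≈ f ^ₚ l ⊕ g ^ₚ l [mod con (+ l) ]
  freshman f g = begin
    (f ⊕ g) ^ₚ suc m                                    ≈⟨ ≈⇒mod (Binomial.theorem (suc m) f g) ⟩
    t Fin.zero ⊕ sum (t ∘ Fin.suc)                     ≈⟨ mod-+ (≈⇒mod first) (sum-mod-last m (t ∘ Fin.suc) (λ i p →
                                                            con-mod-0 (prime∣choose lp (suc (toℕ i)) (s≤s z≤n) (s≤s p)) _)) ⟩
    g ^ₚ suc m ⊕ t (Fin.suc (Fin.fromℕ m))              ≈⟨ mod-+ mod-refl (≈⇒mod last) ⟩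
    g ^ₚ suc m ⊕ f ^ₚ suc m                              ≈⟨ ≈⇒mod (R.+-comm _ _) ⟩
    f ^ₚ suc m ⊕ g ^ₚ suc m ∎
    where
    open Mod-Reasoning (con (+ suc m))
    t = Binomial.binomialTerm f g (suc m)
    first : t Fin.zero ≈ g ^ₚ suc m
    first = ≈-trans (·≈con⊗ (suc m choose 0) _) (≈-trans (R.*-congˡ (R.*-identityˡ _))
      (≈-trans (R.*-congʳ (≈-reflexive (cong (con ∘ +_) (n0 (suc m))))) (R.*-identityˡ _)))
      where
      n0 : ∀ n → n choose 0 ≡ 1
      n0 n = trans (nCk≡nC[n∸k] {0} {n} z≤n) (nCn≡1 n)
    last : t (Fin.suc (Fin.fromℕ m)) ≈ f ^ₚ suc m
    last = ≈-trans (·≈con⊗ (suc m choose suc (toℕ (Fin.fromℕ m))) _) (≈-trans (R.*-cong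
        (≈-reflexive (cong (con ∘ +_) c≡1)) pw) (R.*-identityˡ _))
      where
      c≡1 : suc m choose suc (toℕ (Fin.fromℕ m)) ≡ 1
      c≡1 = trans (cong (λ z → suc m choose suc z) (Finₚ.toℕ-fromℕ m)) (nCn≡1 (suc m))
      pw : f ^ₚ suc (toℕ (Fin.fromℕ m)) ⊗ g ^ₚ (m ℕ.∸ toℕ (Fin.fromℕ m)) ≈ f ^ₚ suc m
      pw = ≈-trans (≈-reflexive (cong₂ (λ y z → f ^ₚ suc y ⊗ g ^ₚ z) (Finₚ.toℕ-fromℕ m)
        (trans (cong (m ℕ.∸_) (Finₚ.toℕ-fromℕ m)) (ℕₚ.n∸n≡0 m)))) (R.*-identityʳ _)

  []^l : [] ^ₚ l ≈ []
  []^l = R.zeroˡ _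

  fermat-pos : ∀ a → con (+ a) ^ₚ l ≈ con (+ a) [mod con (+ l) ]
  fermat-pos zero    = ≈⇒mod (≈-trans (^-congˡ l con-0) (≈-trans []^l (≈-sym con-0)))
  fermat-pos (suc a) = begin
    con (+ suc a) ^ₚ l              ≈⟨ ≈⇒mod (^-congˡ l (con-+ 1ℤ (+ a))) ⟩
    (con 1ℤ ⊕ con (+ a)) ^ₚ l       ≈⟨ freshman (con 1ℤ) (con (+ a)) ⟩
    con 1ℤ ^ₚ l ⊕ con (+ a) ^ₚ l     ≈⟨ mod-+ (≈⇒mod (one^ l)) (fermat-pos a) ⟩
    con 1ℤ ⊕ con (+ a)             ≈⟨ ≈⇒mod (≈-sym (con-+ 1ℤ (+ a))) ⟩
    con (+ suc a) ∎
    where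
    open Mod-Reasoning (con (+ l))
    one^ : ∀ k → con 1ℤ ^ₚ k ≈ con 1ℤ
    one^ zero    = ≈-refl
    one^ (suc k) = ≈-trans (R.*-identityˡ _) (one^ k)

  fermat : ∀ a → con a ^ₚ l ≈ con a [mod con (+ l) ]
  fermat (+ a)    = fermat-pos a
  -- The constant is compared with its opposite: `(v ⊕ u) ^ₚ l` vanishes, so the nonnegative case
  -- transfers through `freshman`, with no distinction between even and odd l.
  fermat -[1+ n ] = begin
    u ^ₚ l                             ≈⟨ ≈⇒mod (≈-sym (≈-trans (R.+-congʳ (R.-‿inverseˡ v)) (R.+-identityˡ _))) ⟩
    (⊝ v ⊕ v) ⊕ u ^ₚ l                 ≈⟨ ≈⇒mod (R.+-assoc _ _ _) ⟩
    ⊝ v ⊕ (v ⊕ u ^ₚ l)                 ≈⟨ mod-+ mod-refl (mod-+ (mod-sym (fermat-pos (suc n))) mod-refl) ⟩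
    ⊝ v ⊕ (v ^ₚ l ⊕ u ^ₚ l)             ≈⟨ mod-+ mod-refl (mod-sym (freshman v u)) ⟩
    ⊝ v ⊕ (v ⊕ u) ^ₚ l                 ≈⟨ ≈⇒mod (R.+-congˡ (≈-trans (^-congˡ l v+u) []^l)) ⟩
    ⊝ v ⊕ []                          ≈⟨ ≈⇒mod (≈-trans (R.+-identityʳ _) (≈-sym (con-neg (+ suc n)))) ⟩
    u ∎
    where
    open Mod-Reasoning (con (+ l))
    u = con -[1+ n ]
    v = con (+ suc n)
    v+u : v ⊕ u ≈ []
    v+u = ≈-trans (R.+-congˡ (con-neg (+ suc n))) (R.-‿inverseʳ v)

  frobenius : ∀ f → f ^ₚ l ≈ f ∘ₚ (X ^ₚ l) [mod con (+ l) ]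
  frobenius []      = ≈⇒mod []^l
  frobenius (a ∷ f) = begin
    (a ∷ f) ^ₚ l                         ≈⟨ ≈⇒mod (^-congˡ l (∷≈ a f)) ⟩
    (con a ⊕ X ⊗ f) ^ₚ l                 ≈⟨ freshman (con a) (X ⊗ f) ⟩
    con a ^ₚ l ⊕ (X ⊗ f) ^ₚ l             ≈⟨ mod-+ (fermat a) (mod-trans (≈⇒mod (^-distrib-* X f l)) (mod-* mod-refl (frobenius f))) ⟩
    con a ⊕ X ^ₚ l ⊗ f ∘ₚ (X ^ₚ l) ∎
    where open Mod-Reasoning (con (+ l))

-- Linear functionals on polynomials

pair : (ℕ → ℤ) → Poly → ℤ
pair φ []      = 0ℤ
pair φ (a ∷ f) = φ 0 ℤ.* a ℤ.+ pair (φ ∘ suc) f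

pair-single : ∀ φ f j → (∀ i → i ≢ j → φ i ℤ.* coeff f i ≡ 0ℤ) → pair φ f ≡ φ j ℤ.* coeff f j
pair-single φ []      j       z = sym (ℤₚ.*-zeroʳ (φ j))
pair-single φ (a ∷ f) zero    z = trans (cong (ℤ._+_ (φ 0 ℤ.* a)) (vanish (φ ∘ suc) f (λ i → z (suc i) λ ()))) (ℤₚ.+-identityʳ _)
  where
  vanish : ∀ φ f → (∀ i → φ i ℤ.* coeff f i ≡ 0ℤ) → pair φ f ≡ 0ℤ
  vanish φ []      z = refl
  vanish φ (a ∷ f) z = cong₂ ℤ._+_ (z 0) (vanish (φ ∘ suc) f (z ∘ suc))
pair-single φ (a ∷ f) (suc j) z = trans (cong₂ ℤ._+_ (z 0 λ ()) (pair-single (φ ∘ suc) f j (λ i p → z (suc i) (p ∘ ℕₚ.suc-injective))))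
  (ℤₚ.+-identityˡ _)

pair-zero : ∀ φ f → f ≋ [] → pair φ f ≡ 0ℤ
pair-zero φ []      e = refl
pair-zero φ (a ∷ f) e = trans (cong₂ (λ u v → φ 0 ℤ.* u ℤ.+ v) (e 0) (pair-zero (φ ∘ suc) f (e ∘ suc)))
  (trans (ℤₚ.+-identityʳ _) (ℤₚ.*-zeroʳ (φ 0)))

pair-cong : ∀ φ f g → f ≈ g → pair φ f ≡ pair φ g
pair-cong φ []      g       e = sym (pair-zero φ g (at (≈-sym e)))
pair-cong φ (a ∷ f) []      e = pair-zero φ (a ∷ f) (at e)
pair-cong φ (a ∷ f) (b ∷ g) e = cong₂ (λ u v → φ 0 ℤ.* u ℤ.+ v) (at e 0) (pair-cong (φ ∘ suc) f g ⟪ at e ∘ suc ⟫)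

pair-congˡ : ∀ {φ ψ} f → (∀ i → φ i ≡ ψ i) → pair φ f ≡ pair ψ f
pair-congˡ []      e = refl
pair-congˡ (a ∷ f) e = cong₂ (λ u v → u ℤ.* a ℤ.+ v) (e 0) (pair-congˡ f (e ∘ suc))

pair-⊕ : ∀ φ f g → pair φ (f ⊕ g) ≡ pair φ f ℤ.+ pair φ g
pair-⊕ φ []      g       = trans (pair-cong φ _ g (R.+-identityˡ g)) (sym (ℤₚ.+-identityˡ _))
pair-⊕ φ (a ∷ f) []      = trans (pair-cong φ _ (a ∷ f) (R.+-identityʳ (a ∷ f))) (sym (ℤₚ.+-identityʳ _))
pair-⊕ φ (a ∷ f) (b ∷ g) = trans (pair-cong φ _ _ (≈-sym (∷-⊕ a b f g)))
  (trans (cong (ℤ._+_ (φ 0 ℤ.* (a ℤ.+ b))) (pair-⊕ (φ ∘ suc) f g)) (lem (φ 0) a b (pair (φ ∘ suc) f) (pair (φ ∘ suc) g)))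
  where
  lem : ∀ c a b x y → c ℤ.* (a ℤ.+ b) ℤ.+ (x ℤ.+ y) ≡ (c ℤ.* a ℤ.+ x) ℤ.+ (c ℤ.* b ℤ.+ y)
  lem = solve-∀

pair-con-⊗ : ∀ φ a f → pair φ (con a ⊗ f) ≡ a ℤ.* pair φ f
pair-con-⊗ φ a []      = trans (pair-cong φ _ [] (R.zeroʳ _)) (sym (ℤₚ.*-zeroʳ a))
pair-con-⊗ φ a (b ∷ f) = trans (pair-cong φ _ _ (con-⊗-∷ a b f))
  (trans (cong (ℤ._+_ (φ 0 ℤ.* (a ℤ.* b))) (pair-con-⊗ (φ ∘ suc) a f)) (lem (φ 0) a b (pair (φ ∘ suc) f)))
  where
  lem : ∀ c a b x → c ℤ.* (a ℤ.* b) ℤ.+ a ℤ.* x ≡ a ℤ.* (c ℤ.* b ℤ.+ x)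
  lem = solve-∀

pair-⊝ : ∀ φ f → pair φ (⊝ f) ≡ ℤ.- pair φ f
pair-⊝ φ f = trans (pair-cong φ (⊝ f) (con -1ℤ ⊗ f) ⟪ (λ k → trans (coeff-⊝ f k) (sym (coeff-con-⊗ -1ℤ f k))) ⟫)
  (trans (pair-con-⊗ φ -1ℤ f) (ℤₚ.-1*i≡-i _))

pair-X⊗ : ∀ φ f → pair φ (X ⊗ f) ≡ pair (φ ∘ suc) f
pair-X⊗ φ f = trans (pair-cong φ _ (0ℤ ∷ f) (≈-sym (≈-trans (∷≈ 0ℤ f) (≈-trans (R.+-congʳ con-0) (R.+-identityˡ _)))))
  (trans (cong (ℤ._+ pair (φ ∘ suc) f) (ℤₚ.*-zeroʳ (φ 0))) (ℤₚ.+-identityˡ _))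

pair-X^⊗ : ∀ φ k f → pair φ (X ^ₚ k ⊗ f) ≡ pair (φ ∘ (k ℕ.+_)) f
pair-X^⊗ φ zero    f = pair-cong φ _ f (R.*-identityˡ f)
pair-X^⊗ φ (suc k) f = trans (pair-cong φ _ _ (R.*-assoc X (X ^ₚ k) f))
  (trans (pair-X⊗ φ (X ^ₚ k ⊗ f)) (pair-X^⊗ (φ ∘ suc) k f))

pair-∘ : ∀ φ k f → pair φ (f ∘ₚ (X ^ₚ k)) ≡ pair (φ ∘ (k ℕ.*_)) f
pair-∘ φ k []      = refl
pair-∘ φ k (a ∷ f) = begin
  pair φ (con a ⊕ X ^ₚ k ⊗ f ∘ₚ (X ^ₚ k))                        ≡⟨ pair-⊕ φ (con a) _ ⟩
  φ 0 ℤ.* a ℤ.+ 0ℤ ℤ.+ pair φ (X ^ₚ k ⊗ f ∘ₚ (X ^ₚ k))           ≡⟨ cong₂ ℤ._+_ (ℤₚ.+-identityʳ (φ 0 ℤ.* a)) (trans (pair-X^⊗ φ k (f ∘ₚ (X ^ₚ k))) (pair-∘ (φ ∘ (k ℕ.+_)) k f)) ⟩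
  φ 0 ℤ.* a ℤ.+ pair (λ i → φ (k ℕ.+ k ℕ.* i)) f               ≡⟨ cong₂ (λ u v → φ u ℤ.* a ℤ.+ v) (sym (ℕₚ.*-zeroʳ k)) (pair-congˡ f (λ i → cong φ (sym (ℕₚ.*-suc k i)))) ⟩
  φ (k ℕ.* 0) ℤ.* a ℤ.+ pair (λ i → φ (k ℕ.* suc i)) f ∎
  where open ≡-Reasoning

Periodic : ℕ → (ℕ → ℤ) → Set
Periodic n φ = ∀ i → φ (n ℕ.+ i) ≡ φ i

-- Multiplication by x^n shifts φ by n, so a functional of period n kills every multiple of x^n - 1
-- and descends to the quotient.
pair-mod : ∀ {n φ f g} → Periodic n φ → f ≈ g [mod X^n-1 n ] → pair φ f ≡ pair φ g
pair-mod {n} {φ} {f} {g} per ⟦ h , e ⟧ = begin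
  pair φ f                                           ≡⟨ pair-cong φ f _ e ⟩
  pair φ (g ⊕ X^n-1 n ⊗ h)                           ≡⟨ pair-⊕ φ g _ ⟩
  pair φ g ℤ.+ pair φ (X^n-1 n ⊗ h)                  ≡⟨ cong (ℤ._+_ (pair φ g)) (trans (pair-cong φ _ _ (lem (X ^ₚ n) h)) (pair-⊕ φ (X ^ₚ n ⊗ h) (⊝ h))) ⟩
  pair φ g ℤ.+ (pair φ (X ^ₚ n ⊗ h) ℤ.+ pair φ (⊝ h)) ≡⟨ cong (ℤ._+_ (pair φ g)) (cong₂ ℤ._+_ (trans (pair-X^⊗ φ n h) (pair-congˡ h per)) (pair-⊝ φ h)) ⟩
  pair φ g ℤ.+ (pair φ h ℤ.+ ℤ.- pair φ h)           ≡⟨ trans (cong (ℤ._+_ (pair φ g)) (ℤₚ.+-inverseʳ (pair φ h))) (ℤₚ.+-identityʳ _) ⟩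
  pair φ g ∎
  where
  open ≡-Reasoning
  opaque
    unfolding _⊕_
    lem : ∀ x h → (x ⊕ ⊝ con 1ℤ) ⊗ h ≈ x ⊗ h ⊕ ⊝ h
    lem = solve-∀-in polyACR

-- Residue classes modulo n

module _ (n : ℕ) where

  Congruent : ℕ → ℕ → Set
  Congruent i j = + n ℤ∣.∣ + i ℤ.- + j

  -- Indicator of the class of j modulo n. For j < n, `pair (residue j) f` is the coefficient of x^j
  -- in the reduction of f modulo x^n - 1, read off without reducing f.
  residue : ℕ → ℕ → ℤ
  residue j i with + n ℤ∣.∣? + i ℤ.- + j
  ... | yes _ = 1ℤ
  ... | no  _ = 0ℤ

  residue-yes : ∀ {i j} → Congruent i j → residue j i ≡ 1ℤ
  residue-yes {i} {j} e with + n ℤ∣.∣? + i ℤ.- + j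
  ... | yes _ = refl
  ... | no ne = ⊥-elim (ne e)

  residue-no : ∀ {i j} → ¬ Congruent i j → residue j i ≡ 0ℤ
  residue-no {i} {j} ne with + n ℤ∣.∣? + i ℤ.- + j
  ... | yes e = ⊥-elim (ne e)
  ... | no _  = refl

  residue-cong : ∀ {i j i′ j′} → (Congruent i j → Congruent i′ j′) → (Congruent i′ j′ → Congruent i j) →
    residue j i ≡ residue j′ i′
  residue-cong {i} {j} {i′} {j′} to from with + n ℤ∣.∣? + i′ ℤ.- + j′
  ... | yes e = residue-yes (from e)
  ... | no ne = residue-no (ne ∘ to)

  congruent-refl : ∀ i → Congruent i i
  congruent-refl i = ℤ∣.divides 0ℤ (ℤₚ.+-inverseʳ (+ i))

  congruent-<⇒≡ : ∀ {i j} → i < n → j < n → Congruent i j → i ≡ j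
  congruent-<⇒≡ {i} {j} i<n j<n d with ℤ.∣ + i ℤ.- + j ∣ in eq
  ... | zero  = ℤₚ.+-injective (ℤₚ.i-j≡0⇒i≡j (+ i) (+ j) (ℤₚ.∣i∣≡0⇒i≡0 eq))
  ... | suc k = ⊥-elim (ℕₚ.<⇒≱ bound (ℕ∣.∣⇒≤ (subst (n ℕ∣.∣_) eq (ℤ∣.∣⇒∣ᵤ d))))
    where
    bound : suc k < n
    bound = ℕₚ.≤-<-trans (subst₂ _≤_ (trans (cong ℤ.∣_∣ (sym (ℤₚ.m-n≡m⊖n i j))) eq) refl (ℤₚ.∣m⊝n∣≤m⊔n i j)) (ℕₚ.⊔-lub i<n j<n)

  private
    add : ∀ i j → + (n ℕ.+ i) ℤ.- + j ≡ + n ℤ.+ (+ i ℤ.- + j)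
    add i j = ℤₚ.+-assoc (+ n) (+ i) (ℤ.- + j)

  residue-periodic : ∀ j → Periodic n (residue j)
  residue-periodic j i = residue-cong
    (λ d → ℤ∣.∣m+n∣m⇒∣n (subst (+ n ℤ∣.∣_) (add i j) d) ℤ∣.∣-refl)
    (λ d → subst (+ n ℤ∣.∣_) (sym (add i j)) (ℤ∣.∣m∣n⇒∣m+n ℤ∣.∣-refl d))

-- The substitution of x^k modulo x^n - 1

^-swap : ∀ u m k → (u ^ₚ m) ^ₚ k ≈ (u ^ₚ k) ^ₚ m
^-swap u m k = ≈-trans (^-assocʳ u m k) (≈-trans (≈-reflexive (cong (u ^ₚ_) (ℕₚ.*-comm m k))) (≈-sym (^-assocʳ u k m)))

X^-∘ : ∀ n u → (X ^ₚ n) ∘ₚ u ≈ u ^ₚ n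
X^-∘ n u = ≈-trans (∘-^ X n u) (^-congˡ n (X-∘ u))

⊝-∘ : ∀ f u → (⊝ f) ∘ₚ u ≈ ⊝ (f ∘ₚ u)
⊝-∘ f u = ≈-trans (∘-congˡ _ _ u (⊝≈ f)) (≈-trans (∘-con-⊗ -1ℤ f u) (≈-sym (⊝≈ (f ∘ₚ u))))
  where
  ⊝≈ : ∀ f → ⊝ f ≈ con -1ℤ ⊗ f
  ⊝≈ f = ⟪ (λ k → trans (coeff-⊝ f k) (sym (coeff-con-⊗ -1ℤ f k))) ⟫

X^n-1-∘ : ∀ n u → X^n-1 n ∘ₚ u ≈ u ^ₚ n ⊖ con 1ℤ
X^n-1-∘ n u = ≈-trans (∘-+ (X ^ₚ n) _ u) (R.+-cong (X^-∘ n u) (≈-trans (⊝-∘ (con 1ℤ) u) (R.-‿cong (con-∘ 1ℤ u))))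

X^n-1-∣-∘ : ∀ n k → X^n-1 n ∣⊗ X^n-1 n ∘ₚ (X ^ₚ k)
X^n-1-∣-∘ n k = geom k (X ^ₚ n) , ≈-trans (telescope k (X ^ₚ n))
  (≈-trans (R.+-congʳ (^-swap X n k)) (≈-sym (X^n-1-∘ n (X ^ₚ k))))

-- x^n - 1 divides x^(nk) - 1, so substituting x^k is well defined in the quotient.
mod-∘-X^ : ∀ {n f g} k → f ≈ g [mod X^n-1 n ] → f ∘ₚ (X ^ₚ k) ≈ g ∘ₚ (X ^ₚ k) [mod X^n-1 n ]
mod-∘-X^ {n} {f} {g} k ⟦ h , e ⟧ = mod-weaken (X^n-1-∣-∘ n k) ⟦ h ∘ₚ (X ^ₚ k) ,
  ≈-trans (∘-congˡ f _ _ e) (≈-trans (∘-+ g _ _) (R.+-congˡ (∘-* (X^n-1 n) h _))) ⟧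

∣⊖⇒mod : ∀ {m f g} → m ∣⊗ f ⊖ g → f ≈ g [mod m ]
∣⊖⇒mod {m} {f} {g} (h , e) = ⟦ h , ≈-trans (lem f g) (R.+-congˡ (≈-sym e)) ⟧
  where
  opaque
    unfolding _⊕_
    lem : ∀ f g → f ≈ g ⊕ (f ⊕ ⊝ g)
    lem = solve-∀-in polyACR

mod⇒∣⊖ : ∀ {m f g} → f ≈ g [mod m ] → m ∣⊗ f ⊖ g
mod⇒∣⊖ {m} {f} {g} ⟦ h , e ⟧ = h , ≈-sym (≈-trans (R.+-congʳ e) (lem g (m ⊗ h)))
  where
  opaque
    unfolding _⊕_
    lem : ∀ g h → (g ⊕ h) ⊕ ⊝ g ≈ h
    lem = solve-∀-in polyACR

prime∤⇒coprime : ∀ {l n} → Prime l → ¬ (l ℕ∣.∣ n) → Coprime l n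
prime∤⇒coprime lp l∤n {d} (d∣l , d∣n) with prime⇒irreducible lp d∣l
... | inj₁ d≡1 = d≡1
... | inj₂ refl = ⊥-elim (l∤n d∣n)

coprime-ℤ-bézout : ∀ {m n} → Coprime m n → ∃ λ s → ∃ λ t → s ℤ.* + m ℤ.+ t ℤ.* + n ≡ 1ℤ
coprime-ℤ-bézout {m} {n} c with coprime-Bézout c
... | Bézout.Identity.+- x y eq = + x , ℤ.- + y , (begin
  + x ℤ.* + m ℤ.+ (ℤ.- + y) ℤ.* + n                    ≡⟨ cong (ℤ._+ (ℤ.- + y) ℤ.* + n) (trans (sym (ℤₚ.pos-* x m)) (trans (cong +_ (sym eq)) (cong (ℤ._+_ 1ℤ) (ℤₚ.pos-* y n)))) ⟩
  (1ℤ ℤ.+ + y ℤ.* + n) ℤ.+ (ℤ.- + y) ℤ.* + n           ≡⟨ lem (+ y) (+ n) ⟩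
  1ℤ ∎)
  where
  open ≡-Reasoning
  lem : ∀ y n → (1ℤ ℤ.+ y ℤ.* n) ℤ.+ (ℤ.- y) ℤ.* n ≡ 1ℤ
  lem = solve-∀
... | Bézout.Identity.-+ x y eq = ℤ.- + x , + y , (begin
  (ℤ.- + x) ℤ.* + m ℤ.+ + y ℤ.* + n                    ≡⟨ cong (ℤ._+_ ((ℤ.- + x) ℤ.* + m)) (trans (sym (ℤₚ.pos-* y n)) (trans (cong +_ (sym eq)) (cong (ℤ._+_ 1ℤ) (ℤₚ.pos-* x m)))) ⟩
  (ℤ.- + x) ℤ.* + m ℤ.+ (1ℤ ℤ.+ + x ℤ.* + m)           ≡⟨ lem (+ x) (+ m) ⟩
  1ℤ ∎)
  where
  open ≡-Reasoning
  lem : ∀ y n → (ℤ.- y) ℤ.* n ℤ.+ (1ℤ ℤ.+ y ℤ.* n) ≡ 1ℤ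
  lem = solve-∀

-- Reduced representatives modulo x^n - 1

applyUpTo-snoc : ∀ c m → applyUpTo c (suc m) ≈ applyUpTo c m ⊕ con (c m) ⊗ X ^ₚ m
applyUpTo-snoc c zero    = ≈-sym (≈-trans (R.+-identityˡ _) (R.*-identityʳ _))
applyUpTo-snoc c (suc m) = begin
  c 0 ∷ applyUpTo (c ∘ suc) (suc m)                                        ≈⟨ ∷≈ (c 0) _ ⟩
  con (c 0) ⊕ X ⊗ applyUpTo (c ∘ suc) (suc m)                              ≈⟨ R.+-congˡ (R.*-congˡ (applyUpTo-snoc (c ∘ suc) m)) ⟩
  con (c 0) ⊕ X ⊗ (applyUpTo (c ∘ suc) m ⊕ con (c (suc m)) ⊗ X ^ₚ m)        ≈⟨ lem (con (c 0)) X (applyUpTo (c ∘ suc) m) (con (c (suc m))) (X ^ₚ m) ⟩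
  (con (c 0) ⊕ X ⊗ applyUpTo (c ∘ suc) m) ⊕ con (c (suc m)) ⊗ (X ⊗ X ^ₚ m)  ≈⟨ R.+-congʳ (≈-sym (∷≈ (c 0) _)) ⟩
  (c 0 ∷ applyUpTo (c ∘ suc) m) ⊕ con (c (suc m)) ⊗ (X ⊗ X ^ₚ m) ∎
  where
  open ≈-Reasoning
  opaque
    unfolding _⊕_
    lem : ∀ a x f c y → a ⊕ x ⊗ (f ⊕ c ⊗ y) ≈ (a ⊕ x ⊗ f) ⊕ c ⊗ (x ⊗ y)
    lem = solve-∀-in polyACR

reduce : ∀ m f → ∃ λ c → f ≈ applyUpTo c (suc m) [mod X^n-1 (suc m) ]
reduce m [] = (λ _ → 0ℤ) , ≈⇒mod (≈-sym (zeros (suc m)))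
  where
  zeros : ∀ k → applyUpTo (λ _ → 0ℤ) k ≈ []
  zeros zero    = ≈-refl
  zeros (suc k) = ≈-trans (∷-cong refl (zeros k)) con-0
reduce m (a ∷ f) with reduce m f
... | c , e = c′ , (begin
  a ∷ f                                                       ≈⟨ ≈⇒mod (∷≈ a f) ⟩
  con a ⊕ X ⊗ f                                               ≈⟨ mod-+ mod-refl (mod-* mod-refl (mod-trans e (≈⇒mod (applyUpTo-snoc c m)))) ⟩
  con a ⊕ X ⊗ (applyUpTo c m ⊕ con (c m) ⊗ X ^ₚ m)             ≈⟨ ≈⇒mod (lem₁ (con a) X (applyUpTo c m) (con (c m)) (X ^ₚ m)) ⟩
  (con a ⊕ con (c m) ⊗ X ^ₚ suc m) ⊕ X ⊗ applyUpTo c m         ≈⟨ mod-+ (mod-+ mod-refl (mod-* mod-refl X^n≈1)) mod-refl ⟩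
  (con a ⊕ con (c m) ⊗ con 1ℤ) ⊕ X ⊗ applyUpTo c m            ≈⟨ ≈⇒mod (R.+-congʳ (≈-trans (R.+-congˡ (R.*-identityʳ _)) (≈-sym (con-+ a (c m))))) ⟩
  con (a ℤ.+ c m) ⊕ X ⊗ applyUpTo c m                         ≈⟨ ≈⇒mod (≈-sym (∷≈ _ _)) ⟩
  applyUpTo c′ (suc m) ∎)
  where
  open Mod-Reasoning (X^n-1 (suc m))
  c′ : ℕ → ℤ
  -- Multiplication by x pushes the top coefficient to x^(m+1) ≡ 1, which returns it to the constant
  -- term.
  c′ zero    = a ℤ.+ c m
  c′ (suc i) = c i
  X^n≈1 : X ^ₚ suc m ≈ con 1ℤ [mod X^n-1 (suc m) ]
  X^n≈1 = ∣⊖⇒mod ∣-refl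
  opaque
    unfolding _⊕_
    lem₁ : ∀ a x f c y → a ⊕ x ⊗ (f ⊕ c ⊗ y) ≈ (a ⊕ c ⊗ (x ⊗ y)) ⊕ x ⊗ f
    lem₁ = solve-∀-in polyACR

coeff-applyUpTo : ∀ c k j → j < k → coeff (applyUpTo c k) j ≡ c j
coeff-applyUpTo c (suc k) zero    p       = refl
coeff-applyUpTo c (suc k) (suc j) (s≤s p) = coeff-applyUpTo (c ∘ suc) k j p

coeff-applyUpTo-≥ : ∀ c k j → k ≤ j → coeff (applyUpTo c k) j ≡ 0ℤ
coeff-applyUpTo-≥ c zero    j       p       = refl
coeff-applyUpTo-≥ c (suc k) (suc j) (s≤s p) = coeff-applyUpTo-≥ (c ∘ suc) k j p

∣all-powers⇒0 : ∀ l → 1 < l → ∀ z → (∀ k → l ℕ.^ k ℕ∣.∣ z) → z ≡ 0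
∣all-powers⇒0 l 1<l zero    d = refl
∣all-powers⇒0 l 1<l z@(suc _) d = ⊥-elim (ℕₚ.<⇒≱ (k<l^k z) (ℕ∣.∣⇒≤ (d z)))
  where
  k<l^k : ∀ k → k < l ℕ.^ k
  k<l^k zero    = s≤s z≤n
  k<l^k (suc k) = begin
    1 ℕ.+ suc k                ≤⟨ ℕₚ.+-mono-≤ (ℕₚ.≤-trans (s≤s z≤n) (k<l^k k)) (k<l^k k) ⟩
    l ℕ.^ k ℕ.+ l ℕ.^ k        ≡⟨ cong (l ℕ.^ k ℕ.+_) (sym (ℕₚ.+-identityʳ _)) ⟩
    2 ℕ.* l ℕ.^ k              ≤⟨ ℕₚ.*-monoˡ-≤ (l ℕ.^ k) 1<l ⟩
    l ℕ.* l ℕ.^ k ∎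
    where open ℕₚ.≤-Reasoning

-- Invariance of n-fold idempotents under substitution of x^k, for k prime to n

module Invariance (m : ℕ) (E : Poly)
  (idem : E ⊗ E ≈ con (+ suc m) ⊗ E [mod X^n-1 (suc m) ]) where

  private
    n = suc m
    M = X^n-1 n
    N = con (+ n)

  module _ {l-1 : ℕ} (lp : Prime (suc l-1)) (l∤n : ¬ (suc l-1 ℕ∣.∣ n)) where

    private
      l = suc l-1
      L = con (+ l)
      F = E ∘ₚ (X ^ₚ l)
      δ = E ⊖ F

    -- n is invertible modulo l; the Bézout relation s n + t l = 1 stands in for its inverse.
    unit-cancel : ∀ f c → N ⊗ f ≈ L ⊗ c [mod M ] → ∃ λ w → f ≈ L ⊗ w [mod M ]
    unit-cancel f c e with coprime-ℤ-bézout (Coprimality.sym (prime∤⇒coprime lp l∤n))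
    ... | s , t , eq = con s ⊗ c ⊕ con t ⊗ f , (begin
      f                                              ≈⟨ ≈⇒mod (≈-sym (R.*-identityˡ f)) ⟩
      con 1ℤ ⊗ f                                     ≈⟨ ≈⇒mod (R.*-congʳ (≈-trans (≈-reflexive (cong con (sym eq))) (≈-trans (con-+ _ _) (R.+-cong (con-* s (+ n)) (con-* t (+ l)))))) ⟩
      (con s ⊗ N ⊕ con t ⊗ L) ⊗ f                    ≈⟨ ≈⇒mod (lem₁ (con s) N (con t) L f) ⟩
      con s ⊗ (N ⊗ f) ⊕ L ⊗ (con t ⊗ f)              ≈⟨ mod-+ (mod-* mod-refl e) mod-refl ⟩
      con s ⊗ (L ⊗ c) ⊕ L ⊗ (con t ⊗ f)              ≈⟨ ≈⇒mod (lem₂ (con s) L c (con t ⊗ f)) ⟩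
      L ⊗ (con s ⊗ c ⊕ con t ⊗ f) ∎)
      where
      open Mod-Reasoning M
      opaque
        unfolding _⊕_
        lem₁ : ∀ s n t l f → (s ⊗ n ⊕ t ⊗ l) ⊗ f ≈ s ⊗ (n ⊗ f) ⊕ l ⊗ (t ⊗ f)
        lem₁ = solve-∀-in polyACR
        lem₂ : ∀ s l c g → s ⊗ (l ⊗ c) ⊕ l ⊗ g ≈ l ⊗ (s ⊗ c ⊕ g)
        lem₂ = solve-∀-in polyACR

    -- Powers of n times an idempotent. The extra factor n produces n^l rather than n^(l-1) when the
    -- exponent is l, so that Fermat's congruence applies directly.
    N⊗E^ : ∀ k → N ⊗ E ^ₚ suc k ≈ N ^ₚ suc k ⊗ E [mod M ]
    N⊗E^ zero    = ≈⇒mod (lem N E)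
      where
      opaque
        unfolding _⊕_
        lem : ∀ n e → n ⊗ (e ⊗ con 1ℤ) ≈ n ⊗ con 1ℤ ⊗ e
        lem = solve-∀-in polyACR
    N⊗E^ (suc k) = begin
      N ⊗ (E ⊗ E ^ₚ suc k)        ≈⟨ ≈⇒mod (lem₁ N E (E ^ₚ suc k)) ⟩
      E ⊗ (N ⊗ E ^ₚ suc k)        ≈⟨ mod-* mod-refl (N⊗E^ k) ⟩
      E ⊗ (N ^ₚ suc k ⊗ E)        ≈⟨ ≈⇒mod (lem₁ E (N ^ₚ suc k) E) ⟩
      N ^ₚ suc k ⊗ (E ⊗ E)        ≈⟨ mod-* mod-refl idem ⟩
      N ^ₚ suc k ⊗ (N ⊗ E)        ≈⟨ ≈⇒mod (lem₂ (N ^ₚ suc k) N E) ⟩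
      N ⊗ N ^ₚ suc k ⊗ E ∎
      where
      open Mod-Reasoning M
      opaque
        unfolding _⊕_
        lem₁ : ∀ a b c → a ⊗ (b ⊗ c) ≈ b ⊗ (a ⊗ c)
        lem₁ = solve-∀-in polyACR
        lem₂ : ∀ a b c → a ⊗ (b ⊗ c) ≈ b ⊗ a ⊗ c
        lem₂ = solve-∀-in polyACR

    idemF : F ⊗ F ≈ N ⊗ F [mod M ]
    idemF = mod-trans (≈⇒mod (≈-sym (∘-* E E _))) (mod-trans (mod-∘-X^ {n} l idem)
      (≈⇒mod (∘-con-⊗ (+ n) E _)))

    -- Modulo l, n E(x^l) ≡ n E^l ≡ n^l E ≡ n E by `frobenius`, `N⊗E^` and `fermat`; then n is
    -- cancelled.
    δ-divisible-by-l : ∃ λ w → δ ≈ L ⊗ w [mod M ]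
    δ-divisible-by-l = unit-cancel δ (N ⊗ b ⊖ a ⊗ E) (begin
      N ⊗ (E ⊖ F)                                   ≈⟨ ≈⇒mod (lem₁ N E F L b) ⟩
      N ⊗ E ⊖ N ⊗ (F ⊕ L ⊗ b) ⊕ L ⊗ (N ⊗ b)         ≈⟨ step N⊗E^l ⟩
      N ⊗ E ⊖ (N ⊕ L ⊗ a) ⊗ E ⊕ L ⊗ (N ⊗ b)         ≈⟨ ≈⇒mod (lem₂ N E L a b) ⟩
      L ⊗ (N ⊗ b ⊖ a ⊗ E) ∎)
      where
      open Mod-Reasoning M
      open _≈_[mod_] (frobenius lp E) renaming (quotient to b; equation to E^l)
      open _≈_[mod_] (fermat lp (+ n)) renaming (quotient to a; equation to N^l)
      N⊗E^l : N ⊗ (F ⊕ L ⊗ b) ≈ (N ⊕ L ⊗ a) ⊗ E [mod M ]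
      N⊗E^l = mod-trans (≈⇒mod (R.*-congˡ {N} (≈-sym E^l))) (mod-trans (N⊗E^ l-1) (≈⇒mod (R.*-congʳ {E} N^l)))
      step : ∀ {u v c d} → u ≈ v [mod M ] → c ⊖ u ⊕ d ≈ c ⊖ v ⊕ d [mod M ]
      step e = mod-+ (mod-+ mod-refl (mod-neg e)) mod-refl
      opaque
        unfolding _⊕_
        lem₁ : ∀ n e f l b → n ⊗ (e ⊕ ⊝ f) ≈ n ⊗ e ⊕ ⊝ (n ⊗ (f ⊕ l ⊗ b)) ⊕ l ⊗ (n ⊗ b)
        lem₁ = solve-∀-in polyACR
        lem₂ : ∀ n e l a b → n ⊗ e ⊕ ⊝ ((n ⊕ l ⊗ a) ⊗ e) ⊕ l ⊗ (n ⊗ b) ≈ l ⊗ (n ⊗ b ⊕ ⊝ (a ⊗ e))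
        lem₂ = solve-∀-in polyACR

    -- E / n and F / n are commuting idempotents. Their difference takes only the values 0, 1 and
    -- -1, so it equals its own cube.
    cube : δ ⊗ (δ ⊗ δ) ≈ N ⊗ (N ⊗ δ) [mod M ]
    cube = begin
      (E ⊖ F) ⊗ ((E ⊖ F) ⊗ (E ⊖ F))
        ≈⟨ ≈⇒mod (lem₁ E F) ⟩
      E ⊗ (E ⊗ E) ⊖ F ⊗ (E ⊗ E) ⊖ F ⊗ (E ⊗ E) ⊖ F ⊗ (E ⊗ E) ⊕ (E ⊗ (F ⊗ F) ⊕ E ⊗ (F ⊗ F) ⊕ E ⊗ (F ⊗ F) ⊖ F ⊗ (F ⊗ F))
        ≈⟨ mod-+ (mod-+ (mod-+ (mod-+ (r E) (mod-neg (r F))) (mod-neg (r F))) (mod-neg (r F))) (mod-+ (mod-+ (mod-+ (r′ E) (r′ E)) (r′ E)) (mod-neg (r′ F))) ⟩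
      E ⊗ (N ⊗ E) ⊖ F ⊗ (N ⊗ E) ⊖ F ⊗ (N ⊗ E) ⊖ F ⊗ (N ⊗ E) ⊕ (E ⊗ (N ⊗ F) ⊕ E ⊗ (N ⊗ F) ⊕ E ⊗ (N ⊗ F) ⊖ F ⊗ (N ⊗ F))
        ≈⟨ ≈⇒mod (lem₂ E F N) ⟩
      N ⊗ (E ⊗ E) ⊖ N ⊗ (F ⊗ F)
        ≈⟨ mod-+ (r N) (mod-neg (r′ N)) ⟩
      N ⊗ (N ⊗ E) ⊖ N ⊗ (N ⊗ F)
        ≈⟨ ≈⇒mod (lem₃ E F N) ⟩
      N ⊗ (N ⊗ (E ⊖ F)) ∎
      where
      open Mod-Reasoning M
      r : ∀ f → f ⊗ (E ⊗ E) ≈ f ⊗ (N ⊗ E) [mod M ]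
      r f = mod-* mod-refl idem
      r′ : ∀ f → f ⊗ (F ⊗ F) ≈ f ⊗ (N ⊗ F) [mod M ]
      r′ f = mod-* mod-refl idemF
      opaque
        unfolding _⊕_
        lem₁ : ∀ e f → (e ⊕ ⊝ f) ⊗ ((e ⊕ ⊝ f) ⊗ (e ⊕ ⊝ f)) ≈
          e ⊗ (e ⊗ e) ⊕ ⊝ (f ⊗ (e ⊗ e)) ⊕ ⊝ (f ⊗ (e ⊗ e)) ⊕ ⊝ (f ⊗ (e ⊗ e)) ⊕ (e ⊗ (f ⊗ f) ⊕ e ⊗ (f ⊗ f) ⊕ e ⊗ (f ⊗ f) ⊕ ⊝ (f ⊗ (f ⊗ f)))
        lem₁ = solve-∀-in polyACR
        lem₂ : ∀ e f n →
          e ⊗ (n ⊗ e) ⊕ ⊝ (f ⊗ (n ⊗ e)) ⊕ ⊝ (f ⊗ (n ⊗ e)) ⊕ ⊝ (f ⊗ (n ⊗ e)) ⊕ (e ⊗ (n ⊗ f) ⊕ e ⊗ (n ⊗ f) ⊕ e ⊗ (n ⊗ f) ⊕ ⊝ (f ⊗ (n ⊗ f))) ≈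
          n ⊗ (e ⊗ e) ⊕ ⊝ (n ⊗ (f ⊗ f))
        lem₂ = solve-∀-in polyACR
        lem₃ : ∀ e f n → n ⊗ (n ⊗ e) ⊕ ⊝ (n ⊗ (n ⊗ f)) ≈ n ⊗ (n ⊗ (e ⊕ ⊝ f))
        lem₃ = solve-∀-in polyACR

    -- The factor l can be increased because δ³ = n² δ and l is prime to n.
    δ-divisible-step : ∀ k w → δ ≈ con (+ (l ℕ.^ suc k)) ⊗ w [mod M ] →
      ∃ λ w → δ ≈ con (+ (l ℕ.^ suc (suc k))) ⊗ w [mod M ]
    δ-divisible-step k w e = proj₁ w≡ , (begin
      δ                       ≈⟨ e ⟩
      C ⊗ w                   ≈⟨ mod-* mod-refl (proj₂ w≡) ⟩
      C ⊗ (L ⊗ proj₁ w≡)      ≈⟨ ≈⇒mod (lem₃ C L (proj₁ w≡)) ⟩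
      (L ⊗ C) ⊗ proj₁ w≡      ≈⟨ ≈⇒mod (R.*-congʳ {proj₁ w≡} (≈-sym (L⊗ (suc k)))) ⟩
      con (+ (l ℕ.^ suc (suc k))) ⊗ proj₁ w≡ ∎)
      where
      C C′ w³ : Poly
      C = con (+ (l ℕ.^ suc k))
      C′ = con (+ (l ℕ.^ k))
      w³ = w ⊗ (w ⊗ w)
      L⊗ : ∀ k → con (+ (l ℕ.^ suc k)) ≈ L ⊗ con (+ (l ℕ.^ k))
      L⊗ k = ≈-trans (≈-reflexive (cong con (ℤₚ.pos-* l (l ℕ.^ k)))) (con-* (+ l) (+ (l ℕ.^ k)))
      open Mod-Reasoning M
      opaque
        unfolding _⊕_
        lem₁ : ∀ c n w → c ⊗ (n ⊗ (n ⊗ w) ⊕ ⊝ (c ⊗ (c ⊗ (w ⊗ (w ⊗ w))))) ≈ n ⊗ (n ⊗ (c ⊗ w)) ⊕ ⊝ ((c ⊗ w) ⊗ ((c ⊗ w) ⊗ (c ⊗ w)))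
        lem₁ = solve-∀-in polyACR
        lem₂ : ∀ l c w → (l ⊗ c) ⊗ w ≈ l ⊗ (c ⊗ w)
        lem₂ = solve-∀-in polyACR
        lem₃ : ∀ c l w → c ⊗ (l ⊗ w) ≈ (l ⊗ c) ⊗ w
        lem₃ = solve-∀-in polyACR
      cube′ : C ⊗ (N ⊗ (N ⊗ w) ⊖ C ⊗ (C ⊗ w³)) ≈ [] [mod M ]
      cube′ = begin
        C ⊗ (N ⊗ (N ⊗ w) ⊖ C ⊗ (C ⊗ w³))                        ≈⟨ ≈⇒mod (lem₁ C N w) ⟩
        N ⊗ (N ⊗ (C ⊗ w)) ⊖ (C ⊗ w) ⊗ ((C ⊗ w) ⊗ (C ⊗ w))       ≈⟨ substitute (mod-sym e) ⟩
        N ⊗ (N ⊗ δ) ⊖ δ ⊗ (δ ⊗ δ)                               ≈⟨ mod-+ mod-refl (mod-neg cube) ⟩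
        N ⊗ (N ⊗ δ) ⊖ N ⊗ (N ⊗ δ)                               ≈⟨ ≈⇒mod (R.-‿inverseʳ _) ⟩
        [] ∎
        where
        substitute : ∀ {u v} → u ≈ v [mod M ] → N ⊗ (N ⊗ u) ⊖ u ⊗ (u ⊗ u) ≈ N ⊗ (N ⊗ v) ⊖ v ⊗ (v ⊗ v) [mod M ]
        substitute e = mod-+ (mod-* mod-refl (mod-* mod-refl e)) (mod-neg (mod-* e (mod-* e e)))
      N²w : N ⊗ (N ⊗ w) ≈ L ⊗ (C′ ⊗ (C ⊗ w³)) [mod M ]
      N²w = mod-trans
        -- The power of l cancels inside a multiple of x^n - 1 because the constant term of x^n - 1
        -- is -1.
        (∣⊖⇒mod (∣-con-cancel (+ (l ℕ.^ suc k)) {{ℕₚ.m^n≢0 l (suc k)}} (X^n-1-unitConstant n) (mod⇒∣ cube′)))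
        (≈⇒mod (≈-trans (R.*-congʳ {C ⊗ w³} (L⊗ k)) (lem₂ L C′ (C ⊗ w³))))
      Nw = unit-cancel (N ⊗ w) (C′ ⊗ (C ⊗ w³)) N²w
      w≡ = unit-cancel w (proj₁ Nw) (proj₂ Nw)

    δ-divisible : ∀ k → ∃ λ w → δ ≈ con (+ (l ℕ.^ suc k)) ⊗ w [mod M ]
    δ-divisible zero = proj₁ δ-divisible-by-l ,
      mod-trans (proj₂ δ-divisible-by-l) (≈⇒mod (R.*-congʳ (≈-reflexive (cong (con ∘ +_) (sym (ℕₚ.*-identityʳ l))))))
    δ-divisible (suc k) = δ-divisible-step k (proj₁ (δ-divisible k)) (proj₂ (δ-divisible k))

    -- The residue functionals read off the coefficients of the reduced representative of δ, and by
    -- `δ-divisible` each of these is divisible by all powers of l.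
    δ≈0 : δ ≈ [] [mod M ]
    δ≈0 with reduce m δ
    ... | c , e = mod-trans e (≈⇒mod ⟪ (λ j → zeros j) ⟫)
      where
      ρ = applyUpTo c (suc m)
      zeros : ∀ j → coeff ρ j ≡ 0ℤ
      zeros j with j ℕ.<? suc m
      ... | no j≥ = coeff-applyUpTo-≥ c (suc m) j (ℕₚ.≮⇒≥ j≥)
      ... | yes j< = ℤₚ.∣i∣≡0⇒i≡0 (∣all-powers⇒0 l (ℕ.nonTrivial⇒n>1 l {{prime⇒nonTrivial lp}}) _ λ k →
        ℕ∣.∣-trans (ℕ∣.n∣m*n l) (subst (l ℕ.^ suc k ℕ∣.∣_) (sym (eq k)) (ℕ∣.m∣m*n _)))
        where
        χ = residue (suc m) j
        coeff≡ : pair χ δ ≡ coeff ρ j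
        coeff≡ = trans (pair-mod (residue-periodic (suc m) j) e) (trans (pair-single χ ρ j off)
          (trans (cong (ℤ._* coeff ρ j) (residue-yes (suc m) {j} {j} (congruent-refl (suc m) j))) (ℤₚ.*-identityˡ _)))
          where
          off : ∀ i → i ≢ j → χ i ℤ.* coeff ρ i ≡ 0ℤ
          off i i≢j with i ℕ.<? suc m
          ... | no i≥ = trans (cong (χ i ℤ.*_) (coeff-applyUpTo-≥ c (suc m) i (ℕₚ.≮⇒≥ i≥))) (ℤₚ.*-zeroʳ (χ i))
          ... | yes i< = cong (ℤ._* coeff ρ i) (residue-no (suc m) {i} {j} λ e → i≢j (congruent-<⇒≡ (suc m) i< j< e))
        eq : ∀ k → ℤ.∣ coeff ρ j ∣ ≡ l ℕ.^ suc k ℕ.* ℤ.∣ pair χ (proj₁ (δ-divisible k)) ∣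
        eq k = trans (cong ℤ.∣_∣ (trans (sym coeff≡) (trans (pair-mod (residue-periodic (suc m) j) (proj₂ (δ-divisible k)))
          (pair-con-⊗ χ (+ (l ℕ.^ suc k)) (proj₁ (δ-divisible k))))))
          (ℤₚ.abs-* (+ (l ℕ.^ suc k)) (pair χ (proj₁ (δ-divisible k))))

    prime-invariant : E ≈ F [mod M ]
    prime-invariant = ∣⊖⇒mod (mod⇒∣ δ≈0)

  product-invariant : ∀ ls → All Prime ls → All (λ l → ¬ (l ℕ∣.∣ n)) ls → E ≈ E ∘ₚ (X ^ₚ product ls) [mod M ]
  product-invariant []       _ _ = ≈⇒mod (≈-sym (≈-trans (∘-congʳ E (R.*-identityʳ X)) (∘-X E)))
  product-invariant (zero ∷ ls) (lp ∷ ps) _ = ⊥-elim (¬prime[0] lp)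
  product-invariant (l@(suc _) ∷ ls) (lp ∷ ps) (l∤n ∷ ds) = begin
    E                                       ≈⟨ product-invariant ls ps ds ⟩
    E ∘ₚ (X ^ₚ product ls)                   ≈⟨ mod-∘-X^ {n} (product ls) (prime-invariant lp l∤n) ⟩
    (E ∘ₚ (X ^ₚ l)) ∘ₚ (X ^ₚ product ls)      ≈⟨ ≈⇒mod (∘-assoc E _ _) ⟩
    E ∘ₚ ((X ^ₚ l) ∘ₚ (X ^ₚ product ls))      ≈⟨ ≈⇒mod (∘-congʳ E (≈-trans (X^-∘ l _) (≈-trans (^-assocʳ X (product ls) l) (≈-reflexive (cong (X ^ₚ_) (ℕₚ.*-comm (product ls) l)))))) ⟩
    E ∘ₚ (X ^ₚ (l ℕ.* product ls)) ∎
    where open Mod-Reasoning M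

  -- No prime factor of k divides n, and the substitutions of x^l for these primes l compose to that
  -- of x^k.
  invariant : ∀ k .{{_ : NonZero k}} → Coprime k n → E ≈ E ∘ₚ (X ^ₚ k) [mod M ]
  invariant k c = subst (λ z → E ≈ E ∘ₚ (X ^ₚ z) [mod M ]) (sym isFactorisation)
    (product-invariant factors factorsPrime (All.tabulate λ {l} l∈ l∣n →
      ¬prime[1] (subst Prime (c (subst (l ℕ∣.∣_) (sym isFactorisation) (∈⇒∣product l∈) , l∣n)) (All.lookup factorsPrime l∈))))
    where
    open PrimeFactorisation (factorise k)
 

invariant : ∀ n .{{_ : NonZero n}} E → E ⊗ E ≈ con (+ n) ⊗ E [mod X^n-1 n ] →
  ∀ k .{{_ : NonZero k}} → Coprime k n → E ≈ E ∘ₚ (X ^ₚ k) [mod X^n-1 n ]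
invariant (suc m) E idem k c = Invariance.invariant m E idem k c

-- Sums of substitutions

∑ : ℕ → (ℕ → Poly) → Poly
∑ zero    f = []
∑ (suc n) f = f 0 ⊕ ∑ n (f ∘ suc)

∑-mod : ∀ {m} n {f g} → (∀ i → i < n → f i ≈ g i [mod m ]) → ∑ n f ≈ ∑ n g [mod m ]
∑-mod zero    e = mod-refl
∑-mod (suc n) e = mod-+ (e 0 (s≤s z≤n)) (∑-mod n (λ i p → e (suc i) (s≤s p)))

∑-cong : ∀ n {f g} → (∀ i → f i ≈ g i) → ∑ n f ≈ ∑ n g
∑-cong zero    e = ≈-refl
∑-cong (suc n) e = R.+-cong (e 0) (∑-cong n (e ∘ suc))

∑-const : ∀ n f → ∑ n (λ _ → f) ≈ con (+ n) ⊗ f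
∑-const zero    f = ≈-sym (≈-trans (R.*-congʳ con-0) (R.zeroˡ f))
∑-const (suc n) f = ≈-trans (R.+-congˡ (∑-const n f)) (≈-sym (≈-trans (R.*-congʳ (con-+ 1ℤ (+ n)))
  (≈-trans (R.distribʳ f (con 1ℤ) (con (+ n))) (R.+-congʳ (R.*-identityˡ f)))))

∑-⊗ˡ : ∀ n f g → g ⊗ ∑ n f ≈ ∑ n (λ i → g ⊗ f i)
∑-⊗ˡ zero    f g = R.zeroʳ g
∑-⊗ˡ (suc n) f g = ≈-trans (R.distribˡ g (f 0) _) (R.+-congˡ (∑-⊗ˡ n (f ∘ suc) g))

∑-⊗ʳ : ∀ n f g → ∑ n f ⊗ g ≈ ∑ n (λ i → f i ⊗ g)
∑-⊗ʳ zero    f g = R.zeroˡ g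
∑-⊗ʳ (suc n) f g = ≈-trans (R.distribʳ g (f 0) _) (R.+-congˡ (∑-⊗ʳ n (f ∘ suc) g))

∑-powers : ∀ k u → ∑ k (λ a → u ^ₚ suc a) ≈ u ⊗ geom k u
∑-powers k u = ≈-trans (≈-sym (∑-⊗ˡ k (u ^ₚ_) u)) (R.*-congˡ (pow k))
  where
  pow : ∀ k → ∑ k (u ^ₚ_) ≈ geom k u
  pow zero    = ≈-refl
  pow (suc k) = R.+-congˡ (≈-trans (≈-sym (∑-⊗ˡ k (u ^ₚ_) u)) (R.*-congˡ (pow k)))

-- The polynomial-valued counterpart of `pair`. Substituting u amounts to pairing with the powers of
-- u, so a sum of substitutions into one polynomial becomes a single pairing with sums of powers.
pairₚ : (ℕ → Poly) → Poly → Poly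
pairₚ ψ []      = []
pairₚ ψ (a ∷ f) = ψ 0 ⊗ con a ⊕ pairₚ (ψ ∘ suc) f

pairₚ-mod : ∀ {m ψ ψ′} f → (∀ i → ψ i ≈ ψ′ i [mod m ]) → pairₚ ψ f ≈ pairₚ ψ′ f [mod m ]
pairₚ-mod []      e = mod-refl
pairₚ-mod (a ∷ f) e = mod-+ (mod-* (e 0) mod-refl) (pairₚ-mod f (e ∘ suc))

pairₚ-⊗ : ∀ u ψ f → pairₚ (λ i → u ⊗ ψ i) f ≈ u ⊗ pairₚ ψ f
pairₚ-⊗ u ψ []      = ≈-sym (R.zeroʳ u)
pairₚ-⊗ u ψ (a ∷ f) = ≈-trans (R.+-cong (R.*-assoc u _ _) (pairₚ-⊗ u (ψ ∘ suc) f)) (≈-sym (R.distribˡ u _ _))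

pairₚ-⊕ : ∀ ψ ψ′ f → pairₚ (λ i → ψ i ⊕ ψ′ i) f ≈ pairₚ ψ f ⊕ pairₚ ψ′ f
pairₚ-⊕ ψ ψ′ []      = ≈-sym (R.+-identityˡ [])
pairₚ-⊕ ψ ψ′ (a ∷ f) = ≈-trans (R.+-cong (R.distribʳ (con a) (ψ 0) (ψ′ 0)) (pairₚ-⊕ (ψ ∘ suc) (ψ′ ∘ suc) f))
  (lem (ψ 0 ⊗ con a) (ψ′ 0 ⊗ con a) (pairₚ (ψ ∘ suc) f) (pairₚ (ψ′ ∘ suc) f))
  where
  opaque
    unfolding _⊕_
    lem : ∀ a b c d → (a ⊕ b) ⊕ (c ⊕ d) ≈ (a ⊕ c) ⊕ (b ⊕ d)
    lem = solve-∀-in polyACR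

pairₚ-∑ : ∀ n (ψ : ℕ → ℕ → Poly) f → pairₚ (λ i → ∑ n (λ a → ψ a i)) f ≈ ∑ n (λ a → pairₚ (ψ a) f)
pairₚ-∑ zero    ψ f = zeros f
  where
  zeros : ∀ f → pairₚ (λ i → []) f ≈ []
  zeros []      = ≈-refl
  zeros (a ∷ f) = ≈-trans (R.+-cong (R.zeroˡ (con a)) (zeros f)) (R.+-identityˡ [])
pairₚ-∑ (suc n) ψ f = ≈-trans (pairₚ-⊕ (ψ 0) (λ i → ∑ n (λ a → ψ (suc a) i)) f) (R.+-congˡ (pairₚ-∑ n (ψ ∘ suc) f))

∘-as-pairₚ : ∀ f u → f ∘ₚ u ≈ pairₚ (u ^ₚ_) f
∘-as-pairₚ []      u = ≈-refl
∘-as-pairₚ (a ∷ f) u = R.+-cong (≈-sym (R.*-identityˡ (con a)))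
  (≈-trans (R.*-congˡ (∘-as-pairₚ f u)) (≈-sym (pairₚ-⊗ u (u ^ₚ_) f)))

pairₚ-con : ∀ ρ f → pairₚ (λ i → con (ρ i)) f ≈ con (pair ρ f)
pairₚ-con ρ []      = ≈-sym con-0
pairₚ-con ρ (a ∷ f) = ≈-sym (≈-trans (con-+ _ _) (R.+-cong (con-* (ρ 0) a) (≈-sym (pairₚ-con (ρ ∘ suc) f))))

coeff-⊗-1 : ∀ f g → coeff (f ⊗ g) 1 ≡ coeff f 0 ℤ.* coeff g 1 ℤ.+ coeff f 1 ℤ.* coeff g 0
coeff-⊗-1 []      g = at (R.zeroˡ g) 1
coeff-⊗-1 (a ∷ f) g = trans (coeff-⊗-suc a f g 0) (cong (ℤ._+_ (a ℤ.* coeff g 1)) (coeff-⊗-zero f g))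

opaque
  unfolding _⊕_
  leading-⊗ : ∀ f h d e → (∀ i → d < i → coeff f i ≡ 0ℤ) → (∀ i → e < i → coeff h i ≡ 0ℤ) →
    coeff (f ⊗ h) (d ℕ.+ e) ≡ coeff f d ℤ.* coeff h e
  leading-⊗ = leading

nonconstant-∣con : ∀ {Y} c → coeff Y 1 ≢ 0ℤ → Y ∣⊗ con c → c ≡ 0ℤ
nonconstant-∣con {Y} c y≢0 (h , e) with degree Y | degree h
... | inj₁ z | _ = ⊥-elim (y≢0 (z 1))
... | inj₂ (zero , _ , z) | _ = ⊥-elim (y≢0 (z 1 (s≤s z≤n)))
... | inj₂ _ | inj₁ z = trans (sym (at e 0)) (trans (at (≈-trans (R.*-congˡ ⟪ z ⟫) (R.zeroʳ Y)) 0) refl)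
... | inj₂ (suc d , nz , z) | inj₂ (d′ , nz′ , z′) with
        ℤₚ.i*j≡0⇒i≡0∨j≡0 (coeff Y (suc d)) (trans (sym (leading-⊗ Y h (suc d) d′ z z′)) (at e (suc d ℕ.+ d′)))
...   | inj₁ y = ⊥-elim (nz y)
...   | inj₂ y = ⊥-elim (nz′ y)

-- Power sums of roots of unity modulo Y

u≈1⇒geom : ∀ {Y u} r → Y ∣⊗ u ⊖ con 1ℤ → geom r u ≈ con (+ r) [mod Y ]
u≈1⇒geom r d = mod-trans (mod-geom r (∣⊖⇒mod d)) (≈⇒mod (geom-one r))

one^ : ∀ k → con 1ℤ ^ₚ k ≈ con 1ℤ
one^ zero    = ≈-refl
one^ (suc k) = ≈-trans (R.*-identityˡ _) (one^ k)

u-1∣u^k-1 : ∀ {Y u} k → Y ∣⊗ u ⊖ con 1ℤ → Y ∣⊗ u ^ₚ k ⊖ con 1ℤ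
u-1∣u^k-1 k d = mod⇒∣⊖ (mod-trans (mod-^ k (∣⊖⇒mod d)) (≈⇒mod (one^ k)))

geom∣u^k-1 : ∀ {Y} r u → Y ∣⊗ geom r u → Y ∣⊗ u ^ₚ r ⊖ con 1ℤ
geom∣u^k-1 r u d = ∣-respʳ (telescope r u) (∣-*ˡ (u ⊖ con 1ℤ) d)

-- Modulo Y, u acts either as 1, where the sum is r, or as a primitive r-th root of unity, where the
-- sum is r or 0 according as r divides i or not.
geom-rational : ∀ {r} → Prime r → ∀ {Y} u → Y ∣⊗ u ⊖ con 1ℤ ⊎ Y ∣⊗ geom r u →
  ∀ i → ∃ λ t → geom r (u ^ₚ i) ≈ con t [mod Y ]
geom-rational {r} rp u (inj₁ d) i = + r , u≈1⇒geom r (u-1∣u^k-1 i d)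
geom-rational {r} rp {Y} u (inj₂ d) i with r ℕ∣.∣? i
... | no r∤i = 0ℤ , mod-trans (∣⇒mod (∣-trans d (geom-∣ r i u (prime∤⇒coprime rp r∤i)))) (≈⇒mod (≈-sym con-0))
... | yes (ℕ∣.divides k refl) = + r , u≈1⇒geom r (∣-respʳ (R.+-congʳ (≈-trans (^-assocʳ u r k)
  (≈-reflexive (cong (u ^ₚ_) (ℕₚ.*-comm r k))))) (u-1∣u^k-1 k (geom∣u^k-1 r u d)))

coprime-* : ∀ {k a b} → Coprime k a → Coprime k b → Coprime k (a ℕ.* b)
coprime-* ca cb {d} (d∣k , d∣ab) = cb (d∣k , coprime-divisor (λ (x , y) → ca (ℕ∣.∣-trans x d∣k , y)) d∣ab)

coprime-^ : ∀ {k a} b → Coprime k a → Coprime k (a ℕ.^ b)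
coprime-^ zero    c = λ (_ , d∣1) → ℕ∣.∣1⇒≡1 d∣1
coprime-^ (suc b) c = coprime-* c (coprime-^ b c)

-- Each of x - 1, Φ_p, Φ_q, Φ_pq divides one of two complementary divisors

module Split {p q : ℕ} (pp : Prime p) (qp : Prime q) (p<q : p < q) (b : ℕ) where

  n = p ℕ.* q ℕ.^ b

  instance
    p≢0 : NonZero p
    p≢0 = prime⇒nonZero pp
    q≢0 : NonZero q
    q≢0 = prime⇒nonZero qp
    n≢0 : NonZero n
    n≢0 = pq^b-nonZero pp qp b

  q∤p : ¬ (q ℕ∣.∣ p)
  q∤p d = ℕₚ.<⇒≱ p<q (ℕ∣.∣⇒≤ d)

  p∤q : ¬ (p ℕ∣.∣ q)
  p∤q d = ¬prime[1] (subst Prime (prime∤⇒coprime qp q∤p (d , ℕ∣.∣-refl)) pp)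

  -- Each of p and q divides exactly one of the two summands. By the Chinese remainder theorem these
  -- (p - 1)(q - 1) exponents represent all units modulo pq, and their shape makes sums of powers
  -- over them factor.
  unit-coprime : ∀ s t → suc s < q → suc t < p → Coprime (p ℕ.* suc s ℕ.+ q ℕ.* suc t) n
  unit-coprime s t s<q t<p = coprime-* (Coprimality.sym (prime∤⇒coprime pp p∤k)) (coprime-^ b (Coprimality.sym (prime∤⇒coprime qp q∤k)))
    where
    p∤k : ¬ (p ℕ∣.∣ p ℕ.* suc s ℕ.+ q ℕ.* suc t)
    p∤k d with euclidsLemma q (suc t) pp (ℕ∣.∣m+n∣m⇒∣n d (ℕ∣.m∣m*n (suc s)))
    ... | inj₁ x = p∤q x
    ... | inj₂ x = ℕₚ.<⇒≱ t<p (ℕ∣.∣⇒≤ x)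
    q∤k : ¬ (q ℕ∣.∣ p ℕ.* suc s ℕ.+ q ℕ.* suc t)
    q∤k d with euclidsLemma p (suc s) qp (ℕ∣.∣m+n∣m⇒∣n (subst (q ℕ∣.∣_) (ℕₚ.+-comm _ (q ℕ.* suc t)) d) (ℕ∣.m∣m*n (suc t)))
    ... | inj₁ x = q∤p x
    ... | inj₂ x = ℕₚ.<⇒≱ s<q (ℕ∣.∣⇒≤ x)

  -- Modulo Y, x^p is 1 or a primitive q-th root of unity, and x^q is 1 or a primitive p-th root of
  -- unity. The four combinations belong to x - 1, Φ_p, Φ_q and Φ_pq. Nonconstancy is expressed by
  -- the coefficient of x, which is easily computed for all four.
  record Rational (Y : Poly) : Set where
    field
      divides : Y ∣⊗ X^n-1 n
      nonconstant : coeff Y 1 ≢ 0ℤ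
      at-p : Y ∣⊗ X ^ₚ p ⊖ con 1ℤ ⊎ Y ∣⊗ geom q (X ^ₚ p)
      at-q : Y ∣⊗ X ^ₚ q ⊖ con 1ℤ ⊎ Y ∣⊗ geom p (X ^ₚ q)

  p-1 = ℕ.pred p
  q-1 = ℕ.pred q

  -- Averaging the invariant element E over the exponents p s + q t, which are units.
  average : ∀ {Y} → Rational Y → ∀ E → E ⊗ E ≈ con (+ n) ⊗ E [mod X^n-1 n ] →
    ∃ λ c → con (+ (q-1 ℕ.* p-1)) ⊗ E ≈ con c [mod Y ]
  average {Y} Yr E idem = pair ρ E , (begin
    con (+ (q-1 ℕ.* p-1)) ⊗ E
      ≈⟨ ≈⇒mod (≈-trans (R.*-congʳ (≈-trans (≈-reflexive (cong con (ℤₚ.pos-* q-1 p-1))) (con-* _ _))) (R.*-assoc _ _ _)) ⟩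
    con (+ q-1) ⊗ (con (+ p-1) ⊗ E)
      ≈⟨ ≈⇒mod (≈-sym (≈-trans (∑-cong q-1 (λ s → ∑-const p-1 E)) (∑-const q-1 _))) ⟩
    ∑ q-1 (λ s → ∑ p-1 (λ t → E))
      ≈⟨ ∑-mod q-1 (λ s s< → ∑-mod p-1 (λ t t< → mod-weaken divides (invariant n E idem (k s t) {{k≢0 s t}} (unit-coprime s t (bound q s s<) (bound p t t<))))) ⟩
    ∑ q-1 (λ s → ∑ p-1 (λ t → E ∘ₚ (X ^ₚ k s t)))
      ≈⟨ ≈⇒mod (∑-cong q-1 (λ s → ∑-cong p-1 (λ t → ∘-as-pairₚ E (X ^ₚ k s t)))) ⟩
    ∑ q-1 (λ s → ∑ p-1 (λ t → pairₚ ((X ^ₚ k s t) ^ₚ_) E))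
      ≈⟨ ≈⇒mod (≈-sym (≈-trans (pairₚ-∑ q-1 _ E) (∑-cong q-1 (λ s → pairₚ-∑ p-1 _ E)))) ⟩
    pairₚ (λ i → ∑ q-1 (λ s → ∑ p-1 (λ t → (X ^ₚ k s t) ^ₚ i))) E
      ≈⟨ pairₚ-mod E value ⟩
    pairₚ (λ i → con (ρ i)) E
      ≈⟨ ≈⇒mod (pairₚ-con ρ E) ⟩
    con (pair ρ E) ∎)
    where
    open Rational Yr
    open Mod-Reasoning Y
    k : ℕ → ℕ → ℕ
    k s t = p ℕ.* suc s ℕ.+ q ℕ.* suc t
    k≢0 : ∀ s t → NonZero (k s t)
    k≢0 s t = ℕ.>-nonZero (ℕₚ.<-≤-trans (ℕ.>-nonZero⁻¹ (p ℕ.* suc s) {{ℕₚ.m*n≢0 p (suc s)}}) (ℕₚ.m≤m+n _ _))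
    bound : ∀ r .{{_ : NonZero r}} s → s < ℕ.pred r → suc s < r
    bound (suc r) s s< = s≤s s<
    u v : ℕ → Poly
    u i = (X ^ₚ p) ^ₚ i
    v i = (X ^ₚ q) ^ₚ i
    x y ρ : ℕ → ℤ
    -- The sums over the multipliers of p and q start at 1, so each is a full geometric sum less its
    -- first term 1.
    x i = proj₁ (geom-rational qp (X ^ₚ p) at-p i) ℤ.+ -1ℤ
    y i = proj₁ (geom-rational pp (X ^ₚ q) at-q i) ℤ.+ -1ℤ
    ρ i = x i ℤ.* y i
    split : ∀ i s t → (X ^ₚ k s t) ^ₚ i ≈ u i ^ₚ suc s ⊗ v i ^ₚ suc t
    split i s t = ≈-trans (^-congˡ i (^-homo-* X (p ℕ.* suc s) (q ℕ.* suc t))) (≈-trans (^-distrib-* _ _ i)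
      (R.*-cong (≈-trans (^-congˡ i (≈-sym (^-assocʳ X p (suc s)))) (^-swap (X ^ₚ p) (suc s) i))
                (≈-trans (^-congˡ i (≈-sym (^-assocʳ X q (suc t)))) (^-swap (X ^ₚ q) (suc t) i))))
    less-one : ∀ r .{{_ : NonZero r}} w → ∀ {c} → geom r w ≈ con c [mod Y ] → w ⊗ geom (ℕ.pred r) w ≈ con (c ℤ.+ -1ℤ) [mod Y ]
    less-one (suc r) w {c} e = mod-trans (≈⇒mod (lem (w ⊗ geom r w))) (mod-trans (mod-+ e (≈⇒mod (≈-sym (con-neg 1ℤ)))) (≈⇒mod (≈-sym (con-+ c -1ℤ))))
      where
      opaque
        unfolding _⊕_
        lem : ∀ a → a ≈ (con 1ℤ ⊕ a) ⊕ ⊝ con 1ℤ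
        lem = solve-∀-in polyACR
    value : ∀ i → ∑ q-1 (λ s → ∑ p-1 (λ t → (X ^ₚ k s t) ^ₚ i)) ≈ con (ρ i) [mod Y ]
    value i = begin
      ∑ q-1 (λ s → ∑ p-1 (λ t → (X ^ₚ k s t) ^ₚ i))                 ≈⟨ ≈⇒mod (∑-cong q-1 (λ s → ∑-cong p-1 (split i s))) ⟩
      ∑ q-1 (λ s → ∑ p-1 (λ t → u i ^ₚ suc s ⊗ v i ^ₚ suc t))       ≈⟨ ≈⇒mod (≈-sym (≈-trans (∑-⊗ʳ q-1 _ _) (∑-cong q-1 (λ s → ∑-⊗ˡ p-1 _ _)))) ⟩
      ∑ q-1 (λ s → u i ^ₚ suc s) ⊗ ∑ p-1 (λ t → v i ^ₚ suc t)       ≈⟨ ≈⇒mod (R.*-cong (∑-powers q-1 (u i)) (∑-powers p-1 (v i))) ⟩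
      (u i ⊗ geom q-1 (u i)) ⊗ (v i ⊗ geom p-1 (v i))             ≈⟨ mod-* (less-one q (u i) {proj₁ (geom-rational qp (X ^ₚ p) at-p i)} (proj₂ (geom-rational qp (X ^ₚ p) at-p i))) (less-one p (v i) {proj₁ (geom-rational pp (X ^ₚ q) at-q i)} (proj₂ (geom-rational pp (X ^ₚ q) at-q i))) ⟩
      con (x i) ⊗ con (y i)                                       ≈⟨ ≈⇒mod (≈-sym (con-* (x i) (y i))) ⟩
      con (ρ i) ∎

  X^n≈1 : X ^ₚ n ≈ con 1ℤ [mod X^n-1 n ]
  X^n≈1 = ∣⊖⇒mod ∣-refl

  -- `E` and `E′` add up to θ (x^n - 1), which is n modulo x^n - 1, while g divides `E` and f
  -- divides `E′`. Hence at an n-th root of unity `E` is n if f vanishes there and 0 if g does.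
  module Factors {f g : Poly} (fg : f ⊗ g ≈ X^n-1 n) where

    N = con (+ n)
    E = θ f ⊗ g
    E′ = f ⊗ θ g

    E+E′ : E ⊕ E′ ≈ N [mod X^n-1 n ]
    E+E′ = mod-trans (≈⇒mod (≈-trans (≈-sym (θ-* f g)) (≈-trans (θ-cong fg) (θ-X^n-1 n))))
      (mod-trans (mod-* mod-refl X^n≈1) (≈⇒mod (R.*-identityʳ N)))

    fE : f ⊗ E ≈ [] [mod X^n-1 n ]
    fE = ∣⇒mod (θ f , ≈-trans (R.*-congʳ (≈-sym fg)) (lem f g (θ f)))
      where
      opaque
        unfolding _⊕_
        lem : ∀ f g h → (f ⊗ g) ⊗ h ≈ f ⊗ (h ⊗ g)
        lem = solve-∀-in polyACR

    gE′ : g ⊗ E′ ≈ [] [mod X^n-1 n ]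
    gE′ = ∣⇒mod (θ g , ≈-trans (R.*-congʳ (≈-sym fg)) (lem f g (θ g)))
      where
      opaque
        unfolding _⊕_
        lem : ∀ f g h → (f ⊗ g) ⊗ h ≈ g ⊗ (f ⊗ h)
        lem = solve-∀-in polyACR

    gE : g ⊗ E ≈ N ⊗ g [mod X^n-1 n ]
    gE = begin
      g ⊗ E                     ≈⟨ ≈⇒mod (≈-sym (R.+-identityʳ _)) ⟩
      g ⊗ E ⊕ []                ≈⟨ mod-+ mod-refl (mod-sym gE′) ⟩
      g ⊗ E ⊕ g ⊗ E′            ≈⟨ ≈⇒mod (≈-sym (R.distribˡ g E E′)) ⟩
      g ⊗ (E ⊕ E′)              ≈⟨ mod-* mod-refl E+E′ ⟩
      g ⊗ N                     ≈⟨ ≈⇒mod (R.*-comm g N) ⟩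
      N ⊗ g ∎
      where open Mod-Reasoning (X^n-1 n)

    idem : E ⊗ E ≈ N ⊗ E [mod X^n-1 n ]
    idem = begin
      θ f ⊗ g ⊗ E               ≈⟨ ≈⇒mod (R.*-assoc (θ f) g E) ⟩
      θ f ⊗ (g ⊗ E)             ≈⟨ mod-* mod-refl gE ⟩
      θ f ⊗ (N ⊗ g)             ≈⟨ ≈⇒mod (lem (θ f) N g) ⟩
      N ⊗ (θ f ⊗ g) ∎
      where
      open Mod-Reasoning (X^n-1 n)
      opaque
        unfolding _⊕_
        lem : ∀ a b c → a ⊗ (b ⊗ c) ≈ b ⊗ (a ⊗ c)
        lem = solve-∀-in polyACR

    K = (q-1 ℕ.* p-1)

    K≢0 : NonZero K
    K≢0 = ℕₚ.m*n≢0 q-1 p-1 {{h q (ℕ.nonTrivial⇒n>1 q {{prime⇒nonTrivial qp}})}} {{h p (ℕ.nonTrivial⇒n>1 p {{prime⇒nonTrivial pp}})}}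
      where
      h : ∀ r → 1 < r → NonZero (ℕ.pred r)
      h (suc (suc r)) _ = _
      h (suc zero) (s≤s ())

    -- `average` supplies an integer c with K E ≡ c modulo Y. As E (E - n) ≡ 0, Y divides the
    -- integer c (c - K n), which must be 0 because Y is not constant. If c = 0, then K n g ≡ g K E
    -- ≡ 0; if c = K n, then K n f ≡ f K E ≡ 0. The integers K and n then cancel.
    prime-property : ∀ {Y} → Rational Y → Y ∣⊗ f ⊎ Y ∣⊗ g
    prime-property {Y} Yr = [ inj₂ ∘ Y∣g , inj₁ ∘ Y∣f ]′
      (ℤₚ.i*j≡0⇒i≡0∨j≡0 c {c ℤ.+ ℤ.- (+ K ℤ.* + n)} (nonconstant-∣con _ nonconstant (mod⇒∣ vanish)))
      where
      open Rational Yr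
      open Mod-Reasoning Y
      c = proj₁ (average Yr E idem)
      k : Poly
      k = con (+ K)
      kE : k ⊗ E ≈ con c [mod Y ]
      kE = proj₂ (average Yr E idem)
      u : UnitConstant Y
      u = unitConstant-∣ divides (X^n-1-unitConstant n)
      opaque
        unfolding _⊕_
        lem₁ : ∀ k e n → (k ⊗ e) ⊗ (k ⊗ e ⊕ ⊝ (k ⊗ n)) ≈ k ⊗ (k ⊗ (e ⊗ e ⊕ ⊝ (n ⊗ e)))
        lem₁ = solve-∀-in polyACR
        lem₂ : ∀ a b c → a ⊗ (b ⊗ c) ≈ b ⊗ (a ⊗ c)
        lem₂ = solve-∀-in polyACR
      vanish : con (c ℤ.* (c ℤ.+ ℤ.- (+ K ℤ.* + n))) ≈ [] [mod Y ]
      vanish = begin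
        con (c ℤ.* (c ℤ.+ ℤ.- (+ K ℤ.* + n)))  ≈⟨ ≈⇒mod (≈-trans (con-* c _) (R.*-congˡ (≈-trans (con-+ c _) (R.+-congˡ (≈-trans (con-neg _) (R.-‿cong (con-* (+ K) (+ n)))))))) ⟩
        con c ⊗ (con c ⊖ k ⊗ N)                ≈⟨ mod-* (mod-sym kE) (mod-+ (mod-sym kE) mod-refl) ⟩
        (k ⊗ E) ⊗ (k ⊗ E ⊖ k ⊗ N)              ≈⟨ ≈⇒mod (lem₁ k E N) ⟩
        k ⊗ (k ⊗ (E ⊗ E ⊖ N ⊗ E))              ≈⟨ mod-* mod-refl (mod-* mod-refl (mod-trans (mod-+ (mod-weaken divides idem) mod-refl) (≈⇒mod (R.-‿inverseʳ (N ⊗ E))))) ⟩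
        k ⊗ (k ⊗ [])                           ≈⟨ ≈⇒mod (≈-trans (R.*-congˡ (R.zeroʳ _)) (R.zeroʳ _)) ⟩
        [] ∎
      Y∣g : c ≡ 0ℤ → Y ∣⊗ g
      Y∣g c≡0 = ∣-con-cancel (+ n) u (∣-con-cancel (+ K) {{K≢0}} u (mod⇒∣ (begin
        k ⊗ (N ⊗ g)         ≈⟨ mod-* mod-refl (mod-sym (mod-weaken divides gE)) ⟩
        k ⊗ (g ⊗ E)         ≈⟨ ≈⇒mod (lem₂ k g E) ⟩
        g ⊗ (k ⊗ E)         ≈⟨ mod-* mod-refl kE ⟩
        g ⊗ con c           ≈⟨ ≈⇒mod (≈-trans (R.*-congˡ (≈-trans (≈-reflexive (cong con c≡0)) con-0)) (R.zeroʳ g)) ⟩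
        [] ∎)))
      Y∣f : c ℤ.+ ℤ.- (+ K ℤ.* + n) ≡ 0ℤ → Y ∣⊗ f
      Y∣f c≡Kn = ∣-con-cancel (+ n) u (∣-con-cancel (+ K) {{K≢0}} u (mod⇒∣ (begin
        k ⊗ (N ⊗ f)             ≈⟨ ≈⇒mod (≈-trans (≈-sym (R.*-assoc _ _ _)) (≈-trans (R.*-congʳ (≈-sym (con-* (+ K) (+ n)))) (R.*-comm _ f))) ⟩
        f ⊗ con (+ K ℤ.* + n)   ≈⟨ ≈⇒mod (R.*-congˡ (≈-reflexive (cong con (sym (ℤₚ.i-j≡0⇒i≡j c _ c≡Kn))))) ⟩
        f ⊗ con c               ≈⟨ mod-* mod-refl (mod-sym kE) ⟩
        f ⊗ (k ⊗ E)             ≈⟨ ≈⇒mod (lem₂ f k E) ⟩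
        k ⊗ (f ⊗ E)             ≈⟨ mod-* mod-refl (mod-weaken divides fE) ⟩
        k ⊗ []                  ≈⟨ ≈⇒mod (R.zeroʳ _) ⟩
        [] ∎)))

  -- `t` holds the factors removed earlier, so that `prime-property` applies to the full
  -- factorisation of x^n - 1 into f and g t. If Y divides g t it divides g, since x^n - 1 is
  -- squarefree and has both Y and t as separate factors.
  strip : ∀ {Y r t f g} → Rational Y → f ⊗ g ≈ Y ⊗ r → (Y ⊗ r) ⊗ t ≈ X^n-1 n →
    (∃ λ f′ → f ≈ Y ⊗ f′ × f′ ⊗ g ≈ r) ⊎ (∃ λ g′ → g ≈ Y ⊗ g′ × f ⊗ g′ ≈ r)
  strip {Y} {r} {t} {f} {g} Yr fg Yrt = [ inj₁ ∘ from-f , inj₂ ∘ from-g ]′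
    (Factors.prime-property {f} {g ⊗ t} (≈-trans (≈-sym (R.*-assoc f g t)) (≈-trans (R.*-congʳ fg) Yrt)) Yr)
    where
    open Rational Yr
    u : UnitConstant Y
    u = unitConstant-∣ divides (X^n-1-unitConstant n)
    opaque
      unfolding _⊕_
      lem₁ : ∀ y t r → y ⊗ t ⊗ r ≈ (y ⊗ r) ⊗ t
      lem₁ = solve-∀-in polyACR
      lem₂ : ∀ y f g → y ⊗ (f ⊗ g) ≈ f ⊗ (y ⊗ g)
      lem₂ = solve-∀-in polyACR
    from-f : Y ∣⊗ f → ∃ λ f′ → f ≈ Y ⊗ f′ × f′ ⊗ g ≈ r
    from-f (f′ , e) = f′ , ≈-sym e , *-cancelˡ Y u (≈-trans (≈-sym (R.*-assoc Y f′ g)) (≈-trans (R.*-congʳ e) fg))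
    from-g : Y ∣⊗ g ⊗ t → ∃ λ g′ → g ≈ Y ⊗ g′ × f ⊗ g′ ≈ r
    from-g d = let g′ , e = squarefree-cancel n {Y} {t} {r} {g} (≈-trans (lem₁ Y t r) Yrt) (∣-respʳ (R.*-comm g t) d)
      in g′ , ≈-sym e , *-cancelˡ Y u (≈-trans (lem₂ Y f g′) (≈-trans (R.*-congˡ e) fg))

-- Divisors of (x^n - 1) / (x^(pq) - 1) involve only powers of x^q

coeff-⊗-vanish : ∀ f g i → (∀ j k → j ℕ.+ k ≡ i → coeff f j ℤ.* coeff g k ≡ 0ℤ) → coeff (f ⊗ g) i ≡ 0ℤ
coeff-⊗-vanish []      g i       z = at (R.zeroˡ g) i
coeff-⊗-vanish (a ∷ f) g zero    z = trans (coeff-⊗-zero (a ∷ f) g) (z 0 0 refl)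
coeff-⊗-vanish (a ∷ f) g (suc i) z = trans (coeff-⊗-suc a f g i)
  (cong₂ ℤ._+_ (z 0 (suc i) refl) (coeff-⊗-vanish f g i (λ j k e → z (suc j) k (cong suc e))))

coeff-X^⊗-≥ : ∀ n h j → coeff (X ^ₚ n ⊗ h) (n ℕ.+ j) ≡ coeff h j
coeff-X^⊗-≥ zero    h j = at (R.*-identityˡ h) j
coeff-X^⊗-≥ (suc n) h j = trans (at (R.*-assoc X (X ^ₚ n) h) _) (trans (coeff-X⊗-suc (X ^ₚ n ⊗ h) (n ℕ.+ j)) (coeff-X^⊗-≥ n h j))

coeff-X^⊗-< : ∀ n h i → i < n → coeff (X ^ₚ n ⊗ h) i ≡ 0ℤ
coeff-X^⊗-< (suc n) h zero    p       = trans (at (R.*-assoc X (X ^ₚ n) h) 0) (coeff-X⊗-zero (X ^ₚ n ⊗ h))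
coeff-X^⊗-< (suc n) h (suc i) (s≤s p) = trans (at (R.*-assoc X (X ^ₚ n) h) _) (trans (coeff-X⊗-suc (X ^ₚ n ⊗ h) i) (coeff-X^⊗-< n h i p))

X^n-1-⊗ : ∀ n h → X^n-1 n ⊗ h ≈ X ^ₚ n ⊗ h ⊖ h
X^n-1-⊗ n h = lem (X ^ₚ n) h
  where
  opaque
    unfolding _⊕_
    lem : ∀ x h → (x ⊕ ⊝ con 1ℤ) ⊗ h ≈ x ⊗ h ⊕ ⊝ h
    lem = solve-∀-in polyACR

coeff-X^n-1-> : ∀ n i → n < i → coeff (X^n-1 n) i ≡ 0ℤ
coeff-X^n-1-> n i p = trans (sym (at (Xⁿ-1≈ n) i)) (coeff-Xⁿ-1 n i p)

-- `θ` does not raise degrees. In degree at most n, reduction modulo x^n - 1 identifies only the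
-- exponents 0 and n, so every other class sum of `θ f ⊗ g` is a single coefficient.
θ-product-degree : ∀ n .{{_ : NonZero n}} {f g} → f ⊗ g ≈ X^n-1 n → ∀ i → n < i → coeff (θ f ⊗ g) i ≡ 0ℤ
θ-product-degree n {f} {g} fg i n<i = go (degree f) (degree g)
  where
  X^n-1≉0 : ¬ (f ⊗ g ≈ [])
  X^n-1≉0 e with trans (sym (cong₂ ℤ._*_ z z)) (X^n-1-unitConstant n)
    where
    z : coeff (X^n-1 n) 0 ≡ 0ℤ
    z = trans (sym (at fg 0)) (at e 0)
  ... | ()
  go : f ≋ [] ⊎ ∃ (HasDegree f) → g ≋ [] ⊎ ∃ (HasDegree g) → coeff (θ f ⊗ g) i ≡ 0ℤ
  go (inj₁ z) _ = ⊥-elim (X^n-1≉0 (≈-trans (R.*-congʳ ⟪ z ⟫) (R.zeroˡ g)))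
  go _ (inj₁ z) = ⊥-elim (X^n-1≉0 (≈-trans (R.*-congˡ ⟪ z ⟫) (R.zeroʳ f)))
  go (inj₂ (d , nz , zf)) (inj₂ (e , nz′ , zg)) = coeff-⊗-vanish (θ f) g i vanish
    where
    d+e≤n : d ℕ.+ e ≤ n
    d+e≤n with d ℕ.+ e ℕ.≤? n
    ... | yes p = p
    ... | no p with ℤₚ.i*j≡0⇒i≡0∨j≡0 (coeff f d) (trans (sym (leading-⊗ f g d e zf zg))
                   (trans (at fg (d ℕ.+ e)) (coeff-X^n-1-> n (d ℕ.+ e) (ℕₚ.≰⇒> p))))
    ...   | inj₁ z = ⊥-elim (nz z)
    ...   | inj₂ z = ⊥-elim (nz′ z)
    vanish : ∀ j k → j ℕ.+ k ≡ i → coeff (θ f) j ℤ.* coeff g k ≡ 0ℤ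
    vanish j k eq with j ℕ.≤? d | k ℕ.≤? e
    ... | no p  | _     = trans (cong (ℤ._* coeff g k) (trans (coeff-θ f j) (trans (cong (+ j ℤ.*_) (zf j (ℕₚ.≰⇒> p))) (ℤₚ.*-zeroʳ (+ j))))) refl
    ... | yes _ | no p  = trans (cong (coeff (θ f) j ℤ.*_) (zg k (ℕₚ.≰⇒> p))) (ℤₚ.*-zeroʳ (coeff (θ f) j))
    ... | yes p | yes r = ⊥-elim (ℕₚ.<⇒≱ (subst (n <_) (sym eq) n<i) (ℕₚ.≤-trans (ℕₚ.+-mono-≤ p r) d+e≤n))

congruent-*-cancel : ∀ n k {i j} → Coprime k n → Congruent n (k ℕ.* i) (k ℕ.* j) → Congruent n i j
congruent-*-cancel n k {i} {j} c d = ℤ∣.∣ᵤ⇒∣ (coprime-divisor (Coprimality.sym c)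
  (subst (n ℕ∣.∣_) (ℤₚ.abs-* (+ k) (+ i ℤ.- + j)) (ℤ∣.∣⇒∣ᵤ (subst (+ n ℤ∣.∣_) (factor k i j) d))))
  where
  factor : ∀ k i j → + (k ℕ.* i) ℤ.- + (k ℕ.* j) ≡ + k ℤ.* (+ i ℤ.- + j)
  factor k i j = trans (cong₂ ℤ._-_ (ℤₚ.pos-* k i) (ℤₚ.pos-* k j)) (lem (+ k) (+ i) (+ j))
    where
    lem : ∀ k i j → k ℤ.* i ℤ.- k ℤ.* j ≡ k ℤ.* (i ℤ.- j)
    lem = solve-∀

congruent-*-mono : ∀ n k {i j} → Congruent n i j → Congruent n (k ℕ.* i) (k ℕ.* j)
congruent-*-mono n k {i} {j} d = subst (+ n ℤ∣.∣_) (trans (lem (+ k) (+ i) (+ j)) (sym (cong₂ ℤ._-_ (ℤₚ.pos-* k i) (ℤₚ.pos-* k j))))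
  (ℤ∣.∣n⇒∣m*n (+ k) d)
  where
  lem : ∀ k i j → k ℤ.* (i ℤ.- j) ≡ k ℤ.* i ℤ.- k ℤ.* j
  lem = solve-∀

residue-shift : ∀ n s j i → residue n (s ℕ.+ j) (s ℕ.+ i) ≡ residue n j i
residue-shift n s j i = residue-cong n {s ℕ.+ i} {s ℕ.+ j} {i} {j} (subst (+ n ℤ∣.∣_) eq) (subst (+ n ℤ∣.∣_) (sym eq))
  where
  eq : + (s ℕ.+ i) ℤ.- + (s ℕ.+ j) ≡ + i ℤ.- + j
  eq = lem (+ s) (+ i) (+ j)
    where
    lem : ∀ s i j → (s ℤ.+ i) ℤ.- (s ℤ.+ j) ≡ i ℤ.- j
    lem = solve-∀

residue-+n : ∀ n j i → residue n (n ℕ.+ j) i ≡ residue n j i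
residue-+n n j i = trans (sym (residue-periodic n (n ℕ.+ j) i)) (residue-shift n n j i)

module PowerOf {p q : ℕ} (pp : Prime p) (qp : Prime q) (p<q : p < q) (b-1 : ℕ) where

  open Split pp qp p<q (suc b-1)

  r = p ℕ.* q

  module _ {f g₁ : Poly} (fg : f ⊗ (X^n-1 r ⊗ g₁) ≈ X^n-1 n) where

    private
      g = X^n-1 r ⊗ g₁
      E = θ f ⊗ g
      Z = θ f ⊗ g₁

    open Factors {f} {g} fg using (idem)

    class : ℕ → ℤ
    class j = pair (residue n j) E

    -- E ≡ E(x^k) modulo x^n - 1, and multiplication by the unit k permutes the residue classes
    -- modulo n.
    class-unit : ∀ k .{{_ : NonZero k}} j → Coprime k n → class (k ℕ.* j) ≡ class j
    class-unit k j c = begin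
      pair (residue n (k ℕ.* j)) E                  ≡⟨ pair-mod {n} (residue-periodic n (k ℕ.* j)) (invariant n E idem k c) ⟩
      pair (residue n (k ℕ.* j)) (E ∘ₚ (X ^ₚ k))     ≡⟨ pair-∘ (residue n (k ℕ.* j)) k E ⟩
      pair (residue n (k ℕ.* j) ∘ (k ℕ.*_)) E       ≡⟨ pair-congˡ E (λ i → residue-cong n {k ℕ.* i} {k ℕ.* j} {i} {j} (congruent-*-cancel n k c) (congruent-*-mono n k)) ⟩
      pair (residue n j) E ∎
      where open ≡-Reasoning

    class-+n : ∀ j → class (n ℕ.+ j) ≡ class j
    class-+n j = pair-congˡ E (residue-+n n j)

    coprime-n : ∀ k → ¬ (p ℕ∣.∣ k) → ¬ (q ℕ∣.∣ k) → Coprime k n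
    coprime-n k p∤k q∤k = coprime-* (Coprimality.sym (prime∤⇒coprime pp p∤k)) (coprime-^ (suc b-1) (Coprimality.sym (prime∤⇒coprime qp q∤k)))

    ∤⇒nonZero : ∀ {k} → ¬ (q ℕ∣.∣ k) → NonZero k
    ∤⇒nonZero {zero}  h = ⊥-elim (h (_ ℕ∣.∣0))
    ∤⇒nonZero {suc k} h = _

    class-p∤ : ∀ j → ¬ (p ℕ∣.∣ j) → ¬ (q ℕ∣.∣ j) → class j ≡ class 1
    class-p∤ j p∤j q∤j = trans (cong class (sym (ℕₚ.*-identityʳ j))) (class-unit j {{∤⇒nonZero q∤j}} 1 (coprime-n j p∤j q∤j))

    class-p∣ : ∀ j → ¬ (q ℕ∣.∣ j ℕ.* p) → class (j ℕ.* p) ≡ class p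
    class-p∣ j q∤jp with p ℕ∣.∣? j
    ... | no p∤j = class-unit j {{∤⇒nonZero q∤j}} p (coprime-n j p∤j q∤j)
      where
      q∤j : ¬ (q ℕ∣.∣ j)
      q∤j d = q∤jp (ℕ∣.∣m⇒∣m*n p d)
    ... | yes p∣j = trans (sym (class-+n (j ℕ.* p))) (trans (cong class eq) (class-unit k {{∤⇒nonZero q∤k}} p (coprime-n k p∤k q∤k)))
      where
      -- Adding n to j p leaves the class unchanged and replaces j by this k, which is prime to p
      -- because p divides j but no power of q.
      k = q ℕ.^ suc b-1 ℕ.+ j
      eq : n ℕ.+ j ℕ.* p ≡ k ℕ.* p
      eq = trans (cong (ℕ._+ j ℕ.* p) (ℕₚ.*-comm p (q ℕ.^ suc b-1))) (sym (ℕₚ.*-distribʳ-+ p (q ℕ.^ suc b-1) j))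
      p∤q^ : ∀ c → ¬ (p ℕ∣.∣ q ℕ.^ c)
      p∤q^ zero    d = ¬prime[1] (subst Prime (ℕ∣.∣1⇒≡1 d) pp)
      p∤q^ (suc c) d = [ p∤q , p∤q^ c ]′ (euclidsLemma q (q ℕ.^ c) pp d)
      p∤k : ¬ (p ℕ∣.∣ k)
      p∤k d = p∤q^ (suc b-1) (ℕ∣.∣m+n∣m⇒∣n (subst (p ℕ∣.∣_) (ℕₚ.+-comm _ j) d) p∣j)
      q∤k : ¬ (q ℕ∣.∣ k)
      q∤k d = q∤jp (ℕ∣.∣m⇒∣m*n p (ℕ∣.∣m+n∣m⇒∣n d (ℕ∣.m∣m*n (q ℕ.^ b-1))))

    q∣r : q ℕ∣.∣ r
    q∣r = ℕ∣.n∣m*n p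

    -- Modulo n, an exponent not divisible by q is a unit times 1 or a unit times p, according as p
    -- divides it or not. Adding p q changes neither condition.
    class-+r : ∀ j → ¬ (q ℕ∣.∣ j) → class (r ℕ.+ j) ≡ class j
    class-+r j q∤j with p ℕ∣.∣? j
    ... | no p∤j = trans (class-p∤ (r ℕ.+ j) (λ d → p∤j (ℕ∣.∣m+n∣m⇒∣n d (ℕ∣.m∣m*n q))) (λ d → q∤j (ℕ∣.∣m+n∣m⇒∣n d q∣r))) (sym (class-p∤ j p∤j q∤j))
    ... | yes (ℕ∣.divides j′ refl) = trans (cong class eq) (trans (class-p∣ (q ℕ.+ j′) (λ d → q∤j (ℕ∣.∣m+n∣m⇒∣n (subst (q ℕ∣.∣_) (sym eq) d) q∣r))) (sym (class-p∣ j′ q∤j)))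
      where
      eq : r ℕ.+ j′ ℕ.* p ≡ (q ℕ.+ j′) ℕ.* p
      eq = trans (cong (ℕ._+ j′ ℕ.* p) (ℕₚ.*-comm p q)) (sym (ℕₚ.*-distribʳ-+ p q j′))

    z : ℕ → ℤ
    z j = pair (residue n j) Z

    class-difference : ∀ j → class (r ℕ.+ j) ≡ z j ℤ.- z (r ℕ.+ j)
    class-difference j = begin
      pair φ E                                   ≡⟨ pair-cong φ E _ (≈-trans (lem (θ f) (X^n-1 r) g₁) (X^n-1-⊗ r Z)) ⟩
      pair φ (X ^ₚ r ⊗ Z ⊖ Z)                     ≡⟨ pair-⊕ φ (X ^ₚ r ⊗ Z) (⊝ Z) ⟩
      pair φ (X ^ₚ r ⊗ Z) ℤ.+ pair φ (⊝ Z)        ≡⟨ cong₂ ℤ._+_ (trans (pair-X^⊗ φ r Z) (pair-congˡ Z (residue-shift n r j))) (pair-⊝ φ Z) ⟩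
      z j ℤ.- z (r ℕ.+ j) ∎
      where
      open ≡-Reasoning
      φ = residue n (r ℕ.+ j)
      opaque
        unfolding _⊕_
        lem : ∀ a b c → a ⊗ (b ⊗ c) ≈ b ⊗ (a ⊗ c)
        lem = solve-∀-in polyACR

    -- The class sums are constant along j + r ℕ, and they telescope over n / r steps because
    -- x^r - 1 divides E.
    class-zero : ∀ j → ¬ (q ℕ∣.∣ j) → class j ≡ 0ℤ
    class-zero j q∤j = [ ⊥-elim ∘ N≢0 , (λ x → x) ]′ (ℤₚ.i*j≡0⇒i≡0∨j≡0 (+ N) N·class≡0)
      where
      N = q ℕ.^ b-1
      N≢0 : + N ≢ 0ℤ
      N≢0 e = ℕ.≢-nonZero⁻¹ N {{ℕₚ.m^n≢0 q b-1}} (ℤₚ.+-injective e)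
      progression : ∀ t → z (t ℕ.* r ℕ.+ j) ≡ z j ℤ.- + t ℤ.* class j × class (t ℕ.* r ℕ.+ j) ≡ class j × ¬ (q ℕ∣.∣ t ℕ.* r ℕ.+ j)
      progression zero    = sym (trans (cong (λ w → z j ℤ.+ ℤ.- w) (ℤₚ.*-zeroˡ (class j))) (ℤₚ.+-identityʳ (z j))) , refl , q∤j
      progression (suc t) with progression t
      ... | zt , ct , nt = (begin
          z (r ℕ.+ t ℕ.* r ℕ.+ j)                              ≡⟨ cong z (ℕₚ.+-assoc r (t ℕ.* r) j) ⟩
          z (r ℕ.+ i)                                          ≡⟨ lem₁ (z i) (z (r ℕ.+ i)) ⟩
          z i ℤ.- (z i ℤ.- z (r ℕ.+ i))                        ≡⟨ cong₂ ℤ._-_ zt (trans (sym (class-difference i)) (trans (class-+r i nt) ct)) ⟩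
          (z j ℤ.- + t ℤ.* class j) ℤ.- class j                ≡⟨ lem₂ (z j) (+ t) (class j) ⟩
          z j ℤ.- + suc t ℤ.* class j ∎) ,
        trans (cong class (ℕₚ.+-assoc r (t ℕ.* r) j)) (trans (class-+r i nt) ct) ,
        λ d → nt (ℕ∣.∣m+n∣m⇒∣n (subst (q ℕ∣.∣_) (ℕₚ.+-assoc r (t ℕ.* r) j) d) q∣r)
        where
        open ≡-Reasoning
        i = t ℕ.* r ℕ.+ j
        lem₁ : ∀ a b → b ≡ a ℤ.- (a ℤ.- b)
        lem₁ = solve-∀
        lem₂ : ∀ a t c → (a ℤ.- t ℤ.* c) ℤ.- c ≡ a ℤ.- (1ℤ ℤ.+ t) ℤ.* c
        lem₂ = solve-∀
      Nr≡n : N ℕ.* r ≡ n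
      Nr≡n = trans (ℕₚ.*-comm N r) (ℕₚ.*-assoc p q N)
      N·class≡0 : + N ℤ.* class j ≡ 0ℤ
      N·class≡0 = trans (lem (z j) (+ N ℤ.* class j)) (trans (cong (λ w → z j ℤ.- w) (trans (sym (proj₁ (progression N)))
        (trans (cong (λ w → z (w ℕ.+ j)) Nr≡n) (pair-congˡ Z (residue-+n n j))))) (ℤₚ.+-inverseʳ (z j)))
        where
        lem : ∀ a b → b ≡ a ℤ.- (a ℤ.- b)
        lem = solve-∀

    q∣n : q ℕ∣.∣ n
    q∣n = ℕ∣.∣n⇒∣m*n p (ℕ∣.m∣m*n (q ℕ.^ b-1))

    E-zero : coeff E 0 ≡ 0ℤ
    E-zero = trans (coeff-⊗-zero (θ f) g) (trans (cong (ℤ._* coeff g 0) (trans (coeff-θ f 0) (ℤₚ.*-zeroˡ (coeff f 0)))) (ℤₚ.*-zeroˡ (coeff g 0)))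

    E-vanish : ∀ j → ¬ (q ℕ∣.∣ j) → coeff E j ≡ 0ℤ
    E-vanish j q∤j with n ℕ.<? j
    ... | yes n<j = θ-product-degree n {f} {g} fg j n<j
    ... | no n≮j = trans (sym (ℤₚ.*-identityˡ (coeff E j))) (trans (cong (ℤ._* coeff E j) (sym (residue-yes n {j} {j} (congruent-refl n j))))
      (trans (sym (pair-single (residue n j) E j off)) (class-zero j q∤j)))
      where
      j<n : j < n
      j<n = ℕₚ.≤∧≢⇒< (ℕₚ.≮⇒≥ n≮j) (λ e → q∤j (subst (q ℕ∣.∣_) (sym e) q∣n))
      off : ∀ i → i ≢ j → residue n j i ℤ.* coeff E i ≡ 0ℤ
      off i i≢j with ℕₚ.<-cmp i n
      ... | tri< i<n _ _ = cong (ℤ._* coeff E i) (residue-no n {i} {j} (i≢j ∘ congruent-<⇒≡ n i<n j<n))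
      ... | tri> _ _ n<i = trans (cong (residue n j i ℤ.*_) (θ-product-degree n {f} {g} fg i n<i)) (ℤₚ.*-zeroʳ (residue n j i))
      -- The exponent n falls into the class of 0, which is not that of j because q divides n but
      -- not j.
      ... | tri≈ _ refl _ = cong (ℤ._* coeff E i) (residue-no n {i} {j} λ d → q∤j (subst (q ℕ∣.∣_) (congruent-<⇒≡ n (ℕ.>-nonZero⁻¹ n) j<n
        (ℤ∣.∣m+n∣m⇒∣n (subst (+ n ℤ∣.∣_) (trans (cong (λ w → + w ℤ.- + j) (sym (ℕₚ.+-identityʳ n))) (ℤₚ.+-assoc (+ n) 0ℤ (ℤ.- + j))) d) ℤ∣.∣-refl)) (_ ℕ∣.∣0)))

    -- The identity f E = (x^n - 1) θ f is a recurrence: i f_i equals (i - n) f_(i-n), present only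
    -- if i ≥ n, minus the sum of f_j E_k over j + k = i. Since E has no constant term and lives on
    -- multiples of q, every f_j that could contribute has j < i and j not divisible by q.
    f-vanish : ∀ i → ¬ (q ℕ∣.∣ i) → coeff f i ≡ 0ℤ
    f-vanish = <-rec (λ i → ¬ (q ℕ∣.∣ i) → coeff f i ≡ 0ℤ) step
      where
      fE≈ : f ⊗ E ≈ X ^ₚ n ⊗ θ f ⊖ θ f
      fE≈ = ≈-trans (lem f (θ f) g) (≈-trans (R.*-congʳ fg) (X^n-1-⊗ n (θ f)))
        where
        opaque
          unfolding _⊕_
          lem : ∀ f h g → f ⊗ (h ⊗ g) ≈ (f ⊗ g) ⊗ h
          lem = solve-∀-in polyACR
      step : ∀ i → (∀ {j} → j < i → ¬ (q ℕ∣.∣ j) → coeff f j ≡ 0ℤ) → ¬ (q ℕ∣.∣ i) → coeff f i ≡ 0ℤ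
      step i rec q∤i = [ (λ i≡0 → ⊥-elim (q∤i (subst (q ℕ∣.∣_) (sym (ℤₚ.+-injective i≡0)) (_ ℕ∣.∣0)))) , (λ x → x) ]′
        (ℤₚ.i*j≡0⇒i≡0∨j≡0 (+ i) (begin
          + i ℤ.* coeff f i                                            ≡⟨ sym (coeff-θ f i) ⟩
          coeff (θ f) i                                                ≡⟨ lem (coeff (X ^ₚ n ⊗ θ f) i) (coeff (θ f) i) ⟩
          coeff (X ^ₚ n ⊗ θ f) i ℤ.+ ℤ.- (coeff (X ^ₚ n ⊗ θ f) i ℤ.+ -1ℤ ℤ.* coeff (θ f) i)
            ≡⟨ cong₂ (λ v w → v ℤ.+ ℤ.- w) high (trans (cong (ℤ._+_ (coeff (X ^ₚ n ⊗ θ f) i)) (sym (coeff-⊝ (θ f) i))) (trans (sym (coeff-⊕ (X ^ₚ n ⊗ θ f) (⊝ θ f) i)) (trans (sym (at fE≈ i)) low))) ⟩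
          0ℤ ∎))
        where
        open ≡-Reasoning
        lem : ∀ a b → b ≡ a ℤ.+ ℤ.- (a ℤ.+ -1ℤ ℤ.* b)
        lem = solve-∀
        low : coeff (f ⊗ E) i ≡ 0ℤ
        low = coeff-⊗-vanish f E i vanish
          where
          vanish : ∀ j k → j ℕ.+ k ≡ i → coeff f j ℤ.* coeff E k ≡ 0ℤ
          vanish j zero      eq = trans (cong (coeff f j ℤ.*_) E-zero) (ℤₚ.*-zeroʳ (coeff f j))
          vanish j k@(suc _) eq with q ℕ∣.∣? k
          ... | no q∤k  = trans (cong (coeff f j ℤ.*_) (E-vanish k q∤k)) (ℤₚ.*-zeroʳ (coeff f j))
          ... | yes q∣k = cong (ℤ._* coeff E k) (rec (subst (j <_) eq (ℕₚ.m<m+n j (s≤s z≤n)))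
            (λ q∣j → q∤i (subst (q ℕ∣.∣_) eq (ℕ∣.∣m∣n⇒∣m+n q∣j q∣k))))
        high : coeff (X ^ₚ n ⊗ θ f) i ≡ 0ℤ
        high with i ℕ.<? n
        ... | yes i<n = coeff-X^⊗-< n (θ f) i i<n
        ... | no i≮n = trans (cong (coeff (X ^ₚ n ⊗ θ f)) (sym n+j≡i)) (trans (coeff-X^⊗-≥ n (θ f) j) (trans (coeff-θ f j)
          (trans (cong (+ j ℤ.*_) (rec j<i (λ q∣j → q∤i (subst (q ℕ∣.∣_) n+j≡i (ℕ∣.∣m∣n⇒∣m+n q∣n q∣j))))) (ℤₚ.*-zeroʳ (+ j)))))
          where
          j = i ℕ.∸ n
          n+j≡i : n ℕ.+ j ≡ i
          n+j≡i = ℕₚ.m+[n∸m]≡n (ℕₚ.≮⇒≥ i≮n)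
          j<i : j < i
          j<i = subst (j <_) n+j≡i (ℕₚ.m<n+m j (ℕ.>-nonZero⁻¹ n))

-- Convolution

Seq : Set
Seq = ℤ → ℤ

-- Coefficients of f times the two-sided series with coefficients s. Indexing by ℤ makes all shifts
-- total and admits the power series 1 / (x^q - 1).
conv : Poly → Seq → Seq
conv []      s n = 0ℤ
conv (a ∷ f) s n = a ℤ.* s n ℤ.+ conv f s (n ℤ.- 1ℤ)

conv-congʳ : ∀ f {s t} → (∀ n → s n ≡ t n) → ∀ n → conv f s n ≡ conv f t n
conv-congʳ []      e n = refl
conv-congʳ (a ∷ f) e n = cong₂ (λ u v → a ℤ.* u ℤ.+ v) (e n) (conv-congʳ f e (n ℤ.- 1ℤ))

conv-zero : ∀ f s n → f ≋ [] → conv f s n ≡ 0ℤ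
conv-zero []      s n e = refl
conv-zero (a ∷ f) s n e = trans (cong₂ (λ u v → u ℤ.* s n ℤ.+ v) (e 0) (conv-zero f s (n ℤ.- 1ℤ) (e ∘ suc)))
  (trans (ℤₚ.+-identityʳ _) (ℤₚ.*-zeroˡ (s n)))

conv-congˡ : ∀ f g s n → f ≈ g → conv f s n ≡ conv g s n
conv-congˡ []      g       s n e = sym (conv-zero g s n (at (≈-sym e)))
conv-congˡ (a ∷ f) []      s n e = conv-zero (a ∷ f) s n (at e)
conv-congˡ (a ∷ f) (b ∷ g) s n e = cong₂ (λ u v → u ℤ.* s n ℤ.+ v) (at e 0) (conv-congˡ f g s (n ℤ.- 1ℤ) ⟪ at e ∘ suc ⟫)

conv-⊕ : ∀ f g s n → conv (f ⊕ g) s n ≡ conv f s n ℤ.+ conv g s n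
conv-⊕ []      g       s n = trans (conv-congˡ ([] ⊕ g) g s n (R.+-identityˡ g)) (sym (ℤₚ.+-identityˡ _))
conv-⊕ (a ∷ f) []      s n = trans (conv-congˡ ((a ∷ f) ⊕ []) (a ∷ f) s n (R.+-identityʳ (a ∷ f))) (sym (ℤₚ.+-identityʳ _))
conv-⊕ (a ∷ f) (b ∷ g) s n = trans (conv-congˡ ((a ∷ f) ⊕ (b ∷ g)) ((a ℤ.+ b) ∷ (f ⊕ g)) s n (≈-sym (∷-⊕ a b f g)))
  (trans (cong (ℤ._+_ ((a ℤ.+ b) ℤ.* s n)) (conv-⊕ f g s (n ℤ.- 1ℤ))) (lem a b (s n) (conv f s (n ℤ.- 1ℤ)) (conv g s (n ℤ.- 1ℤ))))
  where
  lem : ∀ a b c x y → (a ℤ.+ b) ℤ.* c ℤ.+ (x ℤ.+ y) ≡ (a ℤ.* c ℤ.+ x) ℤ.+ (b ℤ.* c ℤ.+ y)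
  lem = solve-∀

conv-con-⊗ : ∀ a f s n → conv (con a ⊗ f) s n ≡ a ℤ.* conv f s n
conv-con-⊗ a []      s n = trans (conv-congˡ (con a ⊗ []) [] s n (R.zeroʳ _)) (sym (ℤₚ.*-zeroʳ a))
conv-con-⊗ a (b ∷ f) s n = trans (conv-congˡ (con a ⊗ (b ∷ f)) (a ℤ.* b ∷ con a ⊗ f) s n (con-⊗-∷ a b f))
  (trans (cong (ℤ._+_ (a ℤ.* b ℤ.* s n)) (conv-con-⊗ a f s (n ℤ.- 1ℤ))) (lem a b (s n) (conv f s (n ℤ.- 1ℤ))))
  where
  lem : ∀ a b c x → a ℤ.* b ℤ.* c ℤ.+ a ℤ.* x ≡ a ℤ.* (b ℤ.* c ℤ.+ x)
  lem = solve-∀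

conv-con : ∀ a s n → conv (con a) s n ≡ a ℤ.* s n
conv-con a s n = ℤₚ.+-identityʳ (a ℤ.* s n)

conv-⊝ : ∀ f s n → conv (⊝ f) s n ≡ ℤ.- conv f s n
conv-⊝ f s n = trans (conv-congˡ (⊝ f) (con -1ℤ ⊗ f) s n ⟪ (λ k → trans (coeff-⊝ f k) (sym (coeff-con-⊗ -1ℤ f k))) ⟫)
  (trans (conv-con-⊗ -1ℤ f s n) (ℤₚ.-1*i≡-i _))

conv-X⊗ : ∀ f s n → conv (X ⊗ f) s n ≡ conv f s (n ℤ.- 1ℤ)
conv-X⊗ f s n = trans (conv-congˡ (X ⊗ f) (0ℤ ∷ f) s n (≈-sym (≈-trans (∷≈ 0ℤ f) (≈-trans (R.+-congʳ con-0) (R.+-identityˡ _)))))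
  (trans (cong (ℤ._+ conv f s (n ℤ.- 1ℤ)) (ℤₚ.*-zeroˡ (s n))) (ℤₚ.+-identityˡ _))

conv-⊗ : ∀ f g s n → conv (f ⊗ g) s n ≡ conv f (conv g s) n
conv-⊗ []      g s n = conv-zero ([] ⊗ g) s n (at (R.zeroˡ g))
conv-⊗ (a ∷ f) g s n = begin
  conv ((a ∷ f) ⊗ g) s n                                   ≡⟨ conv-congˡ ((a ∷ f) ⊗ g) (con a ⊗ g ⊕ X ⊗ (f ⊗ g)) s n (∷-⊗ a f g) ⟩
  conv (con a ⊗ g ⊕ X ⊗ (f ⊗ g)) s n                       ≡⟨ conv-⊕ (con a ⊗ g) (X ⊗ (f ⊗ g)) s n ⟩
  conv (con a ⊗ g) s n ℤ.+ conv (X ⊗ (f ⊗ g)) s n          ≡⟨ cong₂ ℤ._+_ (conv-con-⊗ a g s n) (trans (conv-X⊗ (f ⊗ g) s n) (conv-⊗ f g s (n ℤ.- 1ℤ))) ⟩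
  a ℤ.* conv g s n ℤ.+ conv f (conv g s) (n ℤ.- 1ℤ) ∎
  where open ≡-Reasoning

conv-X^⊗ : ∀ k f s n → conv (X ^ₚ k ⊗ f) s n ≡ conv f s (n ℤ.- + k)
conv-X^⊗ zero    f s n = trans (conv-congˡ (con 1ℤ ⊗ f) f s n (R.*-identityˡ f)) (cong (conv f s) (sym (ℤₚ.+-identityʳ n)))
conv-X^⊗ (suc k) f s n = trans (conv-congˡ (X ^ₚ suc k ⊗ f) (X ⊗ (X ^ₚ k ⊗ f)) s n (R.*-assoc X (X ^ₚ k) f))
  (trans (conv-X⊗ (X ^ₚ k ⊗ f) s n) (trans (conv-X^⊗ k f s (n ℤ.- 1ℤ)) (cong (conv f s) (lem n (+ k)))))
  where
  lem : ∀ n k → n ℤ.- 1ℤ ℤ.- k ≡ n ℤ.- (1ℤ ℤ.+ k)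
  lem = solve-∀

conv-X^-1 : ∀ t s n → conv (X ^ₚ t ⊖ con 1ℤ) s n ≡ s (n ℤ.- + t) ℤ.- s n
conv-X^-1 t s n = trans (conv-⊕ (X ^ₚ t) (⊝ con 1ℤ) s n) (cong₂ ℤ._+_
  (trans (conv-congˡ (X ^ₚ t) (X ^ₚ t ⊗ con 1ℤ) s n (≈-sym (R.*-identityʳ _))) (trans (conv-X^⊗ t (con 1ℤ) s n) (one (n ℤ.- + t))))
  (trans (conv-⊝ (con 1ℤ) s n) (cong ℤ.-_ (one n))))
  where
  one : ∀ n → conv (con 1ℤ) s n ≡ s n
  one n = trans (conv-con 1ℤ s n) (ℤₚ.*-identityˡ (s n))

conv-geom : ∀ k t s n → conv (geom (suc k) (X ^ₚ t)) s n ≡ s n ℤ.+ conv (geom k (X ^ₚ t)) s (n ℤ.- + t)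
conv-geom k t s n = trans (conv-⊕ (con 1ℤ) (X ^ₚ t ⊗ geom k (X ^ₚ t)) s n)
  (cong₂ ℤ._+_ (trans (conv-con 1ℤ s n) (ℤₚ.*-identityˡ (s n))) (conv-X^⊗ t (geom k (X ^ₚ t)) s n))

unit : Seq
unit (+ zero)  = 1ℤ
unit (+ suc n) = 0ℤ
unit -[1+ n ]  = 0ℤ

conv-unit-negative : ∀ f k → conv f unit -[1+ k ] ≡ 0ℤ
conv-unit-negative []      k = refl
conv-unit-negative (a ∷ f) k = cong₂ ℤ._+_ (ℤₚ.*-zeroʳ a) (trans (cong (conv f unit) (lem k)) (conv-unit-negative f (suc k)))
  where
  lem : ∀ k → -[1+ k ] ℤ.- 1ℤ ≡ -[1+ suc k ]
  lem k = cong (λ w → -[1+ suc w ]) (ℕₚ.+-identityʳ k)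

conv-unit : ∀ f k → conv f unit (+ k) ≡ coeff f k
conv-unit []      k       = refl
conv-unit (a ∷ f) zero    = trans (cong₂ ℤ._+_ (ℤₚ.*-identityʳ a) (conv-unit-negative f 0)) (ℤₚ.+-identityʳ a)
conv-unit (a ∷ f) (suc k) = trans (cong₂ ℤ._+_ (ℤₚ.*-zeroʳ a) (conv-unit f k)) (ℤₚ.+-identityˡ (coeff f k))

-- Height bounds

Bounded : ℕ → Seq → Set
Bounded h s = ∀ n → ∣ s n ∣ ≤ h

Supported : ℕ → Seq → Set
Supported q s = ∀ n → ¬ (+ q ℤ∣.∣ n) → s n ≡ 0ℤ

bounded-≡ : ∀ {h s s′} → (∀ n → s n ≡ s′ n) → Bounded h s → Bounded h s′
bounded-≡ {h} e b n = subst (λ z → ∣ z ∣ ≤ h) (e n) (b n)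

bounded-≈ : ∀ {h s} f g → f ≈ g → Bounded h (conv f s) → Bounded h (conv g s)
bounded-≈ {s = s} f g e = bounded-≡ (λ n → conv-congˡ f g s n e)

bounded-⊗ : ∀ {h s} f g → Bounded h (conv f (conv g s)) → Bounded h (conv (f ⊗ g) s)
bounded-⊗ {s = s} f g = bounded-≡ (λ n → sym (conv-⊗ f g s n))

bounded-difference : ∀ {h s} t → Bounded h s → Bounded (2 ℕ.* h) (conv (X ^ₚ t ⊖ con 1ℤ) s)
bounded-difference {h} {s} t b n = begin
  ∣ conv (X ^ₚ t ⊖ con 1ℤ) s n ∣   ≡⟨ cong ∣_∣ (conv-X^-1 t s n) ⟩
  ∣ s (n ℤ.- + t) ℤ.- s n ∣       ≤⟨ ℤₚ.∣i-j∣≤∣i∣+∣j∣ (s (n ℤ.- + t)) (s n) ⟩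
  ∣ s (n ℤ.- + t) ∣ ℕ.+ ∣ s n ∣   ≤⟨ ℕₚ.+-mono-≤ (b _) (b n) ⟩
  h ℕ.+ h                         ≡⟨ cong (h ℕ.+_) (sym (ℕₚ.+-identityʳ h)) ⟩
  2 ℕ.* h ∎
  where open ℕₚ.≤-Reasoning

bounded-geom : ∀ {h s} k t → Bounded h s → Bounded (k ℕ.* h) (conv (geom k (X ^ₚ t)) s)
bounded-geom zero    t b n = z≤n
bounded-geom {h} {s} (suc k) t b n = begin
  ∣ conv (geom (suc k) (X ^ₚ t)) s n ∣                        ≡⟨ cong ∣_∣ (conv-geom k t s n) ⟩
  ∣ s n ℤ.+ conv (geom k (X ^ₚ t)) s (n ℤ.- + t) ∣            ≤⟨ ℤₚ.∣i+j∣≤∣i∣+∣j∣ (s n) _ ⟩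
  ∣ s n ∣ ℕ.+ ∣ conv (geom k (X ^ₚ t)) s (n ℤ.- + t) ∣        ≤⟨ ℕₚ.+-mono-≤ (b n) (bounded-geom k t b _) ⟩
  h ℕ.+ k ℕ.* h ∎
  where open ℕₚ.≤-Reasoning

supported-conv : ∀ {q s} V → Supported q s → Supported q (conv (V ∘ₚ (X ^ₚ q)) s)
supported-conv []      S n q∤n = refl
supported-conv {q} {s} (a ∷ V) S n q∤n = trans (conv-⊕ (con a) (X ^ₚ q ⊗ V ∘ₚ (X ^ₚ q)) s n) (cong₂ ℤ._+_
  (trans (conv-con a s n) (trans (cong (a ℤ.*_) (S n q∤n)) (ℤₚ.*-zeroʳ a)))
  (trans (conv-X^⊗ q (V ∘ₚ (X ^ₚ q)) s n) (supported-conv V S (n ℤ.- + q) (λ d → q∤n (ℤ∣.∣m+n∣n⇒∣m d (ℤ∣.∣m⇒∣-m ℤ∣.∣-refl))))))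

supported-unit : ∀ q → Supported q unit
supported-unit q (+ zero)  q∤n = ⊥-elim (q∤n (ℤ∣.divides 0ℤ refl))
supported-unit q (+ suc n) q∤n = refl
supported-unit q -[1+ n ]  q∤n = refl

extend : Poly → Seq
extend V (+ k)    = coeff V k
extend V -[1+ k ] = 0ℤ

conv-∘-unit : ∀ q .{{_ : NonZero q}} V j → conv (V ∘ₚ (X ^ₚ q)) unit (j ℤ.* + q) ≡ extend V j
conv-∘-unit q []      (+ k)    = refl
conv-∘-unit q []      -[1+ k ] = refl
conv-∘-unit q (a ∷ V) j = begin
  conv (con a ⊕ X ^ₚ q ⊗ V ∘ₚ (X ^ₚ q)) unit (j ℤ.* + q)                        ≡⟨ conv-⊕ (con a) (X ^ₚ q ⊗ V ∘ₚ (X ^ₚ q)) unit (j ℤ.* + q) ⟩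
  conv (con a) unit (j ℤ.* + q) ℤ.+ conv (X ^ₚ q ⊗ V ∘ₚ (X ^ₚ q)) unit (j ℤ.* + q)
    ≡⟨ cong₂ ℤ._+_ (conv-con a unit (j ℤ.* + q)) (trans (conv-X^⊗ q (V ∘ₚ (X ^ₚ q)) unit (j ℤ.* + q)) (trans (cong (conv (V ∘ₚ (X ^ₚ q)) unit) (lem j (+ q))) (conv-∘-unit q V (j ℤ.- 1ℤ)))) ⟩
  a ℤ.* unit (j ℤ.* + q) ℤ.+ extend V (j ℤ.- 1ℤ)                              ≡⟨ cong (λ w → a ℤ.* w ℤ.+ extend V (j ℤ.- 1ℤ)) (unit-* q j) ⟩
  a ℤ.* unit j ℤ.+ extend V (j ℤ.- 1ℤ)                                        ≡⟨ final j ⟩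
  extend (a ∷ V) j ∎
  where
  open ≡-Reasoning
  lem : ∀ j q → j ℤ.* q ℤ.- q ≡ (j ℤ.- 1ℤ) ℤ.* q
  lem = solve-∀
  unit-* : ∀ q .{{_ : NonZero q}} j → unit (j ℤ.* + q) ≡ unit j
  unit-* (suc q) (+ zero)  = refl
  unit-* (suc q) (+ suc j) = refl
  unit-* (suc q) -[1+ j ]  = refl
  final : ∀ j → a ℤ.* unit j ℤ.+ extend V (j ℤ.- 1ℤ) ≡ extend (a ∷ V) j
  final (+ zero)  = trans (ℤₚ.+-identityʳ _) (ℤₚ.*-identityʳ a)
  final (+ suc j) = trans (cong (ℤ._+ coeff V j) (ℤₚ.*-zeroʳ a)) (ℤₚ.+-identityˡ (coeff V j))
  final -[1+ j ]  = trans (ℤₚ.+-identityʳ _) (ℤₚ.*-zeroʳ a)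

-- Sparse sums: a progression of length at most q with difference prime to q meets qℤ at most once.

module Sparse {q t : ℕ} (c : Coprime q t) {s : Seq} (S : Supported q s) where

  conv-geom-zero : ∀ k n → (∀ i → i < k → ¬ (+ q ℤ∣.∣ n ℤ.- + (t ℕ.* i))) → conv (geom k (X ^ₚ t)) s n ≡ 0ℤ
  conv-geom-zero zero    n ∤ = refl
  conv-geom-zero (suc k) n ∤ = trans (conv-geom k t s n) (cong₂ ℤ._+_
    (S n (λ d → ∤ 0 (s≤s z≤n) (subst (+ q ℤ∣.∣_) (sym (trans (cong (λ w → n ℤ.- + w) (ℕₚ.*-zeroʳ t)) (ℤₚ.+-identityʳ n))) d)))
    (conv-geom-zero k (n ℤ.- + t) (λ i i<k d → ∤ (suc i) (s≤s i<k) (subst (+ q ℤ∣.∣_) (shift n i) d))))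
    where
    lem : ∀ n t w → n ℤ.- t ℤ.- w ≡ n ℤ.- (t ℤ.+ w)
    lem = solve-∀
    shift : ∀ n i → n ℤ.- + t ℤ.- + (t ℕ.* i) ≡ n ℤ.- + (t ℕ.* suc i)
    shift n i = trans (lem n (+ t) (+ (t ℕ.* i))) (cong (λ w → n ℤ.- + w) (sym (ℕₚ.*-suc t i)))

  conv-geom-hit : ∀ k i n → k ≤ q → i < k → + q ℤ∣.∣ n ℤ.- + (t ℕ.* i) → conv (geom k (X ^ₚ t)) s n ≡ s (n ℤ.- + (t ℕ.* i))
  conv-geom-hit (suc k) zero n k<q i<k d = trans (conv-geom k t s n) (trans (cong (ℤ._+_ (s n)) (conv-geom-zero k (n ℤ.- + t) miss))
    (trans (ℤₚ.+-identityʳ (s n)) (cong s (sym eq))))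
    where
    eq : n ℤ.- + (t ℕ.* 0) ≡ n
    eq = trans (cong (λ w → n ℤ.- + w) (ℕₚ.*-zeroʳ t)) (ℤₚ.+-identityʳ n)
    miss : ∀ i → i < k → ¬ (+ q ℤ∣.∣ n ℤ.- + t ℤ.- + (t ℕ.* i))
    miss i i<k d′ = ℕₚ.<⇒≱ (ℕₚ.≤-<-trans i<k k<q) (ℕ∣.∣⇒≤ (coprime-divisor c (ℤ∣.∣⇒∣ᵤ (subst (+ q ℤ∣.∣_)
      (trans (lem n (+ t) (+ (t ℕ.* i))) (cong +_ (sym (ℕₚ.*-suc t i)))) (ℤ∣.∣m∣n⇒∣m-n (subst (+ q ℤ∣.∣_) eq d) d′)))))
      where
      lem : ∀ n t w → n ℤ.- (n ℤ.- t ℤ.- w) ≡ t ℤ.+ w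
      lem = solve-∀
  conv-geom-hit (suc k) (suc i) n k<q (s≤s i<k) d = trans (conv-geom k t s n) (trans (cong₂ ℤ._+_ (S n miss)
    (conv-geom-hit k i (n ℤ.- + t) (ℕₚ.<⇒≤ k<q) i<k (subst (+ q ℤ∣.∣_) (sym eq) d))) (trans (ℤₚ.+-identityˡ _) (cong s eq)))
    where
    lem : ∀ n t w → n ℤ.- t ℤ.- w ≡ n ℤ.- (t ℤ.+ w)
    lem = solve-∀
    eq : n ℤ.- + t ℤ.- + (t ℕ.* i) ≡ n ℤ.- + (t ℕ.* suc i)
    eq = trans (lem n (+ t) (+ (t ℕ.* i))) (cong (λ w → n ℤ.- + w) (sym (ℕₚ.*-suc t i)))
    miss : ¬ (+ q ℤ∣.∣ n)
    miss d′ = ℕₚ.<⇒≱ (ℕₚ.≤-<-trans i<k k<q) (ℕ∣.∣⇒≤ (coprime-divisor c (ℤ∣.∣⇒∣ᵤ (subst (+ q ℤ∣.∣_)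
      (lem′ n (+ (t ℕ.* suc i))) (ℤ∣.∣m∣n⇒∣m-n d′ d)))))
      where
      lem′ : ∀ n w → n ℤ.- (n ℤ.- w) ≡ w
      lem′ = solve-∀

  hit : .{{_ : NonZero q}} → ∀ n → ∃ λ i → i < q × + q ℤ∣.∣ n ℤ.- + (t ℕ.* i)
  hit n = from-bézout (coprime-ℤ-bézout c)
    where
    witness : ∀ n x y q t i k → x ℤ.* q ℤ.+ y ℤ.* t ≡ 1ℤ → n ℤ.* y ≡ i ℤ.+ k ℤ.* q →
      n ℤ.- t ℤ.* i ≡ (n ℤ.* x ℤ.+ t ℤ.* k) ℤ.* q
    witness n x y q t i k e e′ = begin
      n ℤ.- t ℤ.* i                                           ≡⟨ lem₁ n t i ⟩
      n ℤ.* 1ℤ ℤ.- t ℤ.* i                                    ≡⟨ cong (λ w → n ℤ.* w ℤ.- t ℤ.* i) (sym e) ⟩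
      n ℤ.* (x ℤ.* q ℤ.+ y ℤ.* t) ℤ.- t ℤ.* i                 ≡⟨ lem₂ n x y q t i ⟩
      n ℤ.* x ℤ.* q ℤ.+ t ℤ.* (n ℤ.* y ℤ.- i)                 ≡⟨ cong (λ w → n ℤ.* x ℤ.* q ℤ.+ t ℤ.* (w ℤ.- i)) e′ ⟩
      n ℤ.* x ℤ.* q ℤ.+ t ℤ.* (i ℤ.+ k ℤ.* q ℤ.- i)           ≡⟨ lem₃ n x q t i k ⟩
      (n ℤ.* x ℤ.+ t ℤ.* k) ℤ.* q ∎
      where
      open ≡-Reasoning
      lem₁ : ∀ n t i → n ℤ.- t ℤ.* i ≡ n ℤ.* 1ℤ ℤ.- t ℤ.* i
      lem₁ = solve-∀
      lem₂ : ∀ n x y q t i → n ℤ.* (x ℤ.* q ℤ.+ y ℤ.* t) ℤ.- t ℤ.* i ≡ n ℤ.* x ℤ.* q ℤ.+ t ℤ.* (n ℤ.* y ℤ.- i)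
      lem₂ = solve-∀
      lem₃ : ∀ n x q t i k → n ℤ.* x ℤ.* q ℤ.+ t ℤ.* (i ℤ.+ k ℤ.* q ℤ.- i) ≡ (n ℤ.* x ℤ.+ t ℤ.* k) ℤ.* q
      lem₃ = solve-∀
    from-bézout : (∃ λ x → ∃ λ y → x ℤ.* + q ℤ.+ y ℤ.* + t ≡ 1ℤ) → ∃ λ i → i < q × + q ℤ∣.∣ n ℤ.- + (t ℕ.* i)
    -- y inverts t modulo q, so t i ≡ n is solved by the residue i of n y.
    from-bézout (x , y , e) = (n ℤ.* y) %ℕ q , n%ℕd<d (n ℤ.* y) q ,
      ℤ∣.divides (n ℤ.* x ℤ.+ + t ℤ.* ((n ℤ.* y) /ℕ q)) (trans (cong (λ w → n ℤ.- w) (ℤₚ.pos-* t ((n ℤ.* y) %ℕ q)))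
        (witness n x y (+ q) (+ t) (+ ((n ℤ.* y) %ℕ q)) ((n ℤ.* y) /ℕ q) e (a≡a%ℕn+[a/ℕn]*n (n ℤ.* y) q)))

  congruent-hits : ∀ {n i j} → + q ℤ∣.∣ n ℤ.- + (t ℕ.* i) → + q ℤ∣.∣ n ℤ.- + (t ℕ.* j) → Congruent q j i
  congruent-hits {n} {i} {j} d d′ = ℤ∣.∣ᵤ⇒∣ (coprime-divisor c (subst (q ℕ∣.∣_) (ℤₚ.abs-* (+ t) (+ j ℤ.- + i))
    (ℤ∣.∣⇒∣ᵤ (subst (+ q ℤ∣.∣_) eq (ℤ∣.∣m∣n⇒∣m-n d d′)))))
    where
    lem : ∀ n t i j → (n ℤ.- t ℤ.* i) ℤ.- (n ℤ.- t ℤ.* j) ≡ t ℤ.* (j ℤ.- i)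
    lem = solve-∀
    eq : (n ℤ.- + (t ℕ.* i)) ℤ.- (n ℤ.- + (t ℕ.* j)) ≡ + t ℤ.* (+ j ℤ.- + i)
    eq = trans (cong₂ (λ v w → (n ℤ.- v) ℤ.- (n ℤ.- w)) (ℤₚ.pos-* t i) (ℤₚ.pos-* t j)) (lem n (+ t) (+ i) (+ j))

  bounded-sparse : .{{_ : NonZero q}} → ∀ {h} k → k ≤ q → Bounded h s → Bounded h (conv (geom k (X ^ₚ t)) s)
  bounded-sparse {h} k k≤q b n = at-hit (hit n)
    where
    at-hit : (∃ λ i → i < q × + q ℤ∣.∣ n ℤ.- + (t ℕ.* i)) → ∣ conv (geom k (X ^ₚ t)) s n ∣ ≤ h
    at-hit (i , i<q , d) with i ℕ.<? k
    ... | yes i<k = subst (λ z → ∣ z ∣ ≤ h) (sym (conv-geom-hit k i n k≤q i<k d)) (b (n ℤ.- + (t ℕ.* i)))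
    ... | no i≮k  = subst (λ z → ∣ z ∣ ≤ h) (sym (conv-geom-zero k n miss)) z≤n
      where
      miss : ∀ j → j < k → ¬ (+ q ℤ∣.∣ n ℤ.- + (t ℕ.* j))
      miss j j<k d′ = i≮k (subst (_< k) (congruent-<⇒≡ q (ℕₚ.<-≤-trans j<k k≤q) i<q (congruent-hits {n} {i} {j} d d′)) j<k)

∣u∣+∣v∣≤ : ∀ {p} u v → ∣ u ℤ.+ v ∣ ≤ p → ∣ u ℤ.- v ∣ ≤ p → ∣ u ∣ ℕ.+ ∣ v ∣ ≤ p
∣u∣+∣v∣≤ (+ a)      (+ b)      x y = x
∣u∣+∣v∣≤ (+ a)      -[1+ b ]   x y = y
∣u∣+∣v∣≤ {p} -[1+ a ]   (+ zero)   x y = subst (_≤ p) (sym (ℕₚ.+-identityʳ (suc a))) x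
∣u∣+∣v∣≤ {p} -[1+ a ]   (+ suc b)  x y = subst (_≤ p) (cong suc (sym (ℕₚ.+-suc a b))) y
∣u∣+∣v∣≤ {p} -[1+ a ]   -[1+ b ]   x y = subst (_≤ p) (cong suc (sym (ℕₚ.+-suc a b))) x

-- One step of length q changes Z by a value of s, hence by at most h, and ∣ c ∣ such steps join the
-- two arguments.
lipschitz : ∀ {h q} {s : Seq} (Z : Seq) → (∀ n → Z (n ℤ.- + q) ℤ.- Z n ≡ s n) → Bounded h s →
  ∀ m c → ∣ Z (m ℤ.+ c ℤ.* + q) ℤ.- Z m ∣ ≤ ∣ c ∣ ℕ.* h
lipschitz {h} {q} {s} Z ΔZ b = go
  where
  back : ∀ m k → ∣ Z (m ℤ.- + k ℤ.* + q) ℤ.- Z m ∣ ≤ k ℕ.* h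
  back m zero = subst (λ w → ∣ w ∣ ≤ 0) (sym (trans (cong (λ w → Z w ℤ.- Z m) (lem m (+ q))) (ℤₚ.+-inverseʳ (Z m)))) z≤n
    where
    lem : ∀ m q → m ℤ.- 0ℤ ℤ.* q ≡ m
    lem = solve-∀
  back m (suc k) = begin
    ∣ Z (m ℤ.- + suc k ℤ.* + q) ℤ.- Z m ∣                              ≡⟨ cong ∣_∣ (trans (cong (λ w → Z w ℤ.- Z m) (lem₁ m (+ k) (+ q))) (lem₂ (Z (m′ ℤ.- + q)) (Z m′) (Z m))) ⟩
    ∣ (Z (m′ ℤ.- + q) ℤ.- Z m′) ℤ.+ (Z m′ ℤ.- Z m) ∣                   ≤⟨ ℤₚ.∣i+j∣≤∣i∣+∣j∣ (Z (m′ ℤ.- + q) ℤ.- Z m′) (Z m′ ℤ.- Z m) ⟩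
    ∣ Z (m′ ℤ.- + q) ℤ.- Z m′ ∣ ℕ.+ ∣ Z m′ ℤ.- Z m ∣                   ≤⟨ ℕₚ.+-mono-≤ (subst (λ w → ∣ w ∣ ≤ h) (sym (ΔZ m′)) (b m′)) (back m k) ⟩
    h ℕ.+ k ℕ.* h ∎
    where
    open ℕₚ.≤-Reasoning
    m′ = m ℤ.- + k ℤ.* + q
    lem₁ : ∀ m k q → m ℤ.- (1ℤ ℤ.+ k) ℤ.* q ≡ m ℤ.- k ℤ.* q ℤ.- q
    lem₁ = solve-∀
    lem₂ : ∀ a b c → a ℤ.- c ≡ (a ℤ.- b) ℤ.+ (b ℤ.- c)
    lem₂ = solve-∀
  go : ∀ m c → ∣ Z (m ℤ.+ c ℤ.* + q) ℤ.- Z m ∣ ≤ ∣ c ∣ ℕ.* h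
  go m -[1+ k ] = subst (λ w → ∣ Z w ℤ.- Z m ∣ ≤ suc k ℕ.* h) (cong (ℤ._+_ m) (ℤₚ.neg-distribˡ-* (+ suc k) (+ q))) (back m (suc k))
  go m (+ k) = subst (_≤ k ℕ.* h) (trans (cong (λ w → ∣ Z w ℤ.- Z m′ ∣) (lem m (+ k) (+ q))) (ℤₚ.∣i-j∣≡∣j-i∣ (Z m) (Z m′))) (back m′ k)
    where
    m′ = m ℤ.+ + k ℤ.* + q
    lem : ∀ m k q → (m ℤ.+ k ℤ.* q) ℤ.- k ℤ.* q ≡ m
    lem = solve-∀

-- The factors x - 1, Φ_p, Φ_q, Φ_pq and the decomposition of a divisor

optional : Bool → Poly → Poly
optional true  Y = Y
optional false Y = con 1ℤ

X¹^ : ∀ k → (X ^ₚ 1) ^ₚ k ≈ X ^ₚ k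
X¹^ k = ^-congˡ k (R.*-identityʳ X)

coeff-geom-zero : ∀ k t .{{_ : NonZero t}} → coeff (geom (suc k) (X ^ₚ t)) 0 ≡ 1ℤ
coeff-geom-zero k t = trans (coeff-⊕ (con 1ℤ) (X ^ₚ t ⊗ geom k (X ^ₚ t)) 0)
  (cong (ℤ._+_ 1ℤ) (coeff-X^⊗-< t (geom k (X ^ₚ t)) 0 (ℕ.>-nonZero⁻¹ t)))

coeff-geom-one : ∀ k → coeff (geom (suc (suc k)) (X ^ₚ 1)) 1 ≡ 1ℤ
coeff-geom-one k = trans (coeff-⊕ (con 1ℤ) (X ^ₚ 1 ⊗ geom (suc k) (X ^ₚ 1)) 1)
  (trans (ℤₚ.+-identityˡ _) (trans (coeff-X^⊗-≥ 1 (geom (suc k) (X ^ₚ 1)) 0) (coeff-geom-zero k 1)))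

coeff-geom-one-> : ∀ k t → 1 < t → coeff (geom k (X ^ₚ t)) 1 ≡ 0ℤ
coeff-geom-one-> zero    t 1<t = refl
coeff-geom-one-> (suc k) t 1<t = trans (coeff-⊕ (con 1ℤ) (X ^ₚ t ⊗ geom k (X ^ₚ t)) 1)
  (trans (ℤₚ.+-identityˡ _) (coeff-X^⊗-< t (geom k (X ^ₚ t)) 1 1<t))

module Cyclotomic {p q : ℕ} (pp : Prime p) (qp : Prime q) (p<q : p < q) (b-1 : ℕ) where

  open Split pp qp p<q (suc b-1) public

  r = p ℕ.* q

  p⊥q : Coprime p q
  p⊥q = prime∤⇒coprime pp p∤q

  1<p : 1 < p
  1<p = ℕ.nonTrivial⇒n>1 p {{prime⇒nonTrivial pp}}

  1<q : 1 < q
  1<q = ℕₚ.<-trans 1<p p<q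

  -- In this order: x - 1, Φ_p, Φ_q, Φ_q(x^p), Φ_p(x^q), Φ_pq and (x^n - 1) / (x^(pq) - 1), with
  -- Φ_pq taken as the cofactor of Φ_p(x) in Φ_p(x^q). Writing `X ^ₚ 1` lets the lemmas about
  -- `geom k (X ^ₚ t)` apply with t = 1.
  A D F T Dq Φ W : Poly
  A = X ^ₚ 1 ⊖ con 1ℤ
  D = geom p (X ^ₚ 1)
  F = geom q (X ^ₚ 1)
  T = geom q (X ^ₚ p)
  Dq = geom p (X ^ₚ q)
  Φ = proj₁ (geom-∣ p q (X ^ₚ 1) p⊥q)
  W = geom (q ℕ.^ b-1) (X ^ₚ r)

  AD : A ⊗ D ≈ X ^ₚ p ⊖ con 1ℤ
  AD = ≈-trans (telescope p (X ^ₚ 1)) (R.+-congʳ (X¹^ p))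

  AF : A ⊗ F ≈ X ^ₚ q ⊖ con 1ℤ
  AF = ≈-trans (telescope q (X ^ₚ 1)) (R.+-congʳ (X¹^ q))

  DΦ : D ⊗ Φ ≈ Dq
  DΦ = ≈-trans (proj₂ (geom-∣ p q (X ^ₚ 1) p⊥q)) (geom-cong p (X¹^ q))

  -- D T and F Φ_p(x^q) are both 1 + x + ... + x^(pq-1), and Φ_p(x^q) = D Φ; then D cancels.
  FΦ : F ⊗ Φ ≈ T
  FΦ = *-cancelˡ D (unitConstant-∣ (∣-respʳ AD (f∣g*f D A)) (X^n-1-unitConstant p)) (begin
    D ⊗ (F ⊗ Φ)                ≈⟨ lem D F Φ ⟩
    F ⊗ (D ⊗ Φ)                ≈⟨ R.*-congˡ (proj₂ (geom-∣ p q (X ^ₚ 1) p⊥q)) ⟩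
    F ⊗ geom p ((X ^ₚ 1) ^ₚ q)   ≈⟨ ≈-sym (geom-* q p (X ^ₚ 1)) ⟩
    geom (q ℕ.* p) (X ^ₚ 1)     ≡⟨ cong (λ z → geom z (X ^ₚ 1)) (ℕₚ.*-comm q p) ⟩
    geom (p ℕ.* q) (X ^ₚ 1)     ≈⟨ geom-* p q (X ^ₚ 1) ⟩
    D ⊗ geom q ((X ^ₚ 1) ^ₚ p)   ≈⟨ R.*-congˡ (geom-cong q (X¹^ p)) ⟩
    D ⊗ T ∎)
    where
    open ≈-Reasoning
    opaque
      unfolding _⊕_
      lem : ∀ a b c → a ⊗ (b ⊗ c) ≈ b ⊗ (a ⊗ c)
      lem = solve-∀-in polyACR

  X^r-1 : X^n-1 r ≈ (A ⊗ D) ⊗ (F ⊗ Φ)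
  X^r-1 = begin
    X ^ₚ r ⊖ con 1ℤ                 ≈⟨ R.+-congʳ (≈-sym (^-assocʳ X p q)) ⟩
    (X ^ₚ p) ^ₚ q ⊖ con 1ℤ           ≈⟨ ≈-sym (telescope q (X ^ₚ p)) ⟩
    (X ^ₚ p ⊖ con 1ℤ) ⊗ T           ≈⟨ R.*-cong (≈-sym AD) (≈-sym FΦ) ⟩
    (A ⊗ D) ⊗ (F ⊗ Φ) ∎
    where open ≈-Reasoning

  X^n-1-W : X^n-1 r ⊗ W ≈ X^n-1 n
  X^n-1-W = ≈-trans (telescope (q ℕ.^ b-1) (X ^ₚ r)) (R.+-congʳ (≈-trans (^-assocʳ X r (q ℕ.^ b-1))
    (≈-reflexive (cong (X ^ₚ_) (ℕₚ.*-assoc p q (q ℕ.^ b-1))))))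

  factorisation : A ⊗ (D ⊗ (F ⊗ (Φ ⊗ W))) ≈ X^n-1 n
  factorisation = ≈-trans (lem A D F Φ W) (≈-trans (R.*-congʳ (≈-sym X^r-1)) X^n-1-W)
    where
    opaque
      unfolding _⊕_
      lem : ∀ a d f φ w → a ⊗ (d ⊗ (f ⊗ (φ ⊗ w))) ≈ ((a ⊗ d) ⊗ (f ⊗ φ)) ⊗ w
      lem = solve-∀-in polyACR

  1≢0 : 1ℤ ≢ 0ℤ
  1≢0 ()

  geom-nonconstant : ∀ k → 1 < k → coeff (geom k (X ^ₚ 1)) 1 ≡ 1ℤ
  geom-nonconstant (suc (suc k)) _ = coeff-geom-one k
  geom-nonconstant (suc zero) (s≤s ())

  geom-constant : ∀ k t .{{_ : NonZero t}} → 1 < k → coeff (geom k (X ^ₚ t)) 0 ≡ 1ℤ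
  geom-constant (suc k) t _ = coeff-geom-zero k t

  A-rational : Rational A
  A-rational = record
    { divides = _ , factorisation
    ; nonconstant = λ e → 1≢0 (trans (sym A₁) e)
    ; at-p = inj₁ (D , AD)
    ; at-q = inj₁ (F , AF) }
    where
    A₁ : coeff A 1 ≡ 1ℤ
    A₁ = trans (coeff-⊕ (X ^ₚ 1) (⊝ con 1ℤ) 1) (cong₂ ℤ._+_ (at (R.*-identityʳ X) 1) (coeff-⊝ (con 1ℤ) 1))

  D-rational : Rational D
  D-rational = record
    { divides = ∣-trans (f∣f*g D _) (∣-respʳ factorisation (f∣g*f _ A))
    ; nonconstant = λ e → 1≢0 (trans (sym (geom-nonconstant p 1<p)) e)
    ; at-p = inj₁ (∣-respʳ AD (f∣g*f D A))
    ; at-q = inj₂ (Φ , DΦ) }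

  F-rational : Rational F
  F-rational = record
    { divides = ∣-trans (f∣f*g F (Φ ⊗ W)) (∣-trans (f∣g*f _ D) (∣-respʳ factorisation (f∣g*f _ A)))
    ; nonconstant = λ e → 1≢0 (trans (sym (geom-nonconstant q 1<q)) e)
    ; at-p = inj₂ (Φ , FΦ)
    ; at-q = inj₁ (∣-respʳ AF (f∣g*f F A)) }

  Φ-rational : Rational Φ
  Φ-rational = record
    { divides = ∣-trans (∣-trans (f∣f*g Φ W) (f∣g*f _ F)) (∣-trans (f∣g*f _ D) (∣-respʳ factorisation (f∣g*f _ A)))
    -- As q > 1, the coefficients of 1 and x in D Φ = Φ_p(x^q) show that Φ has constant term 1 and
    -- coefficient -1 at x.
    ; nonconstant = λ e → 1≢0 (trans (sym Φ₀≡1) (trans (sym (trans (cong (λ w → w ℤ.+ coeff Φ 0) e) (ℤₚ.+-identityˡ (coeff Φ 0)))) Φ₁+Φ₀))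
    ; at-p = inj₂ (∣-respʳ FΦ (f∣g*f Φ F))
    ; at-q = inj₂ (∣-respʳ DΦ (f∣g*f Φ D)) }
    where
    Φ₀≡1 : coeff Φ 0 ≡ 1ℤ
    Φ₀≡1 = trans (sym (trans (cong (ℤ._* coeff Φ 0) (geom-constant p 1 1<p)) (ℤₚ.*-identityˡ (coeff Φ 0))))
      (trans (sym (coeff-⊗-zero D Φ)) (trans (at DΦ 0) (geom-constant p q 1<p)))
    Φ₁+Φ₀ : coeff Φ 1 ℤ.+ coeff Φ 0 ≡ 0ℤ
    Φ₁+Φ₀ = trans (sym (cong₂ ℤ._+_ (trans (cong (ℤ._* coeff Φ 1) (geom-constant p 1 1<p)) (ℤₚ.*-identityˡ (coeff Φ 1)))
        (trans (cong (ℤ._* coeff Φ 0) (geom-nonconstant p 1<p)) (ℤₚ.*-identityˡ (coeff Φ 0)))))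
      (trans (sym (coeff-⊗-1 D Φ)) (trans (at DΦ 1) (coeff-geom-one-> p q 1<q)))

  peel : ∀ {Y r t f g} → Rational Y → f ⊗ g ≈ Y ⊗ r → (Y ⊗ r) ⊗ t ≈ X^n-1 n →
    ∃ λ a → ∃ λ f′ → ∃ λ g′ → f ≈ optional a Y ⊗ f′ × f′ ⊗ g′ ≈ r
  peel {Y} {r} {t} {f} {g} Yr e e′ = [ (λ (f′ , x , y) → true , f′ , g , x , y) ,
    (λ (g′ , x , y) → false , f , g′ , ≈-sym (R.*-identityˡ f) , y) ]′ (strip Yr e e′)

  part : Bool → Bool → Bool → Bool → Poly
  part a d e c = (optional a A ⊗ optional d D) ⊗ (optional e F ⊗ optional c Φ)

  decompose : ∀ {f g} → f ⊗ g ≈ X^n-1 n →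
    ∃ λ a → ∃ λ d → ∃ λ e → ∃ λ c → ∃ λ f₁ → ∃ λ g₁ → f ≈ part a d e c ⊗ f₁ × f₁ ⊗ g₁ ≈ W
  decompose {f} {g} fg =
    let a , f₁ , g₁ , e₁ , h₁ = peel {t = con 1ℤ} A-rational (≈-trans fg (≈-sym factorisation)) (≈-trans (R.*-identityʳ _) factorisation)
        d , f₂ , g₂ , e₂ , h₂ = peel {t = A} D-rational h₁ (≈-trans (R.*-comm _ A) factorisation)
        e , f₃ , g₃ , e₃ , h₃ = peel {t = A ⊗ D} F-rational h₂ (≈-trans (lem₃ A D (F ⊗ (Φ ⊗ W))) factorisation)
        c , f₄ , g₄ , e₄ , h₄ = peel {t = A ⊗ (D ⊗ F)} Φ-rational h₃ (≈-trans (lem₄ A D F (Φ ⊗ W)) factorisation)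
    in a , d , e , c , f₄ , g₄ ,
      ≈-trans e₁ (≈-trans (R.*-congˡ (≈-trans e₂ (R.*-congˡ (≈-trans e₃ (R.*-congˡ e₄)))))
        (lem (optional a A) (optional d D) (optional e F) (optional c Φ) f₄)) , h₄
    where
    opaque
      unfolding _⊕_
      lem₃ : ∀ a d w → w ⊗ (a ⊗ d) ≈ a ⊗ (d ⊗ w)
      lem₃ = solve-∀-in polyACR
      lem₄ : ∀ a d f w → w ⊗ (a ⊗ (d ⊗ f)) ≈ a ⊗ (d ⊗ (f ⊗ w))
      lem₄ = solve-∀-in polyACR
      lem : ∀ a d f φ w → a ⊗ (d ⊗ (f ⊗ (φ ⊗ w))) ≈ ((a ⊗ d) ⊗ (f ⊗ φ)) ⊗ w
      lem = solve-∀-in polyACR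

-- The power series 1 / (X^q - 1).
step : ℕ → Seq
step q (+ m) with q ℕ∣.∣? m
... | yes _ = -1ℤ
... | no _  = 0ℤ
step q -[1+ m ] = 0ℤ

step-∤ : ∀ q m → ¬ (q ℕ∣.∣ m) → step q (+ m) ≡ 0ℤ
step-∤ q m q∤m with q ℕ∣.∣? m
... | yes d = ⊥-elim (q∤m d)
... | no _  = refl

step-∣ : ∀ q m → q ℕ∣.∣ m → step q (+ m) ≡ -1ℤ
step-∣ q m d with q ℕ∣.∣? m
... | yes _ = refl
... | no q∤m = ⊥-elim (q∤m d)

supported-step : ∀ q → Supported q (step q)
supported-step q (+ m)    q∤m = step-∤ q m (q∤m ∘ ℤ∣.∣ᵤ⇒∣)
supported-step q -[1+ m ] _   = refl

step-negative : ∀ q m k → m < k → step q (+ m ℤ.- + k) ≡ 0ℤ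
step-negative q m k m<k = trans (cong (step q) (trans (ℤₚ.m-n≡m⊖n m k) (trans (ℤₚ.⊖-< m<k) (cong (λ w → ℤ.- + w) (sym (ℕₚ.suc-pred (k ℕ.∸ m) {{ℕ.>-nonZero (ℕₚ.m<n⇒0<n∸m m<k)}})))))) refl

step-difference : ∀ q .{{_ : NonZero q}} n → step q (n ℤ.- + q) ℤ.- step q n ≡ unit n
step-difference q@(suc q-1) -[1+ m ] = refl
step-difference q@(suc _) (+ m) with q ℕ.≤? m
step-difference q@(suc _) (+ zero) | no m<q = cong₂ ℤ._-_ (step-negative q 0 q (s≤s z≤n)) (step-∣ q 0 (q ℕ∣.∣0))
step-difference q@(suc _) (+ suc m) | no m≱q = cong₂ ℤ._-_ (step-negative q (suc m) q (ℕₚ.≰⇒> m≱q)) (step-∤ q (suc m) (λ d → m≱q (ℕ∣.∣⇒≤ d)))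
step-difference q@(suc q-1) (+ m@(suc _)) | yes q≤m = trans (cong (λ w → step q w ℤ.- step q (+ m)) (trans (ℤₚ.m-n≡m⊖n m q) (ℤₚ.⊖-≥ q≤m)))
  (trans (cong (ℤ._- step q (+ m)) same) (ℤₚ.+-inverseʳ (step q (+ m))))
  where
  m∸q+q : m ℕ.∸ q ℕ.+ q ≡ m
  m∸q+q = ℕₚ.m∸n+n≡m q≤m
  same : step q (+ (m ℕ.∸ q)) ≡ step q (+ m)
  same with q ℕ∣.∣? m
  ... | yes d = step-∣ q (m ℕ.∸ q) (ℕ∣.∣m+n∣m⇒∣n (subst (q ℕ∣.∣_) (sym (trans (ℕₚ.+-comm q _) m∸q+q)) d) ℕ∣.∣-refl)
  ... | no q∤m = step-∤ q (m ℕ.∸ q) (λ d → q∤m (subst (q ℕ∣.∣_) m∸q+q (ℕ∣.∣m∣n⇒∣m+n d ℕ∣.∣-refl)))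

-- The bound p H(V) for the sixteen products

module Bounds {p q : ℕ} (pp : Prime p) (qp : Prime q) (p<q : p < q) (b-1 : ℕ) (V : Poly) (h : ℕ) where

  open Cyclotomic pp qp p<q b-1

  private
    V′ = V ∘ₚ (X ^ₚ q)

    -- `s` lists the coefficients of V(x^q) and `Z` those of V(x^q) / (x^q - 1). Since Φ_pq (x^q -
    -- 1) = (x - 1) Φ_q(x^p), the coefficients of Φ_pq V(x^q) are `conv A (conv T Z)`, in which T
    -- picks out single values of Z.
    s Z : Seq
    s = conv V′ unit
    Z = conv V′ (step q)

  module _ (b : Bounded h s) where

    S : Supported q s
    S = supported-conv V (supported-unit q)

    ZS : Supported q Z
    ZS = supported-conv V (supported-step q)

    s≡ : ∀ n → s n ≡ conv (X ^ₚ q ⊖ con 1ℤ) Z n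
    s≡ n = begin
      conv V′ unit n                                        ≡⟨ conv-congʳ V′ (λ m → sym (trans (conv-X^-1 q (step q) m) (step-difference q m))) n ⟩
      conv V′ (conv (X ^ₚ q ⊖ con 1ℤ) (step q)) n            ≡⟨ sym (conv-⊗ V′ (X ^ₚ q ⊖ con 1ℤ) (step q) n) ⟩
      conv (V′ ⊗ (X ^ₚ q ⊖ con 1ℤ)) (step q) n               ≡⟨ conv-congˡ _ _ (step q) n (R.*-comm V′ _) ⟩
      conv ((X ^ₚ q ⊖ con 1ℤ) ⊗ V′) (step q) n               ≡⟨ conv-⊗ (X ^ₚ q ⊖ con 1ℤ) V′ (step q) n ⟩
      conv (X ^ₚ q ⊖ con 1ℤ) Z n ∎
      where open ≡-Reasoning

    Z-lipschitz : ∀ m c → ∣ Z (m ℤ.+ c ℤ.* + q) ℤ.- Z m ∣ ≤ ∣ c ∣ ℕ.* h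
    Z-lipschitz = lipschitz Z (λ n → trans (sym (conv-X^-1 q Z n)) (sym (s≡ n))) b

    G : Seq
    G = conv T Z

    module SparseZ = Sparse {q} {p} (Coprimality.sym p⊥q) {Z} ZS

    index : ℤ → ℕ
    index n = proj₁ (SparseZ.hit n)

    index<q : ∀ n → index n < q
    index<q n = proj₁ (proj₂ (SparseZ.hit n))

    -- The only multiple of q among the numbers n - p i with 0 ≤ i < q. Since Z lives on multiples
    -- of q, only this term of `G n` can be nonzero.
    position : ℤ → ℤ
    position n = n ℤ.- + (p ℕ.* index n)

    q∣position : ∀ n → + q ℤ∣.∣ position n
    q∣position n = proj₂ (proj₂ (SparseZ.hit n))

    G≡ : ∀ n → G n ≡ Z (position n)
    G≡ n = SparseZ.conv-geom-hit q (index n) n ℕₚ.≤-refl (index<q n) (q∣position n)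

    gap : ∀ {i j} k → i < q → j < q → k ≤ p → ∣ (ℤ.- + k) ℤ.+ + p ℤ.* (+ i ℤ.- + j) ∣ ≤ p ℕ.* q
    gap {i} {j} k i<q j<q k≤p = begin
      ∣ (ℤ.- + k) ℤ.+ + p ℤ.* (+ i ℤ.- + j) ∣           ≤⟨ ℤₚ.∣i+j∣≤∣i∣+∣j∣ (ℤ.- + k) _ ⟩
      ∣ ℤ.- + k ∣ ℕ.+ ∣ + p ℤ.* (+ i ℤ.- + j) ∣          ≡⟨ cong₂ ℕ._+_ (ℤₚ.∣-i∣≡∣i∣ (+ k)) (ℤₚ.abs-* (+ p) (+ i ℤ.- + j)) ⟩
      k ℕ.+ p ℕ.* ∣ + i ℤ.- + j ∣                        ≤⟨ ℕₚ.+-monoˡ-≤ _ k≤p ⟩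
      p ℕ.+ p ℕ.* ∣ + i ℤ.- + j ∣                        ≡⟨ sym (ℕₚ.*-suc p _) ⟩
      p ℕ.* suc ∣ + i ℤ.- + j ∣                          ≤⟨ ℕₚ.*-monoʳ-≤ p (difference<q i j i<q j<q) ⟩
      p ℕ.* q ∎
      where
      open ℕₚ.≤-Reasoning
      difference<q : ∀ i j → i < q → j < q → ∣ + i ℤ.- + j ∣ < q
      difference<q i j i<q j<q = ℕₚ.≤-<-trans (subst (λ w → ∣ w ∣ ≤ i ℕ.⊔ j) (sym (ℤₚ.m-n≡m⊖n i j)) (ℤₚ.∣m⊝n∣≤m⊔n i j)) (ℕₚ.⊔-lub i<q j<q)

    -- Two indices differ by at most q - 1, so the positions differ by at most k + p (q - 1) ≤ p q.
    position-gap : ∀ k n → k ≤ p → ∣ position (n ℤ.- + k) ℤ.- position n ∣ ≤ p ℕ.* q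
    position-gap k n k≤p = subst (λ w → ∣ w ∣ ≤ p ℕ.* q) (sym eq) (gap k (index<q n) (index<q (n ℤ.- + k)) k≤p)
      where
      lem : ∀ n k p i j → (n ℤ.- k ℤ.- p ℤ.* j) ℤ.- (n ℤ.- p ℤ.* i) ≡ (ℤ.- k) ℤ.+ p ℤ.* (i ℤ.- j)
      lem = solve-∀
      eq : position (n ℤ.- + k) ℤ.- position n ≡ (ℤ.- + k) ℤ.+ + p ℤ.* (+ index n ℤ.- + index (n ℤ.- + k))
      eq = trans (cong₂ (λ v w → (n ℤ.- + k ℤ.- v) ℤ.- (n ℤ.- w)) (ℤₚ.pos-* p (index (n ℤ.- + k))) (ℤₚ.pos-* p (index n)))
        (lem n (+ k) (+ p) (+ index n) (+ index (n ℤ.- + k)))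

    *q-cancel-≤ : ∀ c m → ∣ c ℤ.* + q ∣ ≤ m ℕ.* q → ∣ c ∣ ≤ m
    *q-cancel-≤ c m le = ℕₚ.*-cancelʳ-≤ ∣ c ∣ m q (subst (_≤ m ℕ.* q) (ℤₚ.abs-* c (+ q)) le)

    G-step : ∀ n → conv A G n ≡ G (n ℤ.- 1ℤ) ℤ.- G n
    G-step n = conv-X^-1 1 G n

    Z-difference : ∀ {x y} c → y ℤ.- x ≡ c ℤ.* + q → ∣ Z y ℤ.- Z x ∣ ≤ ∣ c ∣ ℕ.* h
    Z-difference {x} {y} c e = subst (λ w → ∣ Z w ℤ.- Z x ∣ ≤ ∣ c ∣ ℕ.* h)
      (trans (cong (ℤ._+_ x) (sym e)) (lem x y)) (Z-lipschitz x c)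
      where
      lem : ∀ x y → x ℤ.+ (y ℤ.- x) ≡ y
      lem = solve-∀

    -- The positions of n - 1 and n differ by c q with ∣ c ∣ ≤ p, and Z changes by at most h for
    -- each step of length q.
    bounded-AG : Bounded (p ℕ.* h) (conv A G)
    bounded-AG n = from (ℤ∣.∣m∣n⇒∣m-n (q∣position (n ℤ.- 1ℤ)) (q∣position n))
      where
      open ℕₚ.≤-Reasoning
      from : + q ℤ∣.∣ position (n ℤ.- 1ℤ) ℤ.- position n → ∣ conv A G n ∣ ≤ p ℕ.* h
      from (ℤ∣.divides c e) = begin
        ∣ conv A G n ∣                                   ≡⟨ cong ∣_∣ (trans (G-step n) (cong₂ ℤ._-_ (G≡ (n ℤ.- 1ℤ)) (G≡ n))) ⟩
        ∣ Z (position (n ℤ.- 1ℤ)) ℤ.- Z (position n) ∣   ≤⟨ Z-difference c e ⟩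
        ∣ c ∣ ℕ.* h                                      ≤⟨ ℕₚ.*-monoˡ-≤ h (*q-cancel-≤ c p (subst (λ w → ∣ w ∣ ≤ p ℕ.* q) e (position-gap 1 n (ℕₚ.<⇒≤ 1<p)))) ⟩
        p ℕ.* h ∎

    -- By size alone ∣ κ ∣ < 2 q, which only gives ∣ c ∣ < 2 p. But q divides p κ and hence κ, so κ
    -- is 0 or ±q and c is 0 or ±p.
    second-difference-small : ∀ {i₀ i₁ i₂} c → i₀ < q → i₁ < q → i₂ < q →
      c ℤ.* + q ≡ ℤ.- (+ p ℤ.* (+ i₂ ℤ.+ + i₀ ℤ.- (+ i₁ ℤ.+ + i₁))) → ∣ c ∣ ≤ p
    second-difference-small {i₀} {i₁} {i₂} c i₀< i₁< i₂< e = from (ℤ∣.∣ᵤ⇒∣ (coprime-divisor (Coprimality.sym p⊥q)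
        (subst (q ℕ∣.∣_) (ℤₚ.abs-* (+ p) κ) (ℤ∣.∣⇒∣ᵤ (ℤ∣.divides (ℤ.- c) pκ)))))
      where
      κ = + i₂ ℤ.+ + i₀ ℤ.- (+ i₁ ℤ.+ + i₁)
      pκ : + p ℤ.* κ ≡ (ℤ.- c) ℤ.* + q
      pκ = trans (sym (ℤₚ.neg-involutive (+ p ℤ.* κ))) (trans (cong ℤ.-_ (sym e)) (ℤₚ.neg-distribˡ-* c (+ q)))
      ∣κ∣< : ∣ κ ∣ < 2 ℕ.* q
      ∣κ∣< = ℕₚ.≤-<-trans (subst (λ w → ∣ w ∣ ≤ (i₂ ℕ.+ i₀) ℕ.⊔ (i₁ ℕ.+ i₁)) (sym (ℤₚ.m-n≡m⊖n (i₂ ℕ.+ i₀) (i₁ ℕ.+ i₁))) (ℤₚ.∣m⊝n∣≤m⊔n (i₂ ℕ.+ i₀) (i₁ ℕ.+ i₁)))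
        (subst (((i₂ ℕ.+ i₀) ℕ.⊔ (i₁ ℕ.+ i₁)) <_) (cong (q ℕ.+_) (sym (ℕₚ.+-identityʳ q))) (ℕₚ.⊔-lub (ℕₚ.+-mono-< i₂< i₀<) (ℕₚ.+-mono-< i₁< i₁<)))
      from : + q ℤ∣.∣ κ → ∣ c ∣ ≤ p
      from (ℤ∣.divides e′ κ≡) = begin
        ∣ c ∣                      ≡⟨ cong ∣_∣ (ℤₚ.*-cancelʳ-≡ c (ℤ.- (+ p ℤ.* e′)) (+ q) (trans e (trans (cong (λ w → ℤ.- (+ p ℤ.* w)) κ≡) (lem (+ p) e′ (+ q))))) ⟩
        ∣ ℤ.- (+ p ℤ.* e′) ∣       ≡⟨ trans (ℤₚ.∣-i∣≡∣i∣ (+ p ℤ.* e′)) (ℤₚ.abs-* (+ p) e′) ⟩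
        p ℕ.* ∣ e′ ∣               ≤⟨ ℕₚ.*-monoʳ-≤ p (ℕ.s≤s⁻¹ (ℕₚ.*-cancelʳ-< q ∣ e′ ∣ 2 (subst (_< 2 ℕ.* q) (trans (cong ∣_∣ κ≡) (ℤₚ.abs-* e′ (+ q))) ∣κ∣<))) ⟩
        p ℕ.* 1                    ≡⟨ ℕₚ.*-identityʳ p ⟩
        p ∎
        where
        open ℕₚ.≤-Reasoning
        lem : ∀ p e q → ℤ.- (p ℤ.* (e ℤ.* q)) ≡ (ℤ.- (p ℤ.* e)) ℤ.* q
        lem = solve-∀

    -- The steps u, v between the three positions satisfy ∣ u + v ∣ ≤ p and ∣ u - v ∣ ≤ p; since
    -- ∣ u ∣ + ∣ v ∣ is one of these, the Lipschitz bound gives p h rather than 2 p h.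
    bounded-AAG : Bounded (p ℕ.* h) (conv A (conv A G))
    bounded-AAG n = from (ℤ∣.∣m∣n⇒∣m-n (q∣position n₂) (q∣position n₁)) (ℤ∣.∣m∣n⇒∣m-n (q∣position n) (q∣position n₁))
      where
      n₁ n₂ : ℤ
      n₁ = n ℤ.- 1ℤ
      n₂ = n₁ ℤ.- 1ℤ
      i : ℤ → ℤ
      i m = + index m
      value : conv A (conv A G) n ≡ (Z (position n₂) ℤ.- Z (position n₁)) ℤ.+ (Z (position n) ℤ.- Z (position n₁))
      value = trans (conv-X^-1 1 (conv A G) n) (trans (cong₂ ℤ._-_ (G-step n₁) (G-step n))
        (trans (lem (G n₂) (G n₁) (G n)) (cong₂ ℤ._+_ (cong₂ ℤ._-_ (G≡ n₂) (G≡ n₁)) (cong₂ ℤ._-_ (G≡ n) (G≡ n₁)))))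
        where
        lem : ∀ a b c → (a ℤ.- b) ℤ.- (b ℤ.- c) ≡ (a ℤ.- b) ℤ.+ (c ℤ.- b)
        lem = solve-∀
      pos : ∀ m → position m ≡ m ℤ.- + p ℤ.* i m
      pos m = cong (λ w → m ℤ.- w) (ℤₚ.pos-* p (index m))
      sum≡ : (position n₂ ℤ.- position n₁) ℤ.+ (position n ℤ.- position n₁) ≡ ℤ.- (+ p ℤ.* (i n₂ ℤ.+ i n ℤ.- (i n₁ ℤ.+ i n₁)))
      sum≡ = trans (cong₂ ℤ._+_ (cong₂ ℤ._-_ (pos n₂) (pos n₁)) (cong₂ ℤ._-_ (pos n) (pos n₁))) (lem n (+ p) (i n₂) (i n₁) (i n))
        where
        lem : ∀ n p x y z → ((n ℤ.- 1ℤ ℤ.- 1ℤ ℤ.- p ℤ.* x) ℤ.- (n ℤ.- 1ℤ ℤ.- p ℤ.* y)) ℤ.+ ((n ℤ.- p ℤ.* z) ℤ.- (n ℤ.- 1ℤ ℤ.- p ℤ.* y))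
          ≡ ℤ.- (p ℤ.* (x ℤ.+ z ℤ.- (y ℤ.+ y)))
        lem = solve-∀
      n-2 : n ℤ.- + 2 ≡ n₂
      n-2 = lem n
        where
        lem : ∀ n → n ℤ.- + 2 ≡ n ℤ.- 1ℤ ℤ.- 1ℤ
        lem = solve-∀
      from : + q ℤ∣.∣ position n₂ ℤ.- position n₁ → + q ℤ∣.∣ position n ℤ.- position n₁ → ∣ conv A (conv A G) n ∣ ≤ p ℕ.* h
      from (ℤ∣.divides u eu) (ℤ∣.divides v ev) = begin
        ∣ conv A (conv A G) n ∣                                                                   ≡⟨ cong ∣_∣ value ⟩
        ∣ (Z (position n₂) ℤ.- Z (position n₁)) ℤ.+ (Z (position n) ℤ.- Z (position n₁)) ∣        ≤⟨ ℤₚ.∣i+j∣≤∣i∣+∣j∣ (Z (position n₂) ℤ.- Z (position n₁)) _ ⟩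
        ∣ Z (position n₂) ℤ.- Z (position n₁) ∣ ℕ.+ ∣ Z (position n) ℤ.- Z (position n₁) ∣        ≤⟨ ℕₚ.+-mono-≤ (Z-difference u eu) (Z-difference v ev) ⟩
        ∣ u ∣ ℕ.* h ℕ.+ ∣ v ∣ ℕ.* h                                                               ≡⟨ sym (ℕₚ.*-distribʳ-+ h ∣ u ∣ ∣ v ∣) ⟩
        (∣ u ∣ ℕ.+ ∣ v ∣) ℕ.* h                                                                   ≤⟨ ℕₚ.*-monoˡ-≤ h (∣u∣+∣v∣≤ u v u+v u-v) ⟩
        p ℕ.* h ∎
        where
        open ℕₚ.≤-Reasoning
        u+v : ∣ u ℤ.+ v ∣ ≤ p
        u+v = second-difference-small (u ℤ.+ v) (index<q n) (index<q n₁) (index<q n₂)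
          (trans (ℤₚ.*-distribʳ-+ (+ q) u v) (trans (sym (cong₂ ℤ._+_ eu ev)) sum≡))
        u-v : ∣ u ℤ.- v ∣ ≤ p
        -- (u - v) q is the distance between the positions of n - 2 and n, for which `position-gap`
        -- needs 2 ≤ p.
        u-v = *q-cancel-≤ (u ℤ.- v) p (subst (λ w → ∣ w ∣ ≤ p ℕ.* q) eq (position-gap 2 n 1<p))
          where
          lem₁ : ∀ a b c → a ℤ.- c ≡ (a ℤ.- b) ℤ.- (c ℤ.- b)
          lem₁ = solve-∀
          lem₂ : ∀ u v q → u ℤ.* q ℤ.- v ℤ.* q ≡ (u ℤ.- v) ℤ.* q
          lem₂ = solve-∀
          eq : position (n ℤ.- + 2) ℤ.- position n ≡ (u ℤ.- v) ℤ.* + q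
          eq = trans (cong (λ w → position w ℤ.- position n) n-2) (trans (lem₁ (position n₂) (position n₁) (position n))
            (trans (cong₂ ℤ._-_ eu ev) (lem₂ u v (+ q))))

    small : ∀ s → Bounded h s → Bounded (p ℕ.* h) s
    small s b n = ℕₚ.≤-trans (b n) (ℕₚ.m≤n*m h p)

    -- A difference doubles the bound, which the factor p absorbs because p ≥ 2.
    small-difference : ∀ s t → Bounded h s → Bounded (p ℕ.* h) (conv (X ^ₚ t ⊖ con 1ℤ) s)
    small-difference s t b n = ℕₚ.≤-trans (bounded-difference {s = s} t b n) (ℕₚ.*-monoˡ-≤ h 1<p)

    module S₁ = Sparse {q} {1} (λ (_ , d) → ℕ∣.∣1⇒≡1 d) {s} S
    module Sₚ = Sparse {q} {p} (Coprimality.sym p⊥q) {s} S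

    -- As q > 1, at most one of n - 1 and n is a multiple of q, so at most one of the two terms is
    -- nonzero.
    bounded-As : Bounded h (conv A s)
    bounded-As n = subst (λ w → ∣ w ∣ ≤ h) (sym (conv-X^-1 1 s n)) (go (+ q ℤ∣.∣? n))
      where
      go : Dec (+ q ℤ∣.∣ n) → ∣ s (n ℤ.- 1ℤ) ℤ.- s n ∣ ≤ h
      go (no q∤n) = subst (λ w → ∣ w ∣ ≤ h) (sym (trans (cong (λ w → s (n ℤ.- 1ℤ) ℤ.- w) (S n q∤n)) (ℤₚ.+-identityʳ (s (n ℤ.- 1ℤ))))) (b (n ℤ.- 1ℤ))
      go (yes q∣n) = subst (λ w → ∣ w ∣ ≤ h) (sym (trans (cong (ℤ._- s n) (S (n ℤ.- 1ℤ) q∤n-1)) (ℤₚ.+-identityˡ (ℤ.- s n))))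
        (subst (_≤ h) (sym (ℤₚ.∣-i∣≡∣i∣ (s n))) (b n))
        where
        q∤n-1 : ¬ (+ q ℤ∣.∣ n ℤ.- 1ℤ)
        q∤n-1 d = ℕₚ.<⇒≱ 1<q (ℕ∣.∣⇒≤ (ℤ∣.∣⇒∣ᵤ (subst (+ q ℤ∣.∣_) (lem n) (ℤ∣.∣m∣n⇒∣m-n q∣n d))))
          where
          lem : ∀ n → n ℤ.- (n ℤ.- 1ℤ) ≡ 1ℤ
          lem = solve-∀

    bounded-Fs : Bounded h (conv F s)
    bounded-Fs = S₁.bounded-sparse q ℕₚ.≤-refl b

    bounded-Ds : Bounded h (conv D s)
    bounded-Ds = S₁.bounded-sparse p (ℕₚ.<⇒≤ p<q) b

    bounded-Ts : Bounded h (conv T s)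
    bounded-Ts = Sₚ.bounded-sparse q ℕₚ.≤-refl b

    Φs≡AG : ∀ n → conv Φ s n ≡ conv A G n
    Φs≡AG n = begin
      conv Φ s n                                      ≡⟨ conv-congʳ Φ s≡ n ⟩
      conv Φ (conv (X ^ₚ q ⊖ con 1ℤ) Z) n              ≡⟨ sym (conv-⊗ Φ (X ^ₚ q ⊖ con 1ℤ) Z n) ⟩
      conv (Φ ⊗ (X ^ₚ q ⊖ con 1ℤ)) Z n                 ≡⟨ conv-congˡ _ _ Z n eq ⟩
      conv (A ⊗ T) Z n                                ≡⟨ conv-⊗ A T Z n ⟩
      conv A G n ∎
      where
      open ≡-Reasoning
      eq : Φ ⊗ (X ^ₚ q ⊖ con 1ℤ) ≈ A ⊗ T
      eq = ≈-trans (R.*-congˡ (≈-sym AF)) (≈-trans (lem A F Φ) (R.*-congˡ FΦ))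
        where
        opaque
          unfolding _⊕_
          lem : ∀ a f φ → φ ⊗ (a ⊗ f) ≈ a ⊗ (f ⊗ φ)
          lem = solve-∀-in polyACR

    private
      one : Poly
      one = con 1ℤ

      opaque
        unfolding _⊕_
        lem₁ : ∀ a → a ≈ (a ⊗ con 1ℤ) ⊗ (con 1ℤ ⊗ con 1ℤ)
        lem₁ = solve-∀-in polyACR
        lem₂ : ∀ a → a ≈ (con 1ℤ ⊗ a) ⊗ (con 1ℤ ⊗ con 1ℤ)
        lem₂ = solve-∀-in polyACR
        lem₃ : ∀ a → a ≈ (con 1ℤ ⊗ con 1ℤ) ⊗ (a ⊗ con 1ℤ)
        lem₃ = solve-∀-in polyACR
        lem₄ : ∀ a → a ≈ (con 1ℤ ⊗ con 1ℤ) ⊗ (con 1ℤ ⊗ a)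
        lem₄ = solve-∀-in polyACR
        lem₅ : ∀ a b → a ⊗ b ≈ (a ⊗ con 1ℤ) ⊗ (b ⊗ con 1ℤ)
        lem₅ = solve-∀-in polyACR
        lem₆ : ∀ a b → a ⊗ b ≈ (con 1ℤ ⊗ a) ⊗ (b ⊗ con 1ℤ)
        lem₆ = solve-∀-in polyACR
        lem₇ : ∀ a d f → (a ⊗ f) ⊗ d ≈ (a ⊗ d) ⊗ (f ⊗ con 1ℤ)
        lem₇ = solve-∀-in polyACR
        lem₈ : ∀ a b → a ⊗ b ≈ (a ⊗ con 1ℤ) ⊗ (con 1ℤ ⊗ b)
        lem₈ = solve-∀-in polyACR
        lem₉ : ∀ a b → a ⊗ b ≈ (con 1ℤ ⊗ a) ⊗ (con 1ℤ ⊗ b)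
        lem₉ = solve-∀-in polyACR
        lem₁₀ : ∀ a d φ → (d ⊗ φ) ⊗ a ≈ (a ⊗ d) ⊗ (con 1ℤ ⊗ φ)
        lem₁₀ = solve-∀-in polyACR
        lem₁₁ : ∀ a b → a ⊗ b ≈ (con 1ℤ ⊗ con 1ℤ) ⊗ (a ⊗ b)
        lem₁₁ = solve-∀-in polyACR
        lem₁₂ : ∀ a b c → a ⊗ (b ⊗ c) ≈ (a ⊗ con 1ℤ) ⊗ (b ⊗ c)
        lem₁₂ = solve-∀-in polyACR
        lem₁₃ : ∀ a b c → a ⊗ (b ⊗ c) ≈ (con 1ℤ ⊗ a) ⊗ (b ⊗ c)
        lem₁₃ = solve-∀-in polyACR
        lem₁₄ : ∀ a b → a ⊗ b ≈ (a ⊗ b) ⊗ (con 1ℤ ⊗ con 1ℤ)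
        lem₁₄ = solve-∀-in polyACR

    -- Each product is regrouped so that at most one factor enlarges the bound: a difference x^t - 1
    -- costs 2 ≤ p and a geometric sum of p terms costs p, whereas `A`, `D`, `F` or `T` applied
    -- directly to `s` meets at most one nonzero term and costs nothing. Only `Φ` and `A ⊗ Φ` resist
    -- this regrouping and go through `G`.
    bounded-part : ∀ a d e c → Bounded (p ℕ.* h) (conv (part a d e c) s)
    bounded-part false false false false = bounded-≈ one (part false false false false) (lem₁ one)
      (bounded-≡ (λ n → sym (trans (conv-con 1ℤ s n) (ℤₚ.*-identityˡ (s n)))) (small s b))
    bounded-part true  false false false = bounded-≈ A (part true false false false) (lem₁ A) (small (conv A s) bounded-As)
    bounded-part false true  false false = bounded-≈ D (part false true false false) (lem₂ D) (small (conv D s) bounded-Ds)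
    bounded-part true  true  false false = bounded-≈ (X ^ₚ p ⊖ one) (part true true false false) (≈-trans (≈-sym AD) (lem₁₄ A D))
      (small-difference s p b)
    bounded-part false false true  false = bounded-≈ F (part false false true false) (lem₃ F) (small (conv F s) bounded-Fs)
    bounded-part true  false true  false = bounded-≈ (X ^ₚ q ⊖ one) (part true false true false) (≈-trans (≈-sym AF) (lem₅ A F))
      (small-difference s q b)
    bounded-part false true  true  false = bounded-≈ (D ⊗ F) (part false true true false) (lem₆ D F)
      (bounded-⊗ D F (bounded-geom p 1 bounded-Fs))
    bounded-part true  true  true  false = bounded-≈ ((X ^ₚ q ⊖ one) ⊗ D) (part true true true false) (≈-trans (R.*-congʳ (≈-sym AF)) (lem₇ A D F))
      (bounded-⊗ (X ^ₚ q ⊖ one) D (small-difference (conv D s) q bounded-Ds))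
    bounded-part false false false true  = bounded-≈ Φ (part false false false true) (lem₄ Φ)
      (bounded-≡ (λ n → sym (Φs≡AG n)) bounded-AG)
    bounded-part true  false false true  = bounded-≈ (A ⊗ Φ) (part true false false true) (lem₈ A Φ)
      (bounded-⊗ A Φ (bounded-≡ (conv-congʳ A (λ n → sym (Φs≡AG n))) bounded-AAG))
    bounded-part false true  false true  = bounded-≈ Dq (part false true false true) (≈-trans (≈-sym DΦ) (lem₉ D Φ)) (bounded-geom p q b)
    bounded-part true  true  false true  = bounded-≈ (Dq ⊗ A) (part true true false true) (≈-trans (R.*-congʳ (≈-sym DΦ)) (lem₁₀ A D Φ))
      (bounded-⊗ Dq A (bounded-geom p q bounded-As))
    bounded-part false false true  true  = bounded-≈ T (part false false true true) (≈-trans (≈-sym FΦ) (lem₁₁ F Φ)) (small (conv T s) bounded-Ts)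
    bounded-part true  false true  true  = bounded-≈ (A ⊗ T) (part true false true true) (≈-trans (R.*-congˡ (≈-sym FΦ)) (lem₁₂ A F Φ))
      (bounded-⊗ A T (small-difference (conv T s) 1 bounded-Ts))
    bounded-part false true  true  true  = bounded-≈ (D ⊗ T) (part false true true true) (≈-trans (R.*-congˡ (≈-sym FΦ)) (lem₁₃ D F Φ))
      (bounded-⊗ D T (bounded-geom p 1 bounded-Ts))
    bounded-part true  true  true  true  = bounded-≈ ((X ^ₚ p ⊖ one) ⊗ T) (part true true true true) (R.*-cong (≈-sym AD) (≈-sym FΦ))
      (bounded-⊗ (X ^ₚ p ⊖ one) T (small-difference (conv T s) p bounded-Ts))

-- Heights and polynomials in x^q

coeff≤height : ∀ f k → ∣ coeff f k ∣ ≤ height f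
coeff≤height f = coeff≤ f (Allₚ.map⁻ (xs≤max 0 (map ∣_∣ f)))

height≤ : ∀ {N} f → (∀ k → ∣ coeff f k ∣ ≤ N) → height f ≤ N
height≤ f b = max≤v⁺ z≤n (Allₚ.map⁺ (coeff≤⁻ f b))

length≤⇒coeff≡0 : ∀ f i → length f ≤ i → coeff f i ≡ 0ℤ
length≤⇒coeff≡0 []      i       p       = refl
length≤⇒coeff≡0 (a ∷ f) (suc i) (s≤s p) = length≤⇒coeff≡0 f i p

coeff-∘-X^ : ∀ q .{{_ : NonZero q}} V j → coeff (V ∘ₚ (X ^ₚ q)) (j * q) ≡ coeff V j
coeff-∘-X^ q V j = trans (sym (conv-unit (V ∘ₚ (X ^ₚ q)) (j * q))) (trans (cong (conv (V ∘ₚ (X ^ₚ q)) unit) (ℤₚ.pos-* j q)) (conv-∘-unit q V (+ j)))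

coeff-∘-X^-∤ : ∀ q V i → ¬ (q ℕ∣.∣ i) → coeff (V ∘ₚ (X ^ₚ q)) i ≡ 0ℤ
coeff-∘-X^-∤ q V i q∤i = trans (sym (conv-unit (V ∘ₚ (X ^ₚ q)) i)) (supported-conv V (supported-unit q) (+ i) (q∤i ∘ ℤ∣.∣⇒∣ᵤ))

power-of-X^ : ∀ q .{{_ : NonZero q}} f → (∀ i → ¬ (q ℕ∣.∣ i) → coeff f i ≡ 0ℤ) → ∃ λ V → f ≈ V ∘ₚ (X ^ₚ q)
power-of-X^ q f z = V , ⟪ (λ i → by-cases i (q ℕ∣.∣? i)) ⟫
  where
  high : ∀ j → length f ≤ j → coeff f (j * q) ≡ 0ℤ
  high j p = length≤⇒coeff≡0 f (j * q) (ℕₚ.≤-trans p (ℕₚ.m≤m*n j q))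
  V : Poly
  V = applyUpTo (λ j → coeff f (j * q)) (length f)
  coeff-V : ∀ j → coeff V j ≡ coeff f (j * q)
  coeff-V j with j ℕ.<? length f
  ... | yes j< = coeff-applyUpTo (λ j → coeff f (j * q)) (length f) j j<
  ... | no j≮ = trans (coeff-applyUpTo-≥ (λ j → coeff f (j * q)) (length f) j (ℕₚ.≮⇒≥ j≮)) (sym (high j (ℕₚ.≮⇒≥ j≮)))
  by-cases : ∀ i → Dec (q ℕ∣.∣ i) → coeff f i ≡ coeff (V ∘ₚ (X ^ₚ q)) i
  by-cases i (no q∤i) = trans (z i q∤i) (sym (coeff-∘-X^-∤ q V i q∤i))
  by-cases .(j * q) (yes (ℕ∣.divides j refl)) = trans (sym (coeff-V j)) (sym (coeff-∘-X^ q V j))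

conv-geom-const : ∀ k t s v n → (∀ i → i < k → s (n ℤ.- + (t * i)) ≡ v) → conv (geom k (X ^ₚ t)) s n ≡ + k ℤ.* v
conv-geom-const zero    t s v n e = sym (ℤₚ.*-zeroˡ v)
conv-geom-const (suc k) t s v n e = trans (conv-geom k t s n) (trans (cong₂ ℤ._+_
    (trans (cong s (sym (trans (cong (λ w → n ℤ.- + w) (ℕₚ.*-zeroʳ t)) (ℤₚ.+-identityʳ n)))) (e 0 (s≤s z≤n)))
    (conv-geom-const k t s v (n ℤ.- + t) (λ i i<k → trans (cong s (shift i)) (e (suc i) (s≤s i<k)))))
  (distrib (+ k) v))
  where
  lem : ∀ n t w → n ℤ.- t ℤ.- w ≡ n ℤ.- (t ℤ.+ w)
  lem = solve-∀
  shift : ∀ i → n ℤ.- + t ℤ.- + (t * i) ≡ n ℤ.- + (t * suc i)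
  shift i = trans (lem n (+ t) (+ (t * i))) (cong (λ w → n ℤ.- + w) (sym (ℕₚ.*-suc t i)))
  distrib : ∀ k v → v ℤ.+ k ℤ.* v ≡ (1ℤ ℤ.+ k) ℤ.* v
  distrib = solve-∀

-- The equality B(n) = p H(V) for the V of an optimal divisor

module Main {p q : ℕ} (pp : Prime p) (qp : Prime q) (p<q : p < q) (b-1 : ℕ) where

  open Cyclotomic pp qp p<q b-1

  private
    m = B n {{pq^b-nonZero pp qp (suc b-1)}}
    optimal = B-isMaxHeight n {{pq^b-nonZero pp qp (suc b-1)}}
    f g : Poly
    f = proj₁ (proj₁ optimal)
    g = proj₁ (proj₁ (proj₂ (proj₁ optimal)))

    fg : f ⊗ g ≈ X^n-1 n
    fg = ≈-trans (≋⇒≈ (proj₂ (proj₁ (proj₂ (proj₁ optimal))))) (Xⁿ-1≈ n)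

    height-f : height f ≡ m
    height-f = proj₂ (proj₂ (proj₁ optimal))

    maximal : ∀ f g → f ⊗ g ≈ X^n-1 n → height f ≤ m
    maximal f g e = proj₂ optimal f (g , ≈⇒≋ (≈-trans e (≈-sym (Xⁿ-1≈ n))))

  module _ {f₁ g₁ V : Poly} (f₁g₁ : f₁ ⊗ g₁ ≈ W) (f₁≈ : f₁ ≈ V ∘ₚ (X ^ₚ q)) where

    s : Seq
    s = conv (V ∘ₚ (X ^ₚ q)) unit

    s-bounded : Bounded (height V) s
    s-bounded n = go (+ q ℤ∣.∣? n)
      where
      extend-bounded : ∀ j → ∣ extend V j ∣ ≤ height V
      extend-bounded (+ k)    = coeff≤height V k
      extend-bounded -[1+ k ] = z≤n
      go : Dec (+ q ℤ∣.∣ n) → ∣ s n ∣ ≤ height V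
      go (no q∤n) = subst (λ w → ∣ w ∣ ≤ height V) (sym (supported-conv V (supported-unit q) n q∤n)) z≤n
      go (yes (ℤ∣.divides j refl)) = subst (λ w → ∣ w ∣ ≤ height V) (sym (conv-∘-unit q V j)) (extend-bounded j)

    upper : ∀ a d e c → f ≈ part a d e c ⊗ f₁ → m ≤ p * height V
    upper a d e c f≈ = subst (_≤ p * height V) height-f (height≤ f λ k → subst (λ w → ∣ w ∣ ≤ p * height V) (sym (value k))
      (Bounds.bounded-part pp qp p<q b-1 V (height V) s-bounded a d e c (+ k)))
      where
      value : ∀ k → coeff f k ≡ conv (part a d e c) s (+ k)
      value k = begin
        coeff f k                                            ≡⟨ at (≈-trans f≈ (R.*-congˡ f₁≈)) k ⟩
        coeff (part a d e c ⊗ V ∘ₚ (X ^ₚ q)) k               ≡⟨ sym (conv-unit (part a d e c ⊗ V ∘ₚ (X ^ₚ q)) k) ⟩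
        conv (part a d e c ⊗ V ∘ₚ (X ^ₚ q)) unit (+ k)       ≡⟨ conv-⊗ (part a d e c) (V ∘ₚ (X ^ₚ q)) unit (+ k) ⟩
        conv (part a d e c) s (+ k) ∎
        where open ≡-Reasoning

    f* : Poly
    f* = D ⊗ (F ⊗ V ∘ₚ (X ^ₚ q))

    f*-divides : f* ⊗ (A ⊗ (Φ ⊗ g₁)) ≈ X^n-1 n
    f*-divides = ≈-trans (lem D F (V ∘ₚ (X ^ₚ q)) A Φ g₁) (≈-trans
      (R.*-congˡ {A} (R.*-congˡ {D} (R.*-congˡ {F} (R.*-congˡ {Φ} (≈-trans (R.*-congʳ (≈-sym f₁≈)) f₁g₁))))) factorisation)
      where
      opaque
        unfolding _⊕_
        lem : ∀ d f v a φ g → (d ⊗ (f ⊗ v)) ⊗ (a ⊗ (φ ⊗ g)) ≈ a ⊗ (d ⊗ (f ⊗ (φ ⊗ (v ⊗ g))))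
        lem = solve-∀-in polyACR

    -- F V(x^q) is constant on the block of exponents [j q , j q + q), which contains
    -- j q + q - 1 - i for i < p.
    coeff-f* : ∀ j → coeff f* (j * q ℕ.+ q-1) ≡ + p ℤ.* coeff V j
    coeff-f* j = begin
      coeff f* k                                     ≡⟨ sym (conv-unit f* k) ⟩
      conv f* unit (+ k)                             ≡⟨ conv-⊗ D (F ⊗ V ∘ₚ (X ^ₚ q)) unit (+ k) ⟩
      conv D (conv (F ⊗ V ∘ₚ (X ^ₚ q)) unit) (+ k)   ≡⟨ conv-congʳ D (conv-⊗ F (V ∘ₚ (X ^ₚ q)) unit) (+ k) ⟩
      conv D (conv F s) (+ k)                        ≡⟨ conv-geom-const p 1 (conv F s) (coeff V j) (+ k) (λ i i<p → block i (ℕₚ.<-trans i<p p<q)) ⟩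
      + p ℤ.* coeff V j ∎
      where
      open ≡-Reasoning
      k = j * q ℕ.+ q-1
      block : ∀ i → i < q → conv F s (+ k ℤ.- + (1 * i)) ≡ coeff V j
      -- Going back q - 1 - i from the exponent j q + q - 1 - i reaches the multiple j q of q.
      block i i<q = trans (Sparse.conv-geom-hit (λ (_ , d) → ℕ∣.∣1⇒≡1 d) {s} (supported-conv V (supported-unit q)) q (q-1 ℕ.∸ i) (+ k ℤ.- + (1 * i)) ℕₚ.≤-refl
          (ℕₚ.≤-<-trans (ℕₚ.m∸n≤m q-1 i) (ℕₚ.≤-reflexive (ℕₚ.suc-pred q))) (ℤ∣.divides (+ j) target))
        (trans (cong s target) (conv-∘-unit q V (+ j)))
        where
        lem : ∀ x y z → x ℤ.+ (y ℤ.+ z) ℤ.- z ℤ.- y ≡ x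
        lem = solve-∀
        split : + k ≡ + (j * q) ℤ.+ (+ (q-1 ℕ.∸ i) ℤ.+ + i)
        split = cong (λ w → + (j * q ℕ.+ w)) (sym (ℕₚ.m∸n+n≡m (ℕₚ.<⇒≤pred i<q)))
        target : + k ℤ.- + (1 * i) ℤ.- + (1 * (q-1 ℕ.∸ i)) ≡ + j ℤ.* + q
        target = trans (cong₂ (λ v w → + k ℤ.- + v ℤ.- + w) (ℕₚ.*-identityˡ i) (ℕₚ.*-identityˡ (q-1 ℕ.∸ i)))
          (trans (cong (λ w → w ℤ.- + i ℤ.- + (q-1 ℕ.∸ i)) split) (trans (lem (+ (j * q)) (+ (q-1 ℕ.∸ i)) (+ i)) (ℤₚ.pos-* j q)))

    -- Maximality of `m` bounds p times each coefficient of V. Dividing by p gives a bound on the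
    -- coefficients themselves, as `height≤` requires, and multiplying the rounded quotient back
    -- does not exceed `m`.
    lower : p * height V ≤ m
    lower = ℕₚ.≤-trans (subst (_≤ m / p * p) (ℕₚ.*-comm (height V) p) (ℕₚ.*-monoˡ-≤ p (height≤ V coeff-bound))) (m/n*n≤m m p)
      where
      coeff-bound : ∀ j → ∣ coeff V j ∣ ≤ m / p
      coeff-bound j = subst (_≤ m / p) (m*n/n≡m ∣ coeff V j ∣ p) (/-mono-≤ (ℕₚ.≤-trans (ℕₚ.≤-reflexive eq)
          (ℕₚ.≤-trans (coeff≤height f* (j * q ℕ.+ q-1)) (maximal f* _ f*-divides))) ℕₚ.≤-refl)
        where
        eq : ∣ coeff V j ∣ * p ≡ ∣ coeff f* (j * q ℕ.+ q-1) ∣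
        eq = trans (ℕₚ.*-comm ∣ coeff V j ∣ p) (sym (trans (cong ∣_∣ (coeff-f* j)) (ℤₚ.abs-* (+ p) (coeff V j))))

  p∣B : p ℕ∣.∣ m
  p∣B = from (decompose fg)
    where
    from : (∃ λ a → ∃ λ d → ∃ λ e → ∃ λ c → ∃ λ f₁ → ∃ λ g₁ → f ≈ part a d e c ⊗ f₁ × f₁ ⊗ g₁ ≈ W) → p ℕ∣.∣ m
    from (a , d , e , c , f₁ , g₁ , f≈ , f₁g₁) = finish (power-of-X^ q f₁ (PowerOf.f-vanish pp qp p<q b-1 {f₁} {g₁}
        (≈-trans (lem f₁ (X^n-1 r) g₁) (≈-trans (R.*-congˡ f₁g₁) X^n-1-W))))
      where
      opaque
        unfolding _⊕_
        lem : ∀ a b c → a ⊗ (b ⊗ c) ≈ b ⊗ (a ⊗ c)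
        lem = solve-∀-in polyACR
      finish : (∃ λ V → f₁ ≈ V ∘ₚ (X ^ₚ q)) → p ℕ∣.∣ m
      finish (V , f₁≈) = subst (p ℕ∣.∣_) (ℕₚ.≤-antisym (lower {V = V} f₁g₁ f₁≈) (upper {V = V} f₁g₁ f₁≈ a d e c f≈)) (ℕ∣.m∣m*n (height V))

theorem1p4 : ∀ (p q : ℕ) (p-prime : Prime p) (q-prime : Prime q) → p < q →
    ∀ (b : ℕ) .{{_ : NonZero b}} →
    p ∣ B (p * q ^ b) {{pq^b-nonZero p-prime q-prime b}}
theorem1p4 p q p-prime q-prime p<q zero    = ⊥-elim (ℕ.≢-nonZero⁻¹ 0 refl)
theorem1p4 p q p-prime q-prime p<q (suc b) = Main.p∣B p-prime q-prime p<q b
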